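{- For all $3\le k<\ell$ with $\ell$ not divisible by $k$: (i) $\delta_{C_\ell^{(k)}}\ge \frac12+\frac{1}{4(\ell-1)}$; (ii) if $k/\gcd(\ell,k)$ is even, then $\delta_{C_\ell^{(k)}}\ge\frac12+\frac{1}{2(\ell-1)}$; and (iii) if $\gcd(\ell,k)=1$ and $k$ is odd, then $\delta_{C_\ell^{(k)}}\ge\frac12+\frac{1-2^{ -k}}{2(\ell-1)}$.
   Context: A $k$-graph is a $k$-uniform hypergraph. For $\ell>k\ge 2$, the tight cycle $C_\ell^{(k)}$ is the $k$-graph with vertices $v_1,\dots,v_\ell$ and edges $\{v_i,v_{i+1},\dots,v_{i+k-1}\}$, $i\in\{1,\dots,\ell\}$, indices modulo $\ell$. The degree of a vertex of $H$ is the number of edges of $H$ containing it. $\delta_{k-1}(H)$ is the minimum, over all $(k-1)$-sets $S\subseteq V(H)$, of the number of edges of $H$ containing $S$. A $C_\ell^{(k)}$-decomposition of $H$ is a collection of subgraphs of $H$, each isomorphic to $C_\ell^{(k)}$, such that every edge of $H$ is covered exactly once. $H$ is $C_\ell^{(k)}$-divisible if $|E(H)|$ is divisible by $\ell$ and the degree of every vertex is divisible by $k$. $\delta_{C_\ell^{(k)}}$ is the least $d>0$ such that for every $\varepsilon>0$ there exists $n_0$ such that any $C_\ell^{(k)}$-divisible $k$-graph $H$ on $n\ge n_0$ vertices with $\delta_{k-1}(H)\ge(d+\varepsilon)n$ admits a $C_\ell^{(k)}$-decomposition. -}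

module Defs where

open import Data.Fin.Base using (Fin; toℕ)
open import Data.Fin.Properties using (nonZeroIndex)
open import Data.Fin.Subset using (Subset; inside; outside; ⁅_⁆; ⋃; ∣_∣)
open import Data.Fin.Subset.Properties using (_∈?_; _⊆?_)
open import Data.Integer.Base using (+_)
open import Data.List.Base using (List; []; _∷_; _++_; map; filter; length; upTo; allFin; concatMap)
open import Data.List.Extrema.Nat using (min)
open import Data.List.Relation.Binary.Permutation.Propositional using (_↭_)
open import Data.List.Relation.Unary.All using (All)
open import Data.List.Relation.Unary.Unique.Propositional using (Unique)
open import Data.Nat.Base as ℕ using (ℕ; zero; suc; _∸_)
open import Data.Nat.DivMod using (_mod_)
open import Data.Nat.Divisibility using (_∣_)
import Data.Nat.Properties as ℕ
open import Data.Product using (Σ; ∃-syntax; _×_; _,_)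
open import Data.Rational.Base as ℚ using (ℚ; 0ℚ; 1ℚ)
import Data.Rational.Properties as ℚ
import Data.Vec.Base as Vec
open import Function.Definitions using (Injective)
open import Relation.Binary.Definitions using (tri<; tri≈; tri>)
open import Relation.Binary.PropositionalEquality
  using (_≡_; refl; sym; trans; cong; subst)
open import Relation.Nullary using (¬_; contradiction)

-- Real numbers as Dedekind cuts: a real is the set of rationals strictly
-- below it, a nonempty proper subset of ℚ that is downward closed and has no
-- largest element.

record ℝ : Set₁ where
  field
    _∋_       : ℚ → Set
    nonempty  : ∃[ q ] _∋_ q
    proper    : ∃[ q ] ¬ _∋_ q
    down      : ∀ {p q} → p ℚ.< q → _∋_ q → _∋_ p
    noLargest : ∀ {p} → _∋_ p → ∃[ q ] (p ℚ.< q × _∋_ q)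

open ℝ public using (_∋_)

infix 4 _<ᴿ_ _≤ᴿ_

_<ᴿ_ : ℝ → ℝ → Set
x <ᴿ y = ∃[ q ] ((y ∋ q) × ¬ (x ∋ q))

-- Classically this is inclusion of cuts; the negative form is the
-- constructively meaningful one.
_≤ᴿ_ : ℝ → ℝ → Set
x ≤ᴿ y = ¬ (y <ᴿ x)

private
  p-1<p : ∀ p → p ℚ.- 1ℚ ℚ.< p
  p-1<p p = subst (p ℚ.- 1ℚ ℚ.<_) (ℚ.+-identityʳ p)
              (ℚ.+-monoʳ-< p (ℚ.neg-antimono-< (ℚ.positive⁻¹ 1ℚ)))

  cancel : ∀ p q → (p ℚ.- q) ℚ.+ q ≡ p
  cancel p q = trans (ℚ.+-assoc p (ℚ.- q) q)
    (trans (cong (p ℚ.+_) (ℚ.+-inverseˡ q)) (ℚ.+-identityʳ p))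

  cancel′ : ∀ p q → (p ℚ.+ q) ℚ.- q ≡ p
  cancel′ p q = trans (ℚ.+-assoc p q (ℚ.- q))
    (trans (cong (p ℚ.+_) (ℚ.+-inverseʳ q)) (ℚ.+-identityʳ p))

  member<nonmember : ∀ (x : ℝ) {p q} → x ∋ p → ¬ (x ∋ q) → p ℚ.< q
  member<nonmember x {p} {q} p∈ q∉ with ℚ.<-cmp p q
  ... | tri< p<q _ _  = p<q
  ... | tri≈ _ refl _ = contradiction p∈ q∉
  ... | tri> _ _ q<p  = contradiction (ℝ.down x q<p p∈) q∉

fromℚ : ℚ → ℝ
fromℚ r = record
  { _∋_       = ℚ._< r
  ; nonempty  = r ℚ.- 1ℚ , p-1<p r
  ; proper    = r , ℚ.<-irrefl refl
  ; down      = ℚ.<-trans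
  ; noLargest = λ p<r → let (m , p<m , m<r) = ℚ.<-dense p<r in m , p<m , m<r
  }

fromℕ : ℕ → ℝ
fromℕ m = fromℚ (+ m ℚ./ 1)

0ᴿ : ℝ
0ᴿ = fromℚ 0ℚ

infixl 6 _+ᴿ_
infixr 7 _·_

_+ᴿ_ : ℝ → ℝ → ℝ
x +ᴿ y = record
  { _∋_       = λ q → ∃[ a ] ∃[ b ] ((x ∋ a) × (y ∋ b) × q ≡ a ℚ.+ b)
  ; nonempty  = let (a , a∈) = ℝ.nonempty x ; (b , b∈) = ℝ.nonempty y
                in a ℚ.+ b , a , b , a∈ , b∈ , refl
  ; proper    = let (u , u∉) = ℝ.proper x ; (v , v∉) = ℝ.proper y
                in u ℚ.+ v , λ (a , b , a∈ , b∈ , eq) →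
                     ℚ.<-irrefl (sym eq)
                       (ℚ.+-mono-< (member<nonmember x a∈ u∉) (member<nonmember y b∈ v∉))
  ; down      = λ { {p} p<q (a , b , a∈ , b∈ , refl) →
                    p ℚ.- b , b
                  , ℝ.down x (subst (p ℚ.- b ℚ.<_) (cancel′ a b) (ℚ.+-monoˡ-< (ℚ.- b) p<q)) a∈
                  , b∈ , sym (cancel p b) }
  ; noLargest = λ { (a , b , a∈ , b∈ , refl) →
                    let (a′ , a<a′ , a′∈) = ℝ.noLargest x a∈
                    in a′ ℚ.+ b , ℚ.+-monoˡ-< b a<a′ , a′ , b , a′∈ , b∈ , refl }
  }

_·_ : ℕ → ℝ → ℝ
zero  · x = 0ᴿ
suc n · x = x +ᴿ n · x

infixl 7 _⟋_

-- Division of a rational by a natural number, with value 0 for denominator 0.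
_⟋_ : ℚ → ℕ → ℚ
q ⟋ zero  = 0ℚ
q ⟋ suc d = q ℚ.* (+ 1 ℚ./ suc d)

-- k-graphs on the vertex set Fin n; the order of the edge list is irrelevant.
record KGraph (k n : ℕ) : Set where
  field
    edges   : List (Subset n)
    unique  : Unique edges
    uniform : All (λ e → ∣ e ∣ ≡ k) edges

open KGraph public using (edges)

module _ {k n : ℕ} where

  degree : KGraph k n → Fin n → ℕ
  degree H v = length (filter (v ∈?_) (edges H))

  codegree : KGraph k n → Subset n → ℕ
  codegree H S = length (filter (S ⊆?_) (edges H))

subsets : ∀ n → List (Subset n)
subsets zero    = Vec.[] ∷ []
subsets (suc n) = map (inside Vec.∷_) (subsets n) ++ map (outside Vec.∷_) (subsets n)

-- δ_{k-1}(H).  For k ≥ 1 a (k-1)-set lies in at most n edges, so the default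
-- value n only matters when there are no (k-1)-sets at all (n < k - 1).
minCodegree : ∀ {k n} → KGraph k n → ℕ
minCodegree {k} {n} H =
  min n (map (codegree H) (filter (λ S → ∣ S ∣ ℕ.≟ k ∸ 1) (subsets n)))

-- A tight cycle of length ℓ on vertices of Fin n: a sequence of ℓ distinct
-- vertices v₀ , … , v_{ℓ-1}.
record TightCycle (ℓ n : ℕ) : Set where
  field
    vertex   : Fin ℓ → Fin n
    distinct : Injective _≡_ _≡_ vertex

open TightCycle public using (vertex)

-- { v_i , v_{i+1} , … , v_{i+k-1} }, indices modulo ℓ.
cycleEdge : ∀ {ℓ n} → ℕ → TightCycle ℓ n → Fin ℓ → Subset n
cycleEdge {ℓ} k C i =
  ⋃ (map (λ j → ⁅ vertex C (_mod_ (toℕ i ℕ.+ j) ℓ {{nonZeroIndex i}}) ⁆) (upTo k))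

cycleEdges : ∀ {ℓ n} → ℕ → TightCycle ℓ n → List (Subset n)
cycleEdges {ℓ} k C = map (cycleEdge k C) (allFin ℓ)

-- The ℓ edges of a tight cycle are pairwise distinct since k < ℓ.  Equality
-- of the concatenated edge lists with the (duplicate-free) edge list of H as
-- multisets thus says that every cycle is a subgraph of H and that every edge
-- of H lies in exactly one of the cycles.
HasDecomposition : ∀ {k n} → ℕ → KGraph k n → Set
HasDecomposition {k} {n} ℓ H =
  Σ (List (TightCycle ℓ n)) λ Cs → concatMap (cycleEdges k) Cs ↭ edges H

Divisible : ∀ {k n} → ℕ → KGraph k n → Set
Divisible {k} ℓ H = (ℓ ∣ length (edges H)) × (∀ v → k ∣ degree H v)

Forces : (k ℓ : ℕ) → ℝ → Set₁
Forces k ℓ d = ∀ (ε : ℝ) → 0ᴿ <ᴿ ε → Σ ℕ λ n₀ →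
  ∀ n → n₀ ℕ.≤ n → (H : KGraph k n) → Divisible ℓ H →
  n · (d +ᴿ ε) ≤ᴿ fromℕ (minCodegree H) → HasDecomposition ℓ H

-- δ is the least d > 0 with Forces k ℓ d.
record IsThreshold (k ℓ : ℕ) (δ : ℝ) : Set₁ where
  field
    positive : 0ᴿ <ᴿ δ
    forces   : Forces k ℓ δ
    least    : ∀ d → 0ᴿ <ᴿ d → Forces k ℓ d → δ ≤ᴿ d

{-# OPTIONS --safe #-}
module Submission where

open import Defs
open import Data.Nat.Base using (ℕ; _≤_; _<_; _∸_; _*_; _^_)
open import Data.Nat.Divisibility using (_∣_; quotient)
open import Data.Nat.GCD using (gcd; gcd[m,n]∣n)
open import Data.Product using (_×_)
open import Relation.Binary.PropositionalEquality using (_≡_)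
open import Relation.Nullary using (¬_)

-- Vertices carry labels from an abelian group, and edges are selected by their label sum, so that codegrees
-- can be read off.  Split V into halves A and B and take all k-sets meeting A in an odd number of vertices,
-- plus a sparse family of extra k-sets of even type; every codegree is then about (1/2 + q) n, where q is the
-- density of the extra edges.  Neighbouring windows of a tight cycle meet A in numbers differing by at most
-- one, so a cycle without extra edges has constant type c with ℓ c = k |A ∩ C|, whence k / gcd(ℓ,k) divides c.
-- The edges of the remaining types are covered only by cycles containing one of the few extra edges, which is
-- impossible for small q.  All edges are of this kind if k / gcd(ℓ,k) is even, and at least half of them in one
-- of the two parity classes in general.  If gcd(ℓ,k) = 1 and k ≥ 5 is odd, only the edges inside A are not, and
-- this is compensated by a type of extra edge that never occurs alone in a cycle.  Divisibility is automatic,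
-- since the label classes have a size t for which all binomials C(t,j), 1 ≤ j ≤ k, are divisible by k ℓ.
--
-- For k = 3 take instead three classes and all triples meeting exactly two of them.  Along every tight cycle the
-- number of triples of type {0,0,1} is congruent modulo 3 to that of type {0,1,1}; deleting a small family of
-- triples that respects divisibility but violates this congruence shows that the threshold is at least 2/3.

-- The counting is weak linear programming duality. Put `L = ℓ - 1`. If a cycle has `u ≥ 1` extra
-- edges, it has at most `ℓ - u ≤ L * u` others, so a decomposition forces the edges of the dense
-- parity, apart from exempt types, to be at most `L` times as many as the extra edges. Letting
-- `r / m` approach `1 / L` gives the summand `1 / (2 * L)`; if half of the dense edges are exempt,
-- it is halved. The constants in `m = L * r + 3` and `m = 2 * L * r + 5` pay for the boundary
-- terms. For odd `k ≥ 5` coprime to `ℓ` the obstruction reaches the value of (ii), and (iii)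
-- follows from `1 - 2^(-k) ≤ 1`. For `k = 3` the compensating type may have to be `k - 3 = 0`, and
-- triples outside `A` are only as numerous as those inside `A`; this is why another construction
-- takes over.

module Barriers where

  open import Data.Bool.Base using (Bool; true; false; T; _∧_; _∨_; not; if_then_else_; _xor_)
  open import Data.Bool.Properties using (not-involutive; not-injective; T-∧; T-≡; T?)
  open import Data.Fin.Base as Fin using (Fin; zero; suc; toℕ; fromℕ<; splitAt; _↑ˡ_; _↑ʳ_)
  open import Data.Fin.Properties as Fin using (splitAt-↑ˡ; splitAt-↑ʳ; splitAt⁻¹-↑ˡ; splitAt⁻¹-↑ʳ; toℕ-injective; toℕ-fromℕ<; all?)
  open import Data.Fin.Subset using (Subset; inside; outside; ∣_∣; ⁅_⁆; ⋃; _∪_; _∈_; _∉_)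
  open import Data.Fin.Subset.Properties using (_∈?_; _⊆?_; ∪-identityˡ; x∈p∪q⁻; x∈⁅y⁆⇒x≡y; ∉⊥)
  open import Data.Integer.Base as ℤ using (ℤ)
  import Data.Integer.Properties as ℤ
  import Data.Integer.Tactic.RingSolver as ℤSolver
  open import Data.List.Base as List using (List; []; _∷_; map; filter; length; upTo; applyUpTo; allFin; tabulate; concatMap)
  open import Data.List.Extrema.Nat using (v≤min⁺)
  open import Data.List.Membership.Propositional using () renaming (_∉_ to _∉ₗ_)
  open import Data.List.Membership.Propositional.Properties using (∈-map⁻; ∈-allFin)
  open import Data.List.Properties using (map-++; map-∘; map-cong; map-applyUpTo; map-tabulate)
  open import Data.List.Relation.Binary.Permutation.Propositional using (↭-sym)
  open import Data.List.Relation.Binary.Permutation.Propositional.Properties using (map⁺; All-resp-↭)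
  open import Data.List.Relation.Unary.All as All using (All)
  import Data.List.Relation.Unary.All.Properties as All
  import Data.List.Relation.Unary.AllPairs as AllPairs
  open import Data.List.Relation.Unary.Any using (here; there)
  open import Data.List.Relation.Unary.Unique.Propositional using (Unique)
  import Data.List.Relation.Unary.Unique.Propositional.Properties as Unique
  open import Data.Nat.Base as ℕ
  open import Data.Nat.DivMod using (_mod_; %-distribˡ-+; m<n⇒m%n≡m; m≤n⇒[n∸m]%m≡n%m; m%n<n; [m+n]%n≡m%n; m≡m%n+[m/n]*n)
  open import Data.Nat.Divisibility
  open import Data.Nat.GCD using (gcd[m,n]∣m; gcd[m,n]≢0; gcd-greatest; c*gcd[m,n]≡gcd[cm,cn])
  open import Data.Nat.ListAction using (sum)
  open import Data.Nat.ListAction.Properties using (sum-++; sum-↭)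
  open import Data.Nat.Properties
  open import Data.Nat.Tactic.RingSolver using (solve-∀)
  open import Data.Product using (Σ; ∃; ∃-syntax; _,_; proj₁; proj₂)
  open import Data.Rational.Base as ℚ using (ℚ; 0ℚ; ½; 1ℚ; mkℚ; ↧_; toℚᵘ; fromℚᵘ)
  import Data.Rational.Properties as ℚ
  open import Data.Rational.Unnormalised.Base as ℚᵘ using (mkℚᵘ; *≡*; *≤*; *<*)
  import Data.Rational.Unnormalised.Properties as ℚᵘ
  open import Data.Sum.Base using (_⊎_; inj₁; inj₂; [_,_]′)
  open import Data.Unit.Base using (tt)
  open import Data.Vec.Base as Vec using (Vec; []; _∷_; lookup; _++_; take; drop; replicate; _[_]≔_)
  open import Data.Vec.Properties using ([]=⇒lookup; lookup⇒[]=; take++drop≡id; lookup-++ˡ; lookup-++ʳ; lookup∘update; lookup∘update′)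
  open import Function.Base using (_∘_; const; case_of_; id)
  open import Function.Bundles using (Equivalence)
  import Level
  open import Relation.Binary.Definitions using (tri<; tri≈; tri>)
  open import Relation.Binary.PropositionalEquality
  open import Relation.Nullary using (contradiction; does; yes; no)
  open import Relation.Nullary.Decidable using (dec-true; _→-dec_; from-yes; from-no)
  open import Relation.Unary using (Pred; Decidable)

  private variable
    n : ℕ

  -- Sums over vertices and over subsets of the vertex set

  ind : Bool → ℕ
  ind true  = 1
  ind false = 0

  ind≤1 : ∀ b → ind b ≤ 1
  ind≤1 true  = ≤-refl
  ind≤1 false = z≤n

  +-interchange : ∀ a b c d → (a + b) + (c + d) ≡ (a + c) + (b + d)
  +-interchange = solve-∀

  sumF : ∀ n → (Fin n → ℕ) → ℕ
  sumF zero    h = 0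
  sumF (suc n) h = h zero + sumF n (h ∘ suc)

  sumF-cong : ∀ {h h′ : Fin n → ℕ} → (∀ v → h v ≡ h′ v) → sumF n h ≡ sumF n h′
  sumF-cong {zero}  eq = refl
  sumF-cong {suc n} eq = cong₂ _+_ (eq zero) (sumF-cong (eq ∘ suc))

  sumF-+ : ∀ (h h′ : Fin n → ℕ) → sumF n (λ v → h v + h′ v) ≡ sumF n h + sumF n h′
  sumF-+ {zero}  h h′ = refl
  sumF-+ {suc n} h h′ = trans (cong₂ _+_ refl (sumF-+ (h ∘ suc) (h′ ∘ suc)))
                              (+-interchange (h zero) (h′ zero) _ _)

  sumF-const : ∀ n c → sumF n (λ _ → c) ≡ n * c
  sumF-const zero    c = refl
  sumF-const (suc n) c = cong (c +_) (sumF-const n c)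

  sumS : ∀ n → (Subset n → ℕ) → ℕ
  sumS zero    f = f []
  sumS (suc n) f = sumS n (f ∘ (inside ∷_)) + sumS n (f ∘ (outside ∷_))

  sumS-cong : ∀ {f g : Subset n → ℕ} → (∀ e → f e ≡ g e) → sumS n f ≡ sumS n g
  sumS-cong {zero}  eq = eq []
  sumS-cong {suc n} eq = cong₂ _+_ (sumS-cong (eq ∘ (inside ∷_))) (sumS-cong (eq ∘ (outside ∷_)))

  sumS-mono : ∀ {f g : Subset n → ℕ} → (∀ e → f e ≤ g e) → sumS n f ≤ sumS n g
  sumS-mono {zero}  le = le []
  sumS-mono {suc n} le = +-mono-≤ (sumS-mono (le ∘ (inside ∷_))) (sumS-mono (le ∘ (outside ∷_)))

  sumS-+ : ∀ (f g : Subset n → ℕ) → sumS n (λ e → f e + g e) ≡ sumS n f + sumS n g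
  sumS-+ {zero}  f g = refl
  sumS-+ {suc n} f g = trans (cong₂ _+_ (sumS-+ (f ∘ (inside ∷_)) _) (sumS-+ (f ∘ (outside ∷_)) _))
                             (+-interchange (sumS n (f ∘ (inside ∷_))) _ _ _)

  sumS-* : ∀ c (f : Subset n → ℕ) → sumS n (λ e → c * f e) ≡ c * sumS n f
  sumS-* {zero}  c f = refl
  sumS-* {suc n} c f = trans (cong₂ _+_ (sumS-* c (f ∘ (inside ∷_))) (sumS-* c (f ∘ (outside ∷_)))) (sym (*-distribˡ-+ c _ _))

  sumS-zero : ∀ n → sumS n (λ _ → 0) ≡ 0
  sumS-zero zero    = refl
  sumS-zero (suc n) = cong₂ _+_ (sumS-zero n) (sumS-zero n)

  sumS-∣ : ∀ {d} {f : Subset n → ℕ} → (∀ e → d ∣ f e) → d ∣ sumS n f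
  sumS-∣ {zero}  div = div []
  sumS-∣ {suc n} div = ∣m∣n⇒∣m+n (sumS-∣ (div ∘ (inside ∷_))) (sumS-∣ (div ∘ (outside ∷_)))

  sumS-point : ∀ (f : Subset n → ℕ) e → f e ≤ sumS n f
  sumS-point f []           = ≤-refl
  sumS-point f (true ∷ e)  = ≤-trans (sumS-point (f ∘ (inside ∷_)) e) (m≤m+n _ _)
  sumS-point f (false ∷ e) = ≤-trans (sumS-point (f ∘ (outside ∷_)) e) (m≤n+m _ _)

  sumIn sumOut : Subset n → (Fin n → ℕ) → ℕ
  sumIn []          h = 0
  sumIn (true ∷ e)  h = h zero + sumIn e (h ∘ suc)
  sumIn (false ∷ e) h = sumIn e (h ∘ suc)
  sumOut []          h = 0
  sumOut (true ∷ e)  h = sumOut e (h ∘ suc)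
  sumOut (false ∷ e) h = h zero + sumOut e (h ∘ suc)

  sumIn+sumOut : ∀ (e : Subset n) h → sumIn e h + sumOut e h ≡ sumF n h
  sumIn+sumOut []          h = refl
  sumIn+sumOut (true ∷ e)  h = trans (+-assoc (h zero) _ _) (cong (h zero +_) (sumIn+sumOut e (h ∘ suc)))
  sumIn+sumOut (false ∷ e) h = begin
    sumIn e _ + (h zero + sumOut e _) ≡⟨ +-comm (sumIn e _) _ ⟩
    h zero + sumOut e _ + sumIn e _   ≡⟨ +-assoc (h zero) _ _ ⟩
    h zero + (sumOut e _ + sumIn e _) ≡⟨ cong (h zero +_) (+-comm (sumOut e _) _) ⟩
    h zero + (sumIn e _ + sumOut e _) ≡⟨ cong (h zero +_) (sumIn+sumOut e (h ∘ suc)) ⟩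
    sumF _ h                          ∎
    where open ≡-Reasoning

  sumIn-cong : ∀ (e : Subset n) {h h′} → (∀ v → h v ≡ h′ v) → sumIn e h ≡ sumIn e h′
  sumIn-cong []          eq = refl
  sumIn-cong (true ∷ e)  eq = cong₂ _+_ (eq zero) (sumIn-cong e (eq ∘ suc))
  sumIn-cong (false ∷ e) eq = sumIn-cong e (eq ∘ suc)

  sumIn-mono : ∀ (e : Subset n) {h h′} → (∀ v → h v ≤ h′ v) → sumIn e h ≤ sumIn e h′
  sumIn-mono []          le = z≤n
  sumIn-mono (true ∷ e)  le = +-mono-≤ (le zero) (sumIn-mono e (le ∘ suc))
  sumIn-mono (false ∷ e) le = sumIn-mono e (le ∘ suc)

  sumIn-* : ∀ (e : Subset n) c h → sumIn e (λ v → c * h v) ≡ c * sumIn e h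
  sumIn-* []          c h = sym (*-zeroʳ c)
  sumIn-* (true ∷ e)  c h = trans (cong (c * h zero +_) (sumIn-* e c (h ∘ suc))) (sym (*-distribˡ-+ c _ _))
  sumIn-* (false ∷ e) c h = sumIn-* e c (h ∘ suc)

  sumIn-one : ∀ (e : Subset n) → sumIn e (λ _ → 1) ≡ ∣ e ∣
  sumIn-one []          = refl
  sumIn-one (true ∷ e)  = cong suc (sumIn-one e)
  sumIn-one (false ∷ e) = sumIn-one e

  sumOut-mono : ∀ (e : Subset n) {h h′} → (∀ v → lookup e v ≡ outside → h v ≤ h′ v) →
                sumOut e h ≤ sumOut e h′
  sumOut-mono []          le = z≤n
  sumOut-mono (true ∷ e)  le = sumOut-mono e (le ∘ suc)
  sumOut-mono (false ∷ e) le = +-mono-≤ (le zero refl) (sumOut-mono e (le ∘ suc))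

  sumOut-cong : ∀ (e : Subset n) {h h′} → (∀ v → lookup e v ≡ outside → h v ≡ h′ v) →
                sumOut e h ≡ sumOut e h′
  sumOut-cong []          eq = refl
  sumOut-cong (true ∷ e)  eq = sumOut-cong e (eq ∘ suc)
  sumOut-cong (false ∷ e) eq = cong₂ _+_ (eq zero refl) (sumOut-cong e (eq ∘ suc))

  sumOut-+ : ∀ (e : Subset n) h h′ → sumOut e (λ v → h v + h′ v) ≡ sumOut e h + sumOut e h′
  sumOut-+ []          h h′ = refl
  sumOut-+ (true ∷ e)  h h′ = sumOut-+ e (h ∘ suc) (h′ ∘ suc)
  sumOut-+ (false ∷ e) h h′ = trans (cong₂ _+_ refl (sumOut-+ e (h ∘ suc) (h′ ∘ suc)))
                              (+-interchange (h zero) (h′ zero) _ _)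

  sumOut-* : ∀ (e : Subset n) c h → sumOut e (λ v → c * h v) ≡ c * sumOut e h
  sumOut-* []          c h = sym (*-zeroʳ c)
  sumOut-* (false ∷ e) c h = trans (cong (c * h zero +_) (sumOut-* e c (h ∘ suc))) (sym (*-distribˡ-+ c _ _))
  sumOut-* (true ∷ e)  c h = sumOut-* e c (h ∘ suc)

  sumOut≤sumF : ∀ (e : Subset n) h → sumOut e h ≤ sumF n h
  sumOut≤sumF e h = subst (sumOut e h ≤_) (sumIn+sumOut e h) (m≤n+m _ _)

  -- Every pair v ∈ e arises exactly once from the pair v ∉ e ∖ {v}.
  double-count : ∀ n (G : Subset n → Fin n → ℕ) →
    sumS n (λ e → sumIn e (G e)) ≡ sumS n (λ S → sumOut S (λ v → G (S [ v ]≔ inside) v))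
  double-count zero    G = refl
  double-count (suc n) G = begin
    sumS n (λ e → G (inside ∷ e) zero + sumIn e (G (inside ∷ e) ∘ suc)) + sumS n (λ e → sumIn e (G (outside ∷ e) ∘ suc))
      ≡⟨ cong₂ (λ x y → x + y) (sumS-+ (λ e → G (inside ∷ e) zero) _) refl ⟩
    (A + sumS n (λ e → sumIn e (G (inside ∷ e) ∘ suc))) + sumS n (λ e → sumIn e (G (outside ∷ e) ∘ suc))
      ≡⟨ cong₂ _+_ (cong (A +_) (double-count n (λ e v → G (inside ∷ e) (suc v)))) (double-count n (λ e v → G (outside ∷ e) (suc v))) ⟩
    (A + B) + C
      ≡⟨ cong (_+ C) (+-comm A B) ⟩
    (B + A) + C
      ≡⟨ +-assoc B A C ⟩
    B + (A + C)
      ≡⟨ cong (B +_) (sumS-+ (λ S → G (inside ∷ S) zero) _) ⟨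
    _ ∎
    where
    open ≡-Reasoning
    A = sumS n (λ e → G (inside ∷ e) zero)
    B = sumS n (λ S → sumOut S (λ v → G (inside ∷ S [ v ]≔ inside) (suc v)))
    C = sumS n (λ S → sumOut S (λ v → G (outside ∷ S [ v ]≔ inside) (suc v)))

  -- Distinct `v` outside `S` give distinct enlarged sets, so no value of `g` is counted twice.
  sumOut≤sumS : ∀ (S : Subset n) (g : Subset n → ℕ) → sumOut S (λ v → g (S [ v ]≔ inside)) ≤ sumS n g
  sumOut≤sumS []          g = z≤n
  sumOut≤sumS (true ∷ S)  g = ≤-trans (sumOut≤sumS S (g ∘ (inside ∷_))) (m≤m+n _ _)
  sumOut≤sumS (false ∷ S) g = +-mono-≤ (sumS-point (g ∘ (inside ∷_)) S) (sumOut≤sumS S (g ∘ (outside ∷_)))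

  sumIn-insert : ∀ (S : Subset n) w v → lookup S v ≡ outside →
                 sumIn (S [ v ]≔ inside) w ≡ w v + sumIn S w
  sumIn-insert (false ∷ S) w zero    _  = refl
  sumIn-insert (true ∷ S)  w (suc v) eq = begin
    w zero + sumIn (S [ v ]≔ inside) (w ∘ suc) ≡⟨ cong (w zero +_) (sumIn-insert S (w ∘ suc) v eq) ⟩
    w zero + (w (suc v) + sumIn S (w ∘ suc))   ≡⟨ +-assoc (w zero) _ _ ⟨
    w zero + w (suc v) + sumIn S (w ∘ suc)     ≡⟨ cong₂ _+_ (+-comm (w zero) _) refl ⟩
    w (suc v) + w zero + sumIn S (w ∘ suc)     ≡⟨ +-assoc (w (suc v)) _ _ ⟩
    _ ∎
    where open ≡-Reasoning
  sumIn-insert (false ∷ S) w (suc v) eq = sumIn-insert S (w ∘ suc) v eq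

  ∣insert∣ : ∀ (S : Subset n) v → lookup S v ≡ outside → ∣ S [ v ]≔ inside ∣ ≡ suc ∣ S ∣
  ∣insert∣ S v eq = trans (sym (sumIn-one (S [ v ]≔ inside)))
                   (trans (sumIn-insert S (λ _ → 1) v eq) (cong suc (sumIn-one S)))

  -- Hypergraphs with a Boolean indicator

  sumL : {A : Set} → (A → ℕ) → List A → ℕ
  sumL w xs = sum (map w xs)

  sumL-filter : ∀ {A : Set} {P : Pred A Level.zero} (P? : Decidable P) (w : A → ℕ) xs →
                sumL w (filter P? xs) ≡ sumL (λ x → ind (does (P? x)) * w x) xs
  sumL-filter P? w []       = refl
  sumL-filter P? w (x ∷ xs) with does (P? x)
  ... | true  = cong₂ _+_ (sym (+-identityʳ (w x))) (sumL-filter P? w xs)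
  ... | false = sumL-filter P? w xs

  sumL-one : ∀ {A : Set} (xs : List A) → sumL (λ _ → 1) xs ≡ length xs
  sumL-one []       = refl
  sumL-one (x ∷ xs) = cong suc (sumL-one xs)

  sumL-subsets : ∀ n (w : Subset n → ℕ) → sumL w (subsets n) ≡ sumS n w
  sumL-subsets zero    w = +-identityʳ (w [])
  sumL-subsets (suc n) w = begin
    sum (map w (map (inside ∷_) (subsets n) List.++ map (outside ∷_) (subsets n)))
      ≡⟨ cong sum (map-++ w (map (inside ∷_) (subsets n)) _) ⟩
    sum (map w (map (inside ∷_) (subsets n)) List.++ map w (map (outside ∷_) (subsets n)))
      ≡⟨ sum-++ (map w (map (inside ∷_) (subsets n))) _ ⟩
    sum (map w (map (inside ∷_) (subsets n))) + sum (map w (map (outside ∷_) (subsets n)))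
      ≡⟨ cong₂ (λ x y → sum x + sum y) (sym (map-∘ (subsets n))) (sym (map-∘ (subsets n))) ⟩
    sumL (w ∘ (inside ∷_)) (subsets n) + sumL (w ∘ (outside ∷_)) (subsets n)
      ≡⟨ cong₂ _+_ (sumL-subsets n _) (sumL-subsets n _) ⟩
    sumS (suc n) w ∎
    where open ≡-Reasoning

  subsets-unique : ∀ n → Unique (subsets n)
  subsets-unique zero    = All.[] AllPairs.∷ AllPairs.[]
  subsets-unique (suc n) =
    Unique.++⁺ (Unique.map⁺ ∷-inj (subsets-unique n)) (Unique.map⁺ ∷-inj (subsets-unique n))
               λ {e} (p , q) → disj e (∈-map⁻ (inside ∷_) p) (∈-map⁻ (outside ∷_) q)
    where
    ∷-inj : ∀ {b} {x y : Subset n} → b ∷ x ≡ b ∷ y → x ≡ y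
    ∷-inj refl = refl
    disj : ∀ e → (∃ λ x → _ × e ≡ inside ∷ x) → ¬ (∃ λ y → _ × e ≡ outside ∷ y)
    disj e (_ , _ , refl) (_ , _ , ())

  hypergraph : ∀ {k n} (f : Subset n → Bool) → (∀ e → T (f e) → ∣ e ∣ ≡ k) → KGraph k n
  hypergraph {n = n} f unif = record
    { edges   = filter (T? ∘ f) (subsets n)
    ; unique  = Unique.filter⁺ (T? ∘ f) (subsets-unique n)
    ; uniform = All.map (λ {e} → unif e) (All.all-filter (T? ∘ f) (subsets n))
    }

  module _ {k n} (f : Subset n → Bool) (unif : ∀ e → T (f e) → ∣ e ∣ ≡ k) where

    private
      H = hypergraph f unif

    sumL-edges : ∀ w → sumL w (edges H) ≡ sumS n (λ e → ind (f e) * w e)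
    sumL-edges w = trans (sumL-filter (T? ∘ f) w (subsets n)) (sumL-subsets n _)

    ∣edges∣ : length (edges H) ≡ sumS n (ind ∘ f)
    ∣edges∣ = trans (sym (sumL-one (edges H)))
      (trans (sumL-edges _) (sumS-cong (λ e → *-identityʳ (ind (f e)))))

    private
      length-filter : ∀ {P : Pred (Subset n) Level.zero} (P? : Decidable P) →
        length (filter P? (edges H)) ≡ sumS n (λ e → ind (f e) * ind (does (P? e)))
      length-filter P? = trans (sym (sumL-one (filter P? (edges H))))
        (trans (sumL-filter P? _ (edges H)) (trans (sumL-edges _)
          (sumS-cong (λ e → cong (ind (f e) *_) (*-identityʳ _)))))

    degree-sum : ∀ v → degree H v ≡ sumS n (λ e → ind (f e) * ind (lookup e v))
    degree-sum v = trans (length-filter (v ∈?_))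
      (sumS-cong (λ e → cong (λ b → ind (f e) * ind b) (∈?-lookup e)))
      where
      ∈?-lookup : ∀ e → does (v ∈? e) ≡ lookup e v
      ∈?-lookup e with v ∈? e
      ... | yes p = sym ([]=⇒lookup p)
      ... | no ¬p with lookup e v in eq
      ...   | true  = contradiction (lookup⇒[]= v e eq) ¬p
      ...   | false = refl

    codegree-≥ : ∀ S → sumOut S (λ v → ind (f (S [ v ]≔ inside))) ≤ codegree H S
    codegree-≥ S = ≤-trans
      (≤-trans (sumOut-mono S (λ v _ → ≤-reflexive (sym (trans (cong (λ b → ind (f (S [ v ]≔ inside)) * ind b) (⊆-insert v)) (*-identityʳ _)))))
               (sumOut≤sumS S (λ e → ind (f e) * ind (does (S ⊆? e)))))
      (≤-reflexive (sym (length-filter (S ⊆?_))))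
      where
      ∈-insert : ∀ {n} (S : Subset n) v {u} → u ∈ S → u ∈ S [ v ]≔ inside
      ∈-insert (_ ∷ S) zero    Vec.here      = Vec.here
      ∈-insert (_ ∷ S) (suc v) Vec.here      = Vec.here
      ∈-insert (_ ∷ S) zero    (Vec.there p) = Vec.there p
      ∈-insert (_ ∷ S) (suc v) (Vec.there p) = Vec.there (∈-insert S v p)
      ⊆-insert : ∀ v → does (S ⊆? (S [ v ]≔ inside)) ≡ true
      ⊆-insert v with S ⊆? (S [ v ]≔ inside)
      ... | yes _ = refl
      ... | no ¬p = contradiction (λ {u} → ∈-insert S v {u}) ¬p

  -- Binomial coefficients and their divisibility

  sumN : ℕ → (ℕ → ℕ) → ℕ
  sumN zero    g = 0
  sumN (suc n) g = g 0 + sumN n (g ∘ suc)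

  sumN-cong : ∀ n {g g′} → (∀ i → g i ≡ g′ i) → sumN n g ≡ sumN n g′
  sumN-cong zero    eq = refl
  sumN-cong (suc n) eq = cong₂ _+_ (eq 0) (sumN-cong n (eq ∘ suc))

  sumN-+ : ∀ n g g′ → sumN n (λ i → g i + g′ i) ≡ sumN n g + sumN n g′
  sumN-+ zero    g g′ = refl
  sumN-+ (suc n) g g′ = trans (cong₂ _+_ refl (sumN-+ n (g ∘ suc) (g′ ∘ suc)))
                              (+-interchange (g 0) (g′ 0) _ _)

  sumN-zero : ∀ n → sumN n (λ _ → 0) ≡ 0
  sumN-zero zero    = refl
  sumN-zero (suc n) = sumN-zero n

  sumN-∣ : ∀ {d} n {g} → (∀ i → d ∣ g i) → d ∣ sumN n g
  sumN-∣ zero    div = _ ∣0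
  sumN-∣ (suc n) div = ∣m∣n⇒∣m+n (div 0) (sumN-∣ n (div ∘ suc))

  binom : ℕ → ℕ → ℕ
  binom n       zero    = 1
  binom zero    (suc k) = 0
  binom (suc n) (suc k) = binom n k + binom n (suc k)

  binom-absorb : ∀ n k → suc k * binom (suc n) (suc k) ≡ suc n * binom n k
  binom-absorb zero    zero    = refl
  binom-absorb zero    (suc k) = *-zeroʳ k
  binom-absorb (suc n) zero    = cong suc (binom-absorb n zero)
  binom-absorb (suc n) (suc k) = begin
    suc (suc k) * (x + y)          ≡⟨ lem k x y ⟩
    x + suc k * x + suc (suc k) * y ≡⟨ cong₂ (λ u v → x + u + v) (binom-absorb n k) (binom-absorb n (suc k)) ⟩
    x + suc n * binom n k + suc n * binom n (suc k) ≡⟨ +-assoc x _ _ ⟩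
    x + (suc n * binom n k + suc n * binom n (suc k)) ≡⟨ cong (x +_) (*-distribˡ-+ (suc n) (binom n k) _) ⟨
    suc (suc n) * x ∎
    where
    open ≡-Reasoning
    x = binom (suc n) (suc k)
    y = binom (suc n) (suc (suc k))
    lem : ∀ k x y → suc (suc k) * (x + y) ≡ x + suc k * x + suc (suc k) * y
    lem = solve-∀

  -- Pascal's rule. The range `J` is decoupled from `t` so that both halves of the recursion can be
  -- expanded to the same length; the surplus terms vanish.
  sumS-size : ∀ t J (h : ℕ → ℕ) → t ≤ J → sumS t (h ∘ ∣_∣) ≡ sumN (suc J) (λ j → binom t j * h j)
  sumS-size zero J h _ = sym (cong₂ _+_ (+-identityʳ (h 0)) (sumN-zero J) ⟨ trans ⟩ +-identityʳ (h 0))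
    where open import Function.Base using (_⟨_⟩_)
  sumS-size (suc t) (suc J) h (s≤s le) = begin
    sumS t (h ∘ suc ∘ ∣_∣) + sumS t (h ∘ ∣_∣)
      ≡⟨ cong₂ _+_ (sumS-size t J (h ∘ suc) le) (sumS-size t (suc J) h (m≤n⇒m≤1+n le)) ⟩
    sumN (suc J) (λ j → binom t j * h (suc j)) + (1 * h 0 + sumN (suc J) (λ j → binom t (suc j) * h (suc j)))
      ≡⟨ lem (sumN (suc J) (λ j → binom t j * h (suc j))) (1 * h 0) _ ⟩
    1 * h 0 + (sumN (suc J) (λ j → binom t j * h (suc j)) + sumN (suc J) (λ j → binom t (suc j) * h (suc j)))
      ≡⟨ cong (1 * h 0 +_) (sumN-+ (suc J) (λ j → binom t j * h (suc j)) (λ j → binom t (suc j) * h (suc j))) ⟨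
    1 * h 0 + sumN (suc J) (λ j → binom t j * h (suc j) + binom t (suc j) * h (suc j))
      ≡⟨ cong (1 * h 0 +_) (sumN-cong (suc J) (λ j → *-distribʳ-+ (h (suc j)) (binom t j) (binom t (suc j)))) ⟨
    sumN (suc (suc J)) (λ j → binom (suc t) j * h j) ∎
    where
    open ≡-Reasoning
    lem : ∀ a b c → a + (b + c) ≡ b + (a + c)
    lem = solve-∀

  Vanishing : (D k t : ℕ) → Set
  Vanishing D k t = ∀ j → suc j ≤ k → D ∣ binom t (suc j)

  -- By absorption `j * binom t j = t * binom (t - 1) (j - 1)`, and `j * D` divides `k ! *
  -- D`, hence `t`; cancelling `j` leaves `D`.
  factorial-vanishing : ∀ D k s → Vanishing D k (k ! * D * s)
  factorial-vanishing D k s j j<k = go (k ! * D * s) refl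
    where
    sj∣k! : suc j ∣ k !
    sj∣k! = ∣-trans (divides (j !) (*-comm (suc j) (j !))) (m≤n⇒m!∣n! j<k)
    go : ∀ t → t ≡ k ! * D * s → D ∣ binom t (suc j)
    go zero    eq = D ∣0
    go (suc t) eq = *-cancelˡ-∣ (suc j)
      (subst (suc j * D ∣_) (sym (binom-absorb t j))
        (∣-trans (subst (suc j * D ∣_) (sym eq)
          (∣-trans (*-monoˡ-∣ D sj∣k!) (m∣m*n s))) (m∣m*n (binom t j))))

  -- Subsets of the block are grouped by size. For sizes from 1 to `k` the binomial is a multiple of
  -- `D`, and beyond `k` the summand is zero, so only the empty set survives modulo `D`.
  block-sum : ∀ {D k t} → Vanishing D k t → (h : ℕ → ℕ) → (∀ j → k < j → h j ≡ 0) →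
              ∃[ r ] sumS t (h ∘ ∣_∣) ≡ h 0 + r × D ∣ r
  block-sum {D} {k} {t} nice h bd = _ , trans (sumS-size t t h ≤-refl) (cong₂ _+_ (+-identityʳ (h 0)) refl)
                      , sumN-∣ t div
    where
    div : ∀ j → D ∣ binom t (suc j) * h (suc j)
    div j with suc j ≤? k
    ... | yes le = ∣m⇒∣m*n (h (suc j)) (nice j le)
    ... | no ¬le = subst (D ∣_) (sym (trans (cong (binom t (suc j) *_) (bd (suc j) (≰⇒> ¬le))) (*-zeroʳ (binom t (suc j))))) (D ∣0)

  -- Vertex sets divided into blocks

  ++-elim : ∀ t {n} (P : Subset (t + n) → Set) → (∀ a b → P (a ++ b)) → ∀ e → P e
  ++-elim t P h e = subst P (take++drop≡id t e) (h (take t e) (drop t e))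

  sumS-++ : ∀ t n (f : Subset (t + n) → ℕ) → sumS (t + n) f ≡ sumS t (λ a → sumS n (λ b → f (a ++ b)))
  sumS-++ zero    n f = refl
  sumS-++ (suc t) n f = cong₂ _+_ (sumS-++ t n (f ∘ (inside ∷_))) (sumS-++ t n (f ∘ (outside ∷_)))

  sumF-++ : ∀ t n (h : Fin (t + n) → ℕ) → sumF (t + n) h ≡ sumF t (h ∘ (_↑ˡ n)) + sumF n (h ∘ (t ↑ʳ_))
  sumF-++ zero    n h = refl
  sumF-++ (suc t) n h = trans (cong (h zero +_) (sumF-++ t n (h ∘ suc))) (sym (+-assoc (h zero) _ _))

  sumIn-++ : ∀ {t n} (a : Subset t) (b : Subset n) h →
             sumIn (a ++ b) h ≡ sumIn a (h ∘ (_↑ˡ n)) + sumIn b (h ∘ (t ↑ʳ_))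
  sumIn-++ []          b h = refl
  sumIn-++ (true ∷ a)  b h = trans (cong (h zero +_) (sumIn-++ a b (h ∘ suc))) (sym (+-assoc (h zero) _ _))
  sumIn-++ (false ∷ a) b h = sumIn-++ a b (h ∘ suc)

  take-++ : ∀ {A : Set} {t n} (a : Vec A t) (b : Vec A n) → take t (a ++ b) ≡ a
  take-++ []      b = refl
  take-++ (x ∷ a) b = cong (x ∷_) (take-++ a b)

  drop-++ : ∀ {A : Set} {t n} (a : Vec A t) (b : Vec A n) → drop t (a ++ b) ≡ b
  drop-++ []      b = refl
  drop-++ (x ∷ a) b = drop-++ a b

  -- The vertex set Fin (M * t) consists of M consecutive blocks of size t.
  color : ∀ M t → Fin (M * t) → Fin M
  color (suc M) t v = [ const zero , suc ∘ color M t ]′ (splitAt t v)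

  cnt : ∀ M t → Subset (M * t) → Vec ℕ M
  cnt zero    t e = []
  cnt (suc M) t e = ∣ take t e ∣ ∷ cnt M t (drop t e)

  color-ˡ : ∀ M t i → color (suc M) t (i ↑ˡ (M * t)) ≡ zero
  color-ˡ M t i = cong [ const zero , suc ∘ color M t ]′ (splitAt-↑ˡ t i (M * t))

  color-ʳ : ∀ M t v → color (suc M) t (t ↑ʳ v) ≡ suc (color M t v)
  color-ʳ M t v = cong [ const zero , suc ∘ color M t ]′ (splitAt-↑ʳ t (M * t) v)

  cnt-++ : ∀ M t (a : Subset t) b → cnt (suc M) t (a ++ b) ≡ ∣ a ∣ ∷ cnt M t b
  cnt-++ M t a b = cong₂ (λ x y → ∣ x ∣ ∷ cnt M t y) (take-++ a b) (drop-++ a b)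

  sumF-color : ∀ M t (φ : Fin M → ℕ) → sumF (M * t) (φ ∘ color M t) ≡ t * sumF M φ
  sumF-color zero    t φ = sym (*-zeroʳ t)
  sumF-color (suc M) t φ = begin
    sumF (t + M * t) (φ ∘ color (suc M) t)
      ≡⟨ sumF-++ t (M * t) _ ⟩
    sumF t (λ i → φ (color (suc M) t (i ↑ˡ (M * t)))) + sumF (M * t) (λ v → φ (color (suc M) t (t ↑ʳ v)))
      ≡⟨ cong₂ _+_ (trans (sumF-cong (λ i → cong φ (color-ˡ M t i))) (sumF-const t (φ zero)))
                   (trans (sumF-cong (λ v → cong φ (color-ʳ M t v))) (sumF-color M t (φ ∘ suc))) ⟩
    t * φ zero + t * sumF M (φ ∘ suc)
      ≡⟨ *-distribˡ-+ t (φ zero) _ ⟨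
    t * sumF (suc M) φ ∎
    where open ≡-Reasoning

  dot : ∀ {M} → (Fin M → ℕ) → Vec ℕ M → ℕ
  dot w []      = 0
  dot w (x ∷ c) = x * w zero + dot (w ∘ suc) c

  total : ∀ {M} → Vec ℕ M → ℕ
  total = dot (λ _ → 1)

  sumIn-const : ∀ {n} (e : Subset n) c → sumIn e (λ _ → c) ≡ ∣ e ∣ * c
  sumIn-const []          c = refl
  sumIn-const (true ∷ e)  c = cong (c +_) (sumIn-const e c)
  sumIn-const (false ∷ e) c = sumIn-const e c

  sumIn-color : ∀ M t (w : Fin M → ℕ) e → sumIn e (w ∘ color M t) ≡ dot w (cnt M t e)
  sumIn-color zero    t w [] = refl
  sumIn-color (suc M) t w = ++-elim t _ λ a b → begin
    sumIn (a ++ b) (w ∘ color (suc M) t)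
      ≡⟨ sumIn-++ a b _ ⟩
    sumIn a (λ i → w (color (suc M) t (i ↑ˡ (M * t)))) + sumIn b (λ v → w (color (suc M) t (t ↑ʳ v)))
      ≡⟨ cong₂ _+_ (trans (sumIn-cong a (λ i → cong w (color-ˡ M t i))) (sumIn-const a (w zero)))
                   (trans (sumIn-cong b (λ v → cong w (color-ʳ M t v))) (sumIn-color M t (w ∘ suc) b)) ⟩
    ∣ a ∣ * w zero + dot (w ∘ suc) (cnt M t b)
      ≡⟨ cong (dot w) (cnt-++ M t a b) ⟨
    dot w (cnt (suc M) t (a ++ b)) ∎
    where open ≡-Reasoning

  total-cnt : ∀ M t e → total (cnt M t e) ≡ ∣ e ∣
  total-cnt M t e = trans (sym (sumIn-color M t (λ _ → 1) e)) (sumIn-one e)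

  -- On count vectors, `mono` says that the set lies inside a single block; the empty set qualifies
  -- too.
  allZero mono : ∀ {M} → Vec ℕ M → Bool
  allZero []          = true
  allZero (zero ∷ c)  = allZero c
  allZero (suc _ ∷ c) = false
  mono []          = true
  mono (zero ∷ c)  = mono c
  mono (suc _ ∷ c) = allZero c

  allZero-replicate : ∀ M → T (allZero (replicate M 0))
  allZero-replicate zero    = tt
  allZero-replicate (suc M) = allZero-replicate M

  mono-replicate : ∀ M → T (mono (replicate M 0))
  mono-replicate zero    = tt
  mono-replicate (suc M) = mono-replicate M

  mono-single : ∀ M j → T (mono (j ∷ replicate M 0))
  mono-single M zero    = mono-replicate M
  mono-single M (suc j) = allZero-replicate M

  lookup⇒∣∣>0 : ∀ (a : Subset n) i → lookup a i ≡ true → 0 < ∣ a ∣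
  lookup⇒∣∣>0 (true ∷ a)  i       eq = s≤s z≤n
  lookup⇒∣∣>0 (false ∷ a) (suc i) eq = lookup⇒∣∣>0 a i eq

  data Side-of (t n : ℕ) : Fin (t + n) → Set where
    left  : ∀ i → Side-of t n (i ↑ˡ n)
    right : ∀ v → Side-of t n (t ↑ʳ v)

  side : ∀ t n v → Side-of t n v
  side t n v with splitAt t v in eq
  ... | inj₁ i = subst (Side-of t n) (splitAt⁻¹-↑ˡ eq) (left i)
  ... | inj₂ j = subst (Side-of t n) (splitAt⁻¹-↑ʳ eq) (right j)

  allZero-empty : ∀ M t e v → T (allZero (cnt M t e)) → ¬ (lookup e v ≡ true)
  allZero-empty (suc M) t e v = ++-elim t (λ e → T (allZero (cnt (suc M) t e)) → ¬ (lookup e v ≡ true)) go e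
    where
    go : ∀ a b → T (allZero (cnt (suc M) t (a ++ b))) → ¬ (lookup (a ++ b) v ≡ true)
    go a b rewrite cnt-++ M t a b with side t (M * t) v
    go a b | left i with ∣ a ∣ | lookup⇒∣∣>0 a i
    ... | zero  | pos = λ _ eq → case pos (trans (sym (lookup-++ˡ a b i)) eq) of λ ()
    ... | suc _ | _   = λ ()
    go a b | right j with ∣ a ∣
    ... | zero  = λ z eq → allZero-empty M t b j z (trans (sym (lookup-++ʳ a b j)) eq)
    ... | suc _ = λ ()

  mono⇒color : ∀ M t e u v → T (mono (cnt M t e)) → lookup e u ≡ true → lookup e v ≡ true →
               color M t u ≡ color M t v
  mono⇒color (suc M) t e u v =
    ++-elim t (λ e → T (mono (cnt (suc M) t e)) → lookup e u ≡ true → lookup e v ≡ true →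
                     color (suc M) t u ≡ color (suc M) t v) go e
    where
    absurd : ∀ a b i j → T (mono (∣ a ∣ ∷ cnt M t b)) → lookup a i ≡ true → ¬ (lookup b j ≡ true)
    absurd a b i j z eqi eqj with ∣ a ∣ | lookup⇒∣∣>0 a i eqi
    ... | suc _ | _ = allZero-empty M t b j z eqj
    go : ∀ a b → T (mono (cnt (suc M) t (a ++ b))) → lookup (a ++ b) u ≡ true → lookup (a ++ b) v ≡ true →
         color (suc M) t u ≡ color (suc M) t v
    go a b z equ eqv rewrite cnt-++ M t a b with side t (M * t) u | side t (M * t) v
    ... | left i  | left j  = trans (color-ˡ M t i) (sym (color-ˡ M t j))
    ... | left i  | right j = contradiction (trans (sym (lookup-++ʳ a b j)) eqv)
                                (absurd a b i j z (trans (sym (lookup-++ˡ a b i)) equ))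
    ... | right i | left j  = contradiction (trans (sym (lookup-++ʳ a b i)) equ)
                                (absurd a b j i z (trans (sym (lookup-++ˡ a b j)) eqv))
    ... | right i | right j with ∣ a ∣
    ...   | zero  = trans (color-ʳ M t i) (trans (cong suc (mono⇒color M t b i j z
                      (trans (sym (lookup-++ʳ a b i)) equ) (trans (sym (lookup-++ʳ a b j)) eqv))) (sym (color-ʳ M t j)))
    ...   | suc _ = contradiction (trans (sym (lookup-++ʳ a b j)) eqv) (allZero-empty M t b j z)

  -- Divisibility of edge numbers and degrees

  module _ {D k t : ℕ} (nice : Vanishing D k t) where

    Bounded : ∀ {M} → (Vec ℕ M → ℕ) → Set
    Bounded F = ∀ c → k < total c → F c ≡ 0

    private
      bounded-∷ : ∀ {M} (F : Vec ℕ (suc M) → ℕ) → Bounded F → ∀ j → Bounded (λ c → F (j ∷ c))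
      bounded-∷ F bd j c lt = bd (j ∷ c) (≤-trans lt (m≤n+m _ (j * 1)))

      large-head : ∀ {M} (F : Vec ℕ (suc M) → ℕ) → Bounded F → ∀ j c → k < j → F (j ∷ c) ≡ 0
      large-head F bd j c lt = bd (j ∷ c) (≤-trans lt (≤-trans (≤-reflexive (sym (*-identityʳ j))) (m≤m+n (j * 1) _)))

    -- Modulo D every block may be replaced by the empty one.
    sum-mod : ∀ M (F : Vec ℕ M → ℕ) → Bounded F →
              ∃[ r ] sumS (M * t) (F ∘ cnt M t) ≡ F (replicate M 0) + r × D ∣ r
    sum-mod zero    F bd = 0 , sym (+-identityʳ (F [])) , D ∣0
    sum-mod (suc M) F bd =
      let G = λ j → sumS (M * t) (λ b → F (j ∷ cnt M t b))
          (r , eq , D∣r) = block-sum {t = t} nice G (λ j lt → trans (sumS-cong {n = M * t} (λ b → large-head F bd j _ lt)) (sumS-zero (M * t)))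
          (r′ , eq′ , D∣r′) = sum-mod M (λ c → F (0 ∷ c)) (bounded-∷ F bd 0)
      in r′ + r
       , trans (sumS-++ t (M * t) _)
           (trans (sumS-cong (λ a → sumS-cong (λ b → cong F (cnt-++ M t a b))))
           (trans eq (trans (cong (_+ r) eq′) (+-assoc (F (replicate (suc M) 0)) r′ r))))
       , ∣m∣n⇒∣m+n D∣r′ D∣r

    sum-∣ : ∀ M (F : Vec ℕ M → ℕ) → Bounded F → F (replicate M 0) ≡ 0 →
            D ∣ sumS (M * t) (F ∘ cnt M t)
    sum-∣ M F bd F0 with sum-mod M F bd
    ... | r , eq , D∣r = subst (D ∣_) (sym (trans eq (cong (_+ r) F0))) D∣r

    -- Fix the trace of an edge on the block of `v`. Modulo `D` the sum over the other blocks
    -- collapses to the empty rest, where the edge lies inside one block and contributes nothing.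
    -- Blocks preceding that of `v` are first reduced to the empty trace.
    degree-∣ : ∀ M (F : Vec ℕ M → ℕ) → Bounded F → (∀ c → T (mono c) → F c ≡ 0) →
               ∀ v → D ∣ sumS (M * t) (λ e → F (cnt M t e) * ind (lookup e v))
    degree-∣ (suc M) F bd mv v with side t (M * t) v
    ... | left i = subst (D ∣_) (sym (trans (sumS-++ t (M * t) _) (sumS-cong (λ a → sumS-cong (λ b →
            trans (cong₂ (λ c x → F c * ind x) (cnt-++ M t a b) (lookup-++ˡ a b i))
                  (*-comm (F (∣ a ∣ ∷ cnt M t b)) (ind (lookup a i))))))))
          (sumS-∣ (λ a → subst (D ∣_) (sym (sumS-* {n = M * t} (ind (lookup a i)) (λ b → F (∣ a ∣ ∷ cnt M t b))))
            (∣n⇒∣m*n (ind (lookup a i)) (sum-∣ M (λ c → F (∣ a ∣ ∷ c)) (bounded-∷ F bd ∣ a ∣) (mv _ (mono-single M ∣ a ∣))))))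
    ... | right j = subst (D ∣_) (sym (trans (sumS-++ t (M * t) _) (trans (sumS-cong (λ a → sumS-cong (λ b →
            cong₂ (λ c x → F c * ind x) (cnt-++ M t a b) (lookup-++ʳ a b j)))) (proj₁ (proj₂ bs)))))
          (∣m∣n⇒∣m+n (degree-∣ M (λ c → F (0 ∷ c)) (bounded-∷ F bd 0) (λ c → mv (0 ∷ c)) j) (proj₂ (proj₂ bs)))
      where
      bs = block-sum {t = t} nice (λ x → sumS (M * t) (λ b → F (x ∷ cnt M t b) * ind (lookup b j)))
             (λ x lt → trans (sumS-cong {n = M * t} (λ b → cong (_* ind (lookup b j)) (large-head F bd x _ lt))) (sumS-zero (M * t)))

  -- Edges of a tight cycle as windows of a periodic sequence

  sumIn-⊥ : ∀ n w → sumIn (Vec.replicate n outside) w ≡ 0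
  sumIn-⊥ zero    w = refl
  sumIn-⊥ (suc n) w = sumIn-⊥ n (w ∘ suc)

  sumIn-⁅⁆∪ : ∀ v (s : Subset n) w → v ∉ s → sumIn (⁅ v ⁆ ∪ s) w ≡ w v + sumIn s w
  sumIn-⁅⁆∪ zero    (true ∷ s)  w v∉ = contradiction Vec.here v∉
  sumIn-⁅⁆∪ zero    (false ∷ s) w v∉ = cong (λ s → w zero + sumIn s (w ∘ suc)) (∪-identityˡ s)
  sumIn-⁅⁆∪ (suc v) (true ∷ s)  w v∉ = begin
    w zero + sumIn (⁅ v ⁆ ∪ s) (w ∘ suc)     ≡⟨ cong (w zero +_) (sumIn-⁅⁆∪ v s (w ∘ suc) (v∉ ∘ Vec.there)) ⟩
    w zero + (w (suc v) + sumIn s (w ∘ suc)) ≡⟨ lem (w zero) (w (suc v)) (sumIn s (w ∘ suc)) ⟩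
    w (suc v) + (w zero + sumIn s (w ∘ suc)) ∎
    where
    open ≡-Reasoning
    lem : ∀ a b c → a + (b + c) ≡ b + (a + c)
    lem = solve-∀
  sumIn-⁅⁆∪ (suc v) (false ∷ s) w v∉ = sumIn-⁅⁆∪ v s (w ∘ suc) (v∉ ∘ Vec.there)

  ∉-⋃ : ∀ (v : Fin n) vs → v ∉ₗ vs → v ∉ ⋃ (map ⁅_⁆ vs)
  ∉-⋃ v []       v∉ p = ∉⊥ p
  ∉-⋃ v (u ∷ vs) v∉ p with x∈p∪q⁻ ⁅ u ⁆ _ p
  ... | inj₁ q = v∉ (here (x∈⁅y⁆⇒x≡y u q))
  ... | inj₂ q = ∉-⋃ v vs (v∉ ∘ there) q

  sumIn-⋃ : ∀ (vs : List (Fin n)) w → Unique vs → sumIn (⋃ (map ⁅_⁆ vs)) w ≡ sumL w vs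
  sumIn-⋃ {n} []       w _ = sumIn-⊥ n w
  sumIn-⋃ (v ∷ vs) w (v∉ AllPairs.∷ uniq) = trans
    (sumIn-⁅⁆∪ v _ w (∉-⋃ v vs (λ p → All.lookup v∉ p refl)))
    (cong (w v +_) (sumIn-⋃ vs w uniq))

  -- The residue of `y` plus `suc d` stays below `2 * n`, so it wraps at most once: without wrapping
  -- it exceeds the residue of `y`, and with wrapping equality would force `suc d = n`.
  %-window : ∀ y d n .{{_ : NonZero n}} → suc d < n → y % n ≢ (y + suc d) % n
  %-window y d n d<n eq with (y % n + suc d) <? n
  ... | yes lt = m+1+n≢m (y % n) (sym (trans eq (trans step (m<n⇒m%n≡m lt))))
    where
    step : (y + suc d) % n ≡ (y % n + suc d) % n
    step = trans (%-distribˡ-+ y (suc d) n) (cong (λ z → (y % n + z) % n) (m<n⇒m%n≡m d<n))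
  ... | no ¬lt = <⇒≢ d<n (+-cancelˡ-≡ (y % n) (suc d) n
                   (trans (sym (m∸n+n≡m n≤)) (cong (_+ n) (sym (trans eq (trans step (trans (sym (m≤n⇒[n∸m]%m≡n%m n≤)) (m<n⇒m%n≡m small))))))))
    where
    n≤ : n ≤ y % n + suc d
    n≤ = ≮⇒≥ ¬lt
    small : y % n + suc d ∸ n < n
    small = +-cancelʳ-< n _ _ (subst (_< n + n) (sym (m∸n+n≡m n≤)) (+-mono-< (m%n<n y n) d<n))
    step : (y + suc d) % n ≡ (y % n + suc d) % n
    step = trans (%-distribˡ-+ y (suc d) n) (cong (λ z → (y % n + z) % n) (m<n⇒m%n≡m d<n))

  sum-applyUpTo : ∀ g n → sum (applyUpTo g n) ≡ sumN n g
  sum-applyUpTo g zero    = refl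
  sum-applyUpTo g (suc n) = cong (g 0 +_) (sum-applyUpTo (g ∘ suc) n)

  sumL-allFin : ∀ n (g : ℕ → ℕ) → sumL (g ∘ toℕ) (allFin n) ≡ sumN n g
  sumL-allFin n g = trans (cong sum (map-tabulate {n = n} id (g ∘ toℕ))) (go n g)
    where
    go : ∀ n (g : ℕ → ℕ) → sum (tabulate {n = n} (g ∘ toℕ)) ≡ sumN n g
    go zero    g = refl
    go (suc n) g = cong (g 0 +_) (go n (g ∘ suc))

  module _ {L n : ℕ} (C : TightCycle (suc L) n) where

    at : ℕ → Fin n
    at i = vertex C (i mod suc L)

    at-periodic : ∀ i → at (i + suc L) ≡ at i
    at-periodic i = cong (vertex C) (toℕ-injective
      (trans (toℕ-fromℕ< _) (trans ([m+n]%n≡m%n i (suc L)) (sym (toℕ-fromℕ< _)))))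

    window-unique : ∀ k i → k < suc L → Unique (applyUpTo (λ j → at (i + j)) k)
    window-unique k i k<ℓ = Unique.applyUpTo⁺₁ _ k λ {a} {b} a<b b<k eq →
      let mods = TightCycle.distinct C eq
          d = b ∸ suc a
          b≡ = sym (trans (+-suc a d) (m+[n∸m]≡n a<b))
      in %-window (i + a) d (suc L)
           (≤-<-trans (≤-trans (m≤n+m (suc d) a) (≤-reflexive (sym b≡))) (<-trans b<k k<ℓ))
           (trans (sym (toℕ-fromℕ< _)) (trans (cong toℕ mods) (trans (toℕ-fromℕ< _)
             (cong (_% suc L) (trans (cong (i +_) b≡) (sym (+-assoc i a (suc d))))))))

    sumIn-cycleEdge : ∀ k → k < suc L → ∀ w i →
      sumIn (cycleEdge k C i) w ≡ sumN k (λ j → w (at (toℕ i + j)))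
    sumIn-cycleEdge k k<ℓ w i = begin
      sumIn (⋃ (map (λ j → ⁅ at (toℕ i + j) ⁆) (upTo k))) w
        ≡⟨ cong (λ es → sumIn (⋃ es) w) (trans (map-∘ (upTo k)) (cong (map ⁅_⁆) (map-applyUpTo id _ k))) ⟩
      sumIn (⋃ (map ⁅_⁆ (applyUpTo (λ j → at (toℕ i + j)) k))) w
        ≡⟨ sumIn-⋃ _ w (window-unique k (toℕ i) k<ℓ) ⟩
      sum (map w (applyUpTo (λ j → at (toℕ i + j)) k))
        ≡⟨ cong sum (map-applyUpTo (λ j → at (toℕ i + j)) w k) ⟩
      sum (applyUpTo (λ j → w (at (toℕ i + j))) k)
        ≡⟨ sum-applyUpTo _ k ⟩
      sumN k (λ j → w (at (toℕ i + j))) ∎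
      where open ≡-Reasoning

    -- Edge weights that depend only on a label sum see nothing of the cycle but the window sums of
    -- a periodic sequence. All later statements about cycles are statements about such sequences.
    sumL-cycleEdges : ∀ k → k < suc L → ∀ (w : Fin n → ℕ) (g : ℕ → ℕ) →
      sumL (λ e → g (sumIn e w)) (cycleEdges k C) ≡ sumN (suc L) (λ i → g (sumN k (λ j → w (at (i + j)))))
    sumL-cycleEdges k k<ℓ w g = begin
      sum (map (λ e → g (sumIn e w)) (map (cycleEdge k C) (allFin (suc L))))
        ≡⟨ cong sum (map-∘ (allFin (suc L))) ⟨
      sum (map (λ i → g (sumIn (cycleEdge k C i) w)) (allFin (suc L)))
        ≡⟨ cong sum (map-cong (λ i → cong g (sumIn-cycleEdge k k<ℓ w i)) (allFin (suc L))) ⟩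
      sumL ((λ i → g (sumN k (λ j → w (at (i + j))))) ∘ toℕ) (allFin (suc L))
        ≡⟨ sumL-allFin (suc L) (λ i → g (sumN k (λ j → w (at (i + j))))) ⟩
      _ ∎
      where open ≡-Reasoning

  -- Weights summed over a decomposition

  sumL-concatMap : ∀ {A B : Set} (w : B → ℕ) (f : A → List B) xs →
                   sumL w (concatMap f xs) ≡ sumL (λ x → sumL w (f x)) xs
  sumL-concatMap w f []       = refl
  sumL-concatMap w f (x ∷ xs) = trans (cong sum (map-++ w (f x) _))
    (trans (sum-++ (map w (f x)) _) (cong (sumL w (f x) +_) (sumL-concatMap w f xs)))

  sumL-mono : ∀ {A : Set} {v w : A → ℕ} → (∀ x → v x ≤ w x) → ∀ xs → sumL v xs ≤ sumL w xs
  sumL-mono le []       = z≤n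
  sumL-mono le (x ∷ xs) = +-mono-≤ (le x) (sumL-mono le xs)

  -- The duality step: every edge lies in exactly one cycle, so an inequality valid on each cycle
  -- adds up to one on `H`.
  decomposition-≤ : ∀ {k n ℓ} (H : KGraph k n) → HasDecomposition ℓ H → ∀ (α β : Subset n → ℕ) →
    (∀ C → sumL α (cycleEdges {ℓ} k C) ≤ sumL β (cycleEdges k C)) → sumL α (edges H) ≤ sumL β (edges H)
  decomposition-≤ {k} H (Cs , perm) α β le = begin
    sumL α (edges H)                       ≡⟨ sum-↭ (map⁺ α perm) ⟨
    sumL α (concatMap (cycleEdges k) Cs)   ≡⟨ sumL-concatMap α (cycleEdges k) Cs ⟩
    sumL (λ C → sumL α (cycleEdges k C)) Cs ≤⟨ sumL-mono le Cs ⟩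
    sumL (λ C → sumL β (cycleEdges k C)) Cs ≡⟨ sumL-concatMap β (cycleEdges k) Cs ⟨
    sumL β (concatMap (cycleEdges k) Cs)   ≡⟨ sum-↭ (map⁺ β perm) ⟩
    sumL β (edges H)                       ∎
    where open ≤-Reasoning

  -- The property `P` passes from the edges of `H` to the edges of each cycle used, because the
  -- congruence to be applied holds only for cycles whose edges all satisfy `P`.
  decomposition-∣ : ∀ {k n ℓ} (H : KGraph k n) → HasDecomposition ℓ H → ∀ d (ψ : Subset n → ℕ) {P : Subset n → Set} →
    All P (edges H) → (∀ C → All P (cycleEdges {ℓ} k C) → d ∣ sumL ψ (cycleEdges k C)) → d ∣ sumL ψ (edges H)
  decomposition-∣ {k} {n} {ℓ} H (Cs , perm) d ψ {P} all div = subst (d ∣_)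
    (trans (sym (sumL-concatMap ψ (cycleEdges k) Cs)) (sum-↭ (map⁺ ψ perm)))
    (go Cs (All-resp-↭ (↭-sym perm) all))
    where
    go : ∀ (Cs : List (TightCycle ℓ n)) → All P (concatMap (cycleEdges k) Cs) → d ∣ sumL (λ C → sumL ψ (cycleEdges k C)) Cs
    go []       _   = d ∣0
    go (C ∷ Cs) all = ∣m∣n⇒∣m+n (div C (All.++⁻ˡ (cycleEdges k C) all)) (go Cs (All.++⁻ʳ (cycleEdges k C) all))

  -- Window sums of periodic sequences

  sumN-last : ∀ n g → sumN (suc n) g ≡ sumN n g + g n
  sumN-last zero    g = +-comm (g 0) 0
  sumN-last (suc n) g = trans (cong (g 0 +_) (sumN-last n (g ∘ suc))) (sym (+-assoc (g 0) _ _))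

  sumN-swap : ∀ m n (g : ℕ → ℕ → ℕ) → sumN m (λ i → sumN n (g i)) ≡ sumN n (λ j → sumN m (λ i → g i j))
  sumN-swap zero    n g = sym (sumN-zero n)
  sumN-swap (suc m) n g = trans (cong (sumN n (g 0) +_) (sumN-swap m n (g ∘ suc))) (sym (sumN-+ n (g 0) _))

  sumN-mono : ∀ n {g g′} → (∀ i → i < n → g i ≤ g′ i) → sumN n g ≤ sumN n g′
  sumN-mono zero    le = z≤n
  sumN-mono (suc n) le = +-mono-≤ (le 0 (s≤s z≤n)) (sumN-mono n (λ i lt → le (suc i) (s≤s lt)))

  sumN-cong< : ∀ n {g g′} → (∀ i → i < n → g i ≡ g′ i) → sumN n g ≡ sumN n g′
  sumN-cong< zero    eq = refl
  sumN-cong< (suc n) eq = cong₂ _+_ (eq 0 (s≤s z≤n)) (sumN-cong< n (λ i lt → eq (suc i) (s≤s lt)))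

  sumN-* : ∀ n c g → sumN n (λ i → c * g i) ≡ c * sumN n g
  sumN-* zero    c g = sym (*-zeroʳ c)
  sumN-* (suc n) c g = trans (cong (c * g 0 +_) (sumN-* n c (g ∘ suc))) (sym (*-distribˡ-+ c (g 0) _))

  sumN-const : ∀ n c → sumN n (λ _ → c) ≡ n * c
  sumN-const zero    c = refl
  sumN-const (suc n) c = cong (c +_) (sumN-const n c)

  sumN-zero⁻ : ∀ n g → sumN n g ≡ 0 → ∀ i → i < n → g i ≡ 0
  sumN-zero⁻ (suc n) g eq zero    _         = m+n≡0⇒m≡0 (g 0) eq
  sumN-zero⁻ (suc n) g eq (suc i) (s≤s i<n) = sumN-zero⁻ n (g ∘ suc) (m+n≡0⇒n≡0 (g 0) eq) i i<n

  sumN-pos : ∀ n g → 0 < sumN n g → ∃[ i ] i < n × 0 < g i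
  sumN-pos (suc n) g pos with g 0 in eq
  ... | suc _ = 0 , s≤s z≤n , subst (0 <_) (sym eq) (s≤s z≤n)
  ... | zero with sumN-pos n (g ∘ suc) pos
  ...   | i , i<n , gi = suc i , s≤s i<n , gi

  sumN-shift : ∀ ℓ g → (∀ i → g (i + ℓ) ≡ g i) → ∀ s → sumN ℓ (λ i → g (s + i)) ≡ sumN ℓ g
  sumN-shift ℓ g per zero    = refl
  sumN-shift ℓ g per (suc s) = trans (sumN-cong ℓ (λ i → cong g (sym (+-suc s i))))
    (trans (+-cancelˡ-≡ (g (s + 0)) _ _ (begin
      sumN (suc ℓ) (λ i → g (s + i))
        ≡⟨ sumN-last ℓ _ ⟩
      sumN ℓ (λ i → g (s + i)) + g (s + ℓ)
        ≡⟨ cong (sumN ℓ (λ i → g (s + i)) +_) (trans (per s) (cong g (sym (+-identityʳ s)))) ⟩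
      sumN ℓ (λ i → g (s + i)) + g (s + 0)
        ≡⟨ +-comm _ (g (s + 0)) ⟩
      g (s + 0) + sumN ℓ (λ i → g (s + i)) ∎))
    (sumN-shift ℓ g per s))
    where open ≡-Reasoning

  odd : ℕ → Bool
  odd zero    = false
  odd (suc n) = not (odd n)

  odd-double : ∀ q → odd (q * 2) ≡ false
  odd-double zero    = refl
  odd-double (suc q) = trans (not-involutive _) (odd-double q)

  even⇒2∣ : ∀ n → odd n ≡ false → 2 ∣ n
  even⇒2∣ zero          _  = 2 ∣0
  even⇒2∣ (suc (suc n)) eq = ∣m∣n⇒∣m+n ∣-refl (even⇒2∣ n (trans (sym (not-involutive (odd n))) eq))

  2∣⇒even : ∀ n → 2 ∣ n → odd n ≡ false
  2∣⇒even .(q * 2) (divides-refl q) = odd-double q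

  ¬2∣⇒odd : ∀ n → ¬ 2 ∣ n → odd n ≡ true
  ¬2∣⇒odd n 2∤n with odd n in eq
  ... | true  = refl
  ... | false = contradiction (even⇒2∣ n eq) 2∤n

  same-parity : ∀ a b → a ≤ suc b → b ≤ suc a → odd a ≡ odd b → a ≡ b
  same-parity zero          zero          _ _ _ = refl
  same-parity zero          (suc zero)    _ _ ()
  same-parity zero          (suc (suc b)) _ (s≤s ()) _
  same-parity (suc zero)    zero          _ _ ()
  same-parity (suc (suc a)) zero          (s≤s ()) _ _
  same-parity (suc a)       (suc b)       (s≤s p) (s≤s q) eq = cong suc (same-parity a b p q (not-injective eq))

  adjacent : ∀ a b → a ≤ suc b → b ≤ suc a → odd a ≢ odd b → a ≡ suc b ⊎ b ≡ suc a
  adjacent zero          zero          _ _ ne = contradiction refl ne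
  adjacent zero          (suc zero)    _ _ _ = inj₂ refl
  adjacent zero          (suc (suc b)) _ (s≤s ()) _
  adjacent (suc zero)    zero          _ _ _ = inj₁ refl
  adjacent (suc (suc a)) zero          (s≤s ()) _ _
  adjacent (suc a)       (suc b)       (s≤s p) (s≤s q) ne with adjacent a b p q (λ eq → ne (cong not eq))
  ... | inj₁ eq = inj₁ (cong suc eq)
  ... | inj₂ eq = inj₂ (cong suc eq)

  -- `k` divides both `c * ℓ` and `c * k`, hence their gcd `c * gcd ℓ k`; cancelling `gcd ℓ k`
  -- leaves `k / gcd ℓ k` on the left.
  ∣-gcd-cancel : ∀ ℓ k c → .{{NonZero k}} → k ∣ ℓ * c → quotient (gcd[m,n]∣n ℓ k) ∣ c
  ∣-gcd-cancel ℓ k c k∣ℓc = *-cancelʳ-∣ (gcd ℓ k) {{gcd≢0}} (subst₂ _∣_ (_∣_.equality (gcd[m,n]∣n ℓ k)) eq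
      (gcd-greatest (subst (k ∣_) (*-comm ℓ c) k∣ℓc) (∣n⇒∣m*n c ∣-refl)))
    where
    gcd≢0 : NonZero (gcd ℓ k)
    gcd≢0 = ≢-nonZero (gcd[m,n]≢0 ℓ k (inj₂ (≢-nonZero⁻¹ k)))
    eq : gcd (c * ℓ) (c * k) ≡ c * gcd ℓ k
    eq = sym (c*gcd[m,n]≡gcd[cm,cn] c ℓ k)

  -- `x` is the indicator of `A` along the cycle, `c i` is the type of the edge starting at position
  -- `i`, and `X` is the number of vertices of the cycle in `A`.
  module Windows (k L : ℕ) (x : ℕ → ℕ) (x≤1 : ∀ i → x i ≤ 1) (per : ∀ i → x (i + suc L) ≡ x i) where

    ℓ X : ℕ
    ℓ = suc L
    X = sumN ℓ x

    c : ℕ → ℕ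
    c i = sumN k (λ j → x (i + j))

    c-periodic : ∀ i → c (i + ℓ) ≡ c i
    c-periodic i = sumN-cong k λ j → trans (cong x (lem i ℓ j)) (per (i + j))
      where
      lem : ∀ i l j → i + l + j ≡ i + j + l
      lem = solve-∀

    c≤k : ∀ i → c i ≤ k
    c≤k i = ≤-trans (sumN-mono k (λ j _ → x≤1 (i + j))) (≤-reflexive (trans (sumN-const k 1) (*-identityʳ k)))

    -- Every vertex of the cycle lies in `k` windows.
    sum-c : sumN ℓ c ≡ k * X
    sum-c = begin
      sumN ℓ (λ i → sumN k (λ j → x (i + j))) ≡⟨ sumN-swap ℓ k (λ i j → x (i + j)) ⟩
      sumN k (λ j → sumN ℓ (λ i → x (i + j))) ≡⟨ sumN-cong k (λ j → trans (sumN-cong ℓ (λ i → cong x (+-comm i j))) (sumN-shift ℓ x per j)) ⟩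
      sumN k (λ _ → X)                        ≡⟨ sumN-const k X ⟩
      k * X                                   ∎
      where open ≡-Reasoning

    slide : ∀ i → x i + c (suc i) ≡ c i + x (i + k)
    slide i = trans (cong₂ _+_ (cong x (sym (+-identityʳ i))) (sumN-cong k (λ j → cong x (sym (+-suc i j)))))
                    (sumN-last k (λ j → x (i + j)))

    c-up : ∀ i → c (suc i) ≤ suc (c i)
    c-up i = begin
      c (suc i)       ≤⟨ m≤n+m _ (x i) ⟩
      x i + c (suc i) ≡⟨ slide i ⟩
      c i + x (i + k) ≤⟨ +-monoʳ-≤ (c i) (x≤1 (i + k)) ⟩
      c i + 1         ≡⟨ +-comm (c i) 1 ⟩
      suc (c i)       ∎
      where open ≤-Reasoning

    c-down : ∀ i → c i ≤ suc (c (suc i))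
    c-down i = begin
      c i             ≤⟨ m≤m+n _ _ ⟩
      c i + x (i + k) ≡⟨ slide i ⟨
      x i + c (suc i) ≤⟨ +-monoˡ-≤ (c (suc i)) (x≤1 i) ⟩
      suc (c (suc i)) ∎
      where open ≤-Reasoning

    constant : ∀ p s m → (∀ i → i < m → odd (c (s + i)) ≡ p) → ∀ i → i < m → c (s + i) ≡ c (s + 0)
    constant p s m par zero    _  = refl
    constant p s m par (suc i) lt = trans
      (same-parity (c (s + suc i)) (c (s + i))
        (subst (λ z → c z ≤ suc (c (s + i))) (sym (+-suc s i)) (c-up (s + i)))
        (subst (λ z → c (s + i) ≤ suc (c z)) (sym (+-suc s i)) (c-down (s + i)))
        (trans (par (suc i) lt) (sym (par i (<-trans (n<1+n i) lt)))))
      (constant p s m par i (<-trans (n<1+n i) lt))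

    -- With `p` the dense parity, the bad windows are the extra edges of the cycle.
    bad : Bool → ℕ → ℕ
    bad p i = ind (odd (c i) xor p)

    xor-zero : ∀ a b → ind (a xor b) ≡ 0 → a ≡ b
    xor-zero true  true  _ = refl
    xor-zero false false _ = refl

    xor-same : ∀ a b → a ≡ b → ind (a xor b) ≡ 0
    xor-same true  .true  refl = refl
    xor-same false .false refl = refl

    -- Neighbouring window sums differ by at most one, so c is constant and counting incidences gives ℓ c = k X.
    all-same : ∀ p → sumN ℓ (bad p) ≡ 0 → (∀ i → i < ℓ → c i ≡ c 0) × odd (c 0) ≡ p × k ∣ ℓ * c 0
    all-same p none = const-c , par 0 (s≤s z≤n) , divides X (begin
        ℓ * c 0            ≡⟨ sumN-const ℓ (c 0) ⟨
        sumN ℓ (λ _ → c 0) ≡⟨ sumN-cong< ℓ const-c ⟨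
        sumN ℓ c           ≡⟨ sum-c ⟩
        k * X              ≡⟨ *-comm k X ⟩
        X * k              ∎)
      where
      open ≡-Reasoning
      par : ∀ i → i < ℓ → odd (c i) ≡ p
      par i lt = xor-zero _ p (sumN-zero⁻ ℓ (bad p) none i lt)
      const-c : ∀ i → i < ℓ → c i ≡ c 0
      const-c = constant p 0 ℓ par

    -- Read from just after its only bad window, the cycle shows `L` windows of one parity, hence of
    -- one type `b`. The bad window is a neighbour of these, so its type differs from `b` by one,
    -- and counting incidences gives the equation.
    one-bad : ∀ p → 1 ≤ L → sumN ℓ (bad p) ≡ 1 →
      ∃[ i ] ∃[ b ] i < ℓ × b ≤ k × odd b ≡ p × odd (c i) ≢ p × (c i ≡ suc b ⊎ b ≡ suc (c i)) × c i + L * b ≡ k * X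
    one-bad p 1≤L one with sumN-pos ℓ (bad p) (≤-reflexive (sym one))
    ... | i , i<ℓ , pos = i , b , i<ℓ , c≤k (suc i + 0) , par 0 1≤L , ne
        , adjacent (c i) b (subst (λ z → c i ≤ suc (c z)) si≡ (c-down i)) (subst (λ z → c z ≤ suc (c i)) si≡ (c-up i))
            (λ eq → ne (trans eq (par 0 1≤L)))
        , (begin
            c i + L * b ≡⟨ cong₂ _+_ (cong c (sym (+-identityʳ i))) (sym (sumN-const L b)) ⟩
            c (i + 0) + sumN L (λ _ → b) ≡⟨ cong (c (i + 0) +_) (sumN-cong< L (λ j lt → trans (cong c (+-suc i j)) (constant p (suc i) L par j lt))) ⟨
            sumN ℓ (λ j → c (i + j)) ≡⟨ sumN-shift ℓ c c-periodic i ⟩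
            sumN ℓ c ≡⟨ sum-c ⟩
            k * X ∎)
      where
      open ≡-Reasoning
      b = c (suc i + 0)
      si≡ : suc i ≡ suc i + 0
      si≡ = sym (+-identityʳ (suc i))
      ne : odd (c i) ≢ p
      ne eq = >⇒≢ pos (xor-same (odd (c i)) p eq)
      bad-periodic : ∀ j → bad p (j + ℓ) ≡ bad p j
      bad-periodic j = cong (λ z → ind (odd z xor p)) (c-periodic j)
      rotated : bad p (i + 0) + sumN L (λ j → bad p (i + suc j)) ≡ 1
      rotated = trans (sumN-shift ℓ (bad p) bad-periodic i) one
      rest : sumN L (λ j → bad p (i + suc j)) ≡ 0
      rest = n≤0⇒n≡0 (+-cancelˡ-≤ 1 _ _ (≤-trans
        (+-monoˡ-≤ _ (subst (λ z → 1 ≤ bad p z) (sym (+-identityʳ i)) pos)) (≤-reflexive rotated)))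
      par : ∀ j → j < L → odd (c (suc i + j)) ≡ p
      par j lt = xor-zero _ p (trans (cong (bad p) (sym (+-suc i j))) (sumN-zero⁻ L _ rest j lt))

  -- The parity construction and its codegrees

  ind-∧ : ∀ a b → ind (a ∧ b) ≡ ind a * ind b
  ind-∧ true  b = sym (*-identityˡ (ind b))
  ind-∧ false b = refl

  ≡ᵇ-refl : ∀ n → (n ≡ᵇ n) ≡ true
  ≡ᵇ-refl zero    = refl
  ≡ᵇ-refl (suc n) = ≡ᵇ-refl n

  ≡ᵇ-true : ∀ {m n} → m ≡ n → (m ≡ᵇ n) ≡ true
  ≡ᵇ-true {m} refl = ≡ᵇ-refl m

  ≡ᵇ-false : ∀ {m n} → m ≢ n → (m ≡ᵇ n) ≡ false
  ≡ᵇ-false {zero}  {zero}  ne = contradiction refl ne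
  ≡ᵇ-false {zero}  {suc n} ne = refl
  ≡ᵇ-false {suc m} {zero}  ne = refl
  ≡ᵇ-false {suc m} {suc n} ne = ≡ᵇ-false {m} {n} (ne ∘ cong suc)

  sumF-toℕ : ∀ n (g : ℕ → ℕ) → sumF n (g ∘ toℕ) ≡ sumN n g
  sumF-toℕ zero    g = refl
  sumF-toℕ (suc n) g = cong (g 0 +_) (sumF-toℕ n (g ∘ suc))

  sumF-zero : ∀ n → sumF n (λ _ → 0) ≡ 0
  sumF-zero n = trans (sumF-const n 0) (*-zeroʳ n)

  sumF-≟ : ∀ (i : Fin n) → sumF n (λ j → ind (does (j Fin.≟ i))) ≡ 1
  sumF-≟ {suc n} zero    = cong suc (sumF-zero n)
  sumF-≟ {suc n} (suc i) = sumF-≟ i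

  sumN-<ᵇ : ∀ m r → r ≤ m → sumN m (λ i → ind (i <ᵇ r)) ≡ r
  sumN-<ᵇ m       zero    _         = sumN-zero m
  sumN-<ᵇ (suc m) (suc r) (s≤s r≤m) = cong suc (sumN-<ᵇ m r r≤m)

  sumN-residue : ∀ m r .{{_ : NonZero m}} → r ≤ m → ∀ s → sumN m (λ i → ind ((i + s) % m <ᵇ r)) ≡ r
  sumN-residue m r r≤m s = trans (sumN-cong m (λ i → cong (λ z → ind (z % m <ᵇ r)) (+-comm i s)))
    (trans (sumN-shift m (λ i → ind (i % m <ᵇ r)) (λ i → cong (λ z → ind (z <ᵇ r)) ([m+n]%n≡m%n i m)) s)
    (trans (sumN-cong< m (λ i i<m → cong (λ z → ind (z <ᵇ r)) (m<n⇒m%n≡m i<m))) (sumN-<ᵇ m r r≤m)))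

  nonempty-subset : ∀ (S : Subset n) → 0 < ∣ S ∣ → ∃[ u ] lookup S u ≡ true
  nonempty-subset (true ∷ S)  _   = zero , refl
  nonempty-subset (false ∷ S) pos with nonempty-subset S pos
  ... | u , eq = suc u , eq

  subset-of-size : ∀ n κ → κ ≤ n → ∃[ S ] ∣_∣ {n} S ≡ κ
  subset-of-size zero    zero    _       = [] , refl
  subset-of-size (suc n) zero    _       with subset-of-size n zero z≤n
  ... | S , eq = outside ∷ S , eq
  subset-of-size (suc n) (suc κ) (s≤s le) with subset-of-size n κ le
  ... | S , eq = inside ∷ S , cong suc eq

  minCodegree-≥ : ∀ {k n} (H : KGraph k n) x → x ≤ n →
    (∀ S → ∣ S ∣ ≡ k ∸ 1 → x ≤ codegree H S) → x ≤ minCodegree H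
  minCodegree-≥ {k} {n} H x x≤n h =
    v≤min⁺ x≤n (All.map⁺ (All.map (λ {S} → h S) (All.all-filter (λ S → ∣ S ∣ ≟ k ∸ 1) (subsets n))))

  -- Pairs of a set and a new vertex, weighted by `w`, are counted from the larger and from the
  -- smaller set. Adding the pairs whose vertex already lies in the smaller set turns the weight
  -- outside it into the total weight and avoids subtraction.
  count-extensions : ∀ (w : Fin n → ℕ) (G G′ : Subset n → ℕ) x y →
    (∀ e → G e * sumIn e w ≡ x * G e) → (∀ S → G′ S * sumIn S w ≡ y * G′ S) →
    (∀ S v → lookup S v ≡ outside → G (S [ v ]≔ inside) * w v ≡ G′ S * w v) →
    x * sumS n G + y * sumS n G′ ≡ sumF n w * sumS n G′
  count-extensions {n} w G G′ x y hx hy ext = begin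
    x * sumS n G + y * sumS n G′
      ≡⟨ cong₂ _+_ (sym (sumS-* {n} x G)) (sym (sumS-* {n} y G′)) ⟩
    sumS n (λ e → x * G e) + sumS n (λ S → y * G′ S)
      ≡⟨ cong₂ _+_ (sumS-cong {n} (λ e → trans (sym (hx e)) (sym (sumIn-* e (G e) w)))) (sumS-cong {n} (λ S → sym (hy S))) ⟩
    sumS n (λ e → sumIn e (λ v → G e * w v)) + sumS n (λ S → G′ S * sumIn S w)
      ≡⟨ cong (_+ sumS n (λ S → G′ S * sumIn S w)) (trans (double-count n (λ e v → G e * w v))
           (sumS-cong {n} (λ S → trans (sumOut-cong S (ext S)) (sumOut-* S (G′ S) w)))) ⟩
    sumS n (λ S → G′ S * sumOut S w) + sumS n (λ S → G′ S * sumIn S w)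
      ≡⟨ sumS-+ {n} _ _ ⟨
    sumS n (λ S → G′ S * sumOut S w + G′ S * sumIn S w)
      ≡⟨ sumS-cong {n} (λ S → trans (sym (*-distribˡ-+ (G′ S) (sumOut S w) _))
           (trans (cong (G′ S *_) (trans (+-comm (sumOut S w) _) (sumIn+sumOut S w))) (*-comm (G′ S) _))) ⟩
    sumS n (λ S → sumF n w * G′ S)
      ≡⟨ sumS-* {n} (sumF n w) G′ ⟩
    sumF n w * sumS n G′ ∎
    where open ≡-Reasoning

  -- The vertices form 2m blocks of size t: for each residue i < m one block in A and one outside A.
  module Construction (κ m t r : ℕ) (p : Bool) .{{_ : NonZero m}} (1≤κ : 1 ≤ κ) (r≤m : r ≤ m) where

    k M V : ℕ
    k = suc κ
    M = m + m
    V = M * t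

    a b y : Fin M → ℕ
    a γ = [ const 1 , const 0 ]′ (splitAt m γ)
    b γ = [ const 0 , const 1 ]′ (splitAt m γ)
    y γ = [ toℕ , toℕ ]′ (splitAt m γ)

    aᵥ bᵥ yᵥ : Fin V → ℕ
    aᵥ = a ∘ color M t
    bᵥ = b ∘ color M t
    yᵥ = y ∘ color M t

    A Y : Subset V → ℕ
    A e = sumIn e aᵥ
    Y e = sumIn e yᵥ

    same : ℕ → Bool
    same c = not (odd c xor p)

    good : ℕ → ℕ → Bool
    good c s = same c ∨ (s % m <ᵇ r)

    -- Sets inside a single block are left out because they would spoil the divisibility of degrees;
    -- each codegree loses at most `t` by this.
    f : Subset V → Bool
    f e = (∣ e ∣ ≡ᵇ k) ∧ (not (mono (cnt M t e)) ∧ good (A e) (Y e))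

    uniform : ∀ e → T (f e) → ∣ e ∣ ≡ k
    uniform e fe = ≡ᵇ⇒≡ _ _ (proj₁ (Equivalence.to T-∧ fe))

    H : KGraph k V
    H = hypergraph f uniform

    sumF-label : ∀ (φ : ℕ → ℕ → ℕ) → sumF M (λ γ → φ (a γ) (y γ)) ≡ sumN m (φ 1) + sumN m (φ 0)
    sumF-label φ = trans (sumF-++ m m _) (cong₂ _+_
      (trans (sumF-cong (λ i → cong (λ z → φ ([ const 1 , const 0 ]′ z) ([ toℕ , toℕ ]′ z)) (Fin.splitAt-↑ˡ m i m))) (sumF-toℕ m (φ 1)))
      (trans (sumF-cong (λ i → cong (λ z → φ ([ const 1 , const 0 ]′ z) ([ toℕ , toℕ ]′ z)) (Fin.splitAt-↑ʳ m m i))) (sumF-toℕ m (φ 0))))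

    a≤1 : ∀ v → aᵥ v ≤ 1
    a≤1 v with splitAt m (color M t v)
    ... | inj₁ _ = ≤-refl
    ... | inj₂ _ = z≤n

    width : ℕ → ℕ
    width c = if same c then m else r

    sum-good : ∀ c s → sumN m (λ i → ind (good c (i + s))) ≡ width c
    sum-good c s with same c
    ... | true  = trans (sumN-const m 1) (*-identityʳ m)
    ... | false = sumN-residue m r r≤m s

    -- Up to the factor `t` and boundary terms, the number of ways to complete a `κ`-set of type `c`
    -- to an edge whose type satisfies `q`: the first summand adds a vertex of `A`, the second one
    -- outside `A`.
    N : (ℕ → Bool) → ℕ → ℕ
    N q c = width (suc c) * ind (q (suc c)) + width c * ind (q c)

    N-sum : ∀ q c s → sumF V (λ v → ind (good (aᵥ v + c) (yᵥ v + s)) * ind (q (aᵥ v + c))) ≡ t * N q c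
    N-sum q c s = trans (sumF-color M t (λ γ → ind (good (a γ + c) (y γ + s)) * ind (q (a γ + c))))
      (cong (t *_) (trans (sumF-label (λ α i → ind (good (α + c) (i + s)) * ind (q (α + c))))
        (cong₂ _+_ (half (suc c)) (half c))))
      where
      half : ∀ c → sumN m (λ i → ind (good c (i + s)) * ind (q c)) ≡ width c * ind (q c)
      half c = trans (sumN-cong m (λ i → *-comm _ (ind (q c))))
        (trans (sumN-* m (ind (q c)) _) (trans (cong (ind (q c) *_) (sum-good c s)) (*-comm (ind (q c)) _)))

    g : (ℕ → Bool) → Subset V → ℕ
    g q e = ind (f e) * ind (q (A e))

    module _ (S : Subset V) (∣S∣ : ∣ S ∣ ≡ κ) (q : ℕ → Bool) where

      private
        h : Fin V → ℕ
        h v = ind (good (aᵥ v + A S) (yᵥ v + Y S)) * ind (q (aᵥ v + A S))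

        u : Fin V
        u = proj₁ (nonempty-subset S (subst (0 <_) (sym ∣S∣) 1≤κ))

        u∈S : lookup S u ≡ true
        u∈S = proj₂ (nonempty-subset S (subst (0 <_) (sym ∣S∣) 1≤κ))

        h≤1 : ∀ v → h v ≤ 1
        h≤1 v = *-mono-≤ (ind≤1 (good (aᵥ v + A S) (yᵥ v + Y S))) (ind≤1 (q (aᵥ v + A S)))

        g-insert : ∀ v → lookup S v ≡ outside →
          g q (S [ v ]≔ inside) ≡ ind (not (mono (cnt M t (S [ v ]≔ inside)))) * h v
        g-insert v v∉ rewrite ∣insert∣ S v v∉ | ∣S∣ | ≡ᵇ-refl κ
                            | sumIn-insert S aᵥ v v∉ | sumIn-insert S yᵥ v v∉ =
          trans (cong (_* ind (q (aᵥ v + A S))) (ind-∧ (not (mono (cnt M t (S [ v ]≔ inside)))) _))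
                (*-assoc (ind (not (mono (cnt M t (S [ v ]≔ inside))))) _ _)

        g≤h : ∀ v → lookup S v ≡ outside → g q (S [ v ]≔ inside) ≤ h v
        g≤h v v∉ = ≤-trans (≤-reflexive (g-insert v v∉))
          (≤-trans (*-monoˡ-≤ (h v) (ind≤1 (not (mono (cnt M t (S [ v ]≔ inside)))))) (≤-reflexive (*-identityˡ (h v))))

        -- Since `u` belongs to `S`, the completed set can lie inside one block only if `v` is in
        -- the block of `u`.
        h≤g : ∀ v → lookup S v ≡ outside → h v ≤ g q (S [ v ]≔ inside) + ind (does (color M t v Fin.≟ color M t u))
        h≤g v v∉ with color M t v Fin.≟ color M t u
        ... | yes _ = ≤-trans (h≤1 v) (m≤n+m 1 _)
        ... | no ne = ≤-reflexive (sym (trans (+-identityʳ _) (trans (g-insert v v∉)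
                        (trans (cong (λ z → ind (not z) * h v) notmono) (*-identityˡ (h v))))))
          where
          u≢v : u ≢ v
          u≢v eq with trans (sym u∈S) (trans (cong (lookup S) eq) v∉)
          ... | ()
          notmono : mono (cnt M t (S [ v ]≔ inside)) ≡ false
          notmono with mono (cnt M t (S [ v ]≔ inside)) in eq
          ... | false = refl
          ... | true  = contradiction (mono⇒color M t (S [ v ]≔ inside) v u (Equivalence.from T-≡ eq)
                          (lookup∘update v S inside) (trans (lookup∘update′ u≢v S inside) u∈S)) ne

      extensions-≤ : sumOut S (λ v → g q (S [ v ]≔ inside)) ≤ t * N q (A S)
      extensions-≤ = ≤-trans (sumOut-mono S g≤h) (≤-trans (sumOut≤sumF S h) (≤-reflexive (N-sum q (A S) (Y S))))

      -- The correction accounts for the vertices of S and for the block of u.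
      extensions-≥ : t * N q (A S) ≤ sumOut S (λ v → g q (S [ v ]≔ inside)) + (κ + t)
      extensions-≥ = begin
        t * N q (A S)            ≡⟨ N-sum q (A S) (Y S) ⟨
        sumF V h                 ≡⟨ sumIn+sumOut S h ⟨
        sumIn S h + sumOut S h   ≤⟨ +-mono-≤ (≤-trans (sumIn-mono S h≤1) (≤-reflexive (trans (sumIn-one S) ∣S∣)))
                                      (≤-trans (sumOut-mono S h≤g) (≤-trans (≤-reflexive (sumOut-+ S _ _)) (+-monoʳ-≤ _ block))) ⟩
        κ + (sumOut S (λ v → g q (S [ v ]≔ inside)) + t) ≡⟨ lem κ _ t ⟩
        sumOut S (λ v → g q (S [ v ]≔ inside)) + (κ + t) ∎
        where
        open ≤-Reasoning
        lem : ∀ a b c → a + (b + c) ≡ b + (a + c)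
        lem = solve-∀
        block : sumOut S (λ v → ind (does (color M t v Fin.≟ color M t u))) ≤ t
        block = ≤-trans (sumOut≤sumF S _) (≤-reflexive (trans (sumF-color M t (λ γ → ind (does (γ Fin.≟ color M t u))))
                  (trans (cong (t *_) (sumF-≟ (color M t u))) (*-identityʳ t))))

    E : (ℕ → Bool) → ℕ
    E q = sumS V (g q)

    W : (ℕ → ℕ) → ℕ
    W φ = sumS V (λ S → ind (∣ S ∣ ≡ᵇ κ) * φ (A S))

    W-mono : ∀ φ ψ → (∀ S → ∣ S ∣ ≡ κ → φ (A S) ≤ ψ (A S)) → W φ ≤ W ψ
    W-mono φ ψ le = sumS-mono {V} step
      where
      step : ∀ S → ind (∣ S ∣ ≡ᵇ κ) * φ (A S) ≤ ind (∣ S ∣ ≡ᵇ κ) * ψ (A S)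
      step S with ∣ S ∣ ≡ᵇ κ in eq
      ... | false = z≤n
      ... | true  = +-monoˡ-≤ 0 (le S (≡ᵇ⇒≡ _ _ (Equivalence.from T-≡ eq)))

    W-* : ∀ x φ → W (λ c → x * φ c) ≡ x * W φ
    W-* x φ = trans (sumS-cong {V} (λ S → lem (ind (∣ S ∣ ≡ᵇ κ)) x (φ (A S)))) (sumS-* {V} x _)
      where
      lem : ∀ i x z → i * (x * z) ≡ x * (i * z)
      lem = solve-∀

    -- A `k`-set is reached from each of its `k` subsets of size `κ`.
    extension-sum : ∀ (G : Subset V → ℕ) → (∀ e → ∣ e ∣ ≢ k → G e ≡ 0) →
      k * sumS V G ≡ sumS V (λ S → ind (∣ S ∣ ≡ᵇ κ) * sumOut S (λ v → G (S [ v ]≔ inside)))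
    extension-sum G supp = begin
      k * sumS V G ≡⟨ sumS-* {V} k G ⟨
      sumS V (λ e → k * G e) ≡⟨ sumS-cong {V} size ⟩
      sumS V (λ e → sumIn e (λ _ → G e)) ≡⟨ double-count V (λ e _ → G e) ⟩
      sumS V (λ S → sumOut S (λ v → G (S [ v ]≔ inside))) ≡⟨ sumS-cong {V} restrict ⟩
      _ ∎
      where
      open ≡-Reasoning
      size : ∀ e → k * G e ≡ sumIn e (λ _ → G e)
      size e with ∣ e ∣ ≟ k
      ... | yes eq = trans (cong (_* G e) (sym eq)) (sym (sumIn-const e (G e)))
      ... | no ne  = trans (cong (k *_) (supp e ne)) (trans (*-zeroʳ k)
                       (sym (trans (sumIn-const e (G e)) (trans (cong (∣ e ∣ *_) (supp e ne)) (*-zeroʳ ∣ e ∣)))))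
      restrict : ∀ S → sumOut S (λ v → G (S [ v ]≔ inside)) ≡ ind (∣ S ∣ ≡ᵇ κ) * sumOut S (λ v → G (S [ v ]≔ inside))
      restrict S with ∣ S ∣ ≟ κ
      ... | yes eq = sym (trans (cong (λ z → ind z * X) (≡ᵇ-true eq)) (*-identityˡ X))
        where X = sumOut S (λ v → G (S [ v ]≔ inside))
      ... | no ne  = trans (sumOut-cong S (λ v v∉ → supp _ (λ eq → ne (suc-injective (trans (sym (∣insert∣ S v v∉)) eq)))))
                       (trans (sumOut-* S 0 (λ _ → 0)) (sym (cong (λ z → ind z * sumOut S (λ v → G (S [ v ]≔ inside))) (≡ᵇ-false ne))))

    g-support : ∀ q e → ∣ e ∣ ≢ k → g q e ≡ 0
    g-support q e ne rewrite ≡ᵇ-false ne = refl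

    E-≤ : ∀ q → k * E q ≤ W (λ c → t * N q c)
    E-≤ q = ≤-trans (≤-reflexive (extension-sum (g q) (g-support q))) (sumS-mono {V} step)
      where
      step : ∀ S → ind (∣ S ∣ ≡ᵇ κ) * sumOut S (λ v → g q (S [ v ]≔ inside)) ≤ ind (∣ S ∣ ≡ᵇ κ) * (t * N q (A S))
      step S with ∣ S ∣ ≡ᵇ κ in eq
      ... | false = z≤n
      ... | true  = +-monoˡ-≤ 0 (extensions-≤ S (≡ᵇ⇒≡ _ _ (Equivalence.from T-≡ eq)) q)

    -- `q′` selects the `κ`-sets that are used, so that the error `κ + t` is charged to these alone.
    -- This matters when the edges of one particular type are bounded from below.
    E-≥ : ∀ q (q′ : ℕ → Bool) → W (λ c → ind (q′ c) * (t * N q c)) ≤ k * E q + (κ + t) * W (ind ∘ q′)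
    E-≥ q q′ = begin
      W (λ c → ind (q′ c) * (t * N q c))
        ≤⟨ sumS-mono {V} step ⟩
      sumS V (λ S → ind (∣ S ∣ ≡ᵇ κ) * sumOut S (λ v → g q (S [ v ]≔ inside)) + (κ + t) * (ind (∣ S ∣ ≡ᵇ κ) * ind (q′ (A S))))
        ≡⟨ sumS-+ {V} _ _ ⟩
      sumS V (λ S → ind (∣ S ∣ ≡ᵇ κ) * sumOut S (λ v → g q (S [ v ]≔ inside))) + sumS V (λ S → (κ + t) * (ind (∣ S ∣ ≡ᵇ κ) * ind (q′ (A S))))
        ≡⟨ cong₂ _+_ (sym (extension-sum (g q) (g-support q))) (sumS-* {V} (κ + t) _) ⟩
      k * E q + (κ + t) * W (ind ∘ q′) ∎
      where
      open ≤-Reasoning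
      step : ∀ S → ind (∣ S ∣ ≡ᵇ κ) * (ind (q′ (A S)) * (t * N q (A S))) ≤
                   ind (∣ S ∣ ≡ᵇ κ) * sumOut S (λ v → g q (S [ v ]≔ inside)) + (κ + t) * (ind (∣ S ∣ ≡ᵇ κ) * ind (q′ (A S)))
      step S with ∣ S ∣ ≡ᵇ κ in eq
      ... | false = z≤n
      ... | true with q′ (A S)
      ...   | false = z≤n
      ...   | true  = begin
        t * N q (A S) + 0 + 0 ≡⟨ trans (+-identityʳ _) (+-identityʳ _) ⟩
        t * N q (A S) ≤⟨ extensions-≥ S (≡ᵇ⇒≡ _ _ (Equivalence.from T-≡ eq)) q ⟩
        _ ≡⟨ cong₂ _+_ (sym (+-identityʳ _)) (sym (*-identityʳ (κ + t))) ⟩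
        _ ∎

    -- Consecutive types have opposite parity, so one is dense and the other sparse; hence the
    -- codegree estimate is the same for all `κ`-sets.
    width-sum : ∀ c → width (suc c) + width c ≡ m + r
    width-sum c = split (odd c) p
      where
      split : ∀ o p → (if not (not o xor p) then m else r) + (if not (o xor p) then m else r) ≡ m + r
      split true  true  = +-comm r m
      split true  false = refl
      split false true  = refl
      split false false = +-comm r m

    -- x is kept as a separate variable so that no truncated subtraction occurs.
    minCodegree-H : ∀ x → x + (κ + t) ≤ t * (m + r) → x ≤ minCodegree H
    minCodegree-H x le = minCodegree-≥ H x x≤V λ S ∣S∣ → ≤-trans (+-cancelʳ-≤ (κ + t) _ _ (begin
        x + (κ + t)              ≤⟨ le ⟩
        t * (m + r)              ≡⟨ cong (t *_) (trans (sym (width-sum (A S))) (cong₂ _+_ (sym (*-identityʳ (width (suc (A S))))) (sym (*-identityʳ (width (A S)))))) ⟩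
        t * N (const true) (A S) ≤⟨ extensions-≥ S ∣S∣ (const true) ⟩
        sumOut S (λ v → g (const true) (S [ v ]≔ inside)) + (κ + t)
                                 ≡⟨ cong (_+ (κ + t)) (sumOut-cong S (λ v _ → *-identityʳ _)) ⟩
        sumOut S (λ v → ind (f (S [ v ]≔ inside))) + (κ + t) ∎))
      (codegree-≥ f uniform S)
      where
      open ≤-Reasoning
      x≤V : x ≤ V
      x≤V = begin
        x           ≤⟨ m≤m+n x (κ + t) ⟩
        x + (κ + t) ≤⟨ le ⟩
        t * (m + r) ≤⟨ *-monoʳ-≤ t (+-monoʳ-≤ m r≤m) ⟩
        t * M       ≡⟨ *-comm t M ⟩
        V           ∎

    module _ {ℓ : ℕ} (vanishing : Vanishing (k * ℓ) k t) where

      private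
        Q : Vec ℕ M → ℕ
        Q c = ind ((total c ≡ᵇ k) ∧ (not (mono c) ∧ good (dot a c) (dot y c)))

        ind-f : ∀ e → ind (f e) ≡ Q (cnt M t e)
        ind-f e rewrite sym (total-cnt M t e) | sumIn-color M t a e | sumIn-color M t y e = refl

        bounded : Bounded {t = t} vanishing Q
        bounded c lt rewrite ≡ᵇ-false (>⇒≢ lt) = refl

        mono-vanish : ∀ c → T (mono c) → Q c ≡ 0
        mono-vanish c mc with mono c | total c ≡ᵇ k
        ... | true | true  = refl
        ... | true | false = refl

        zeros : Q (replicate M 0) ≡ 0
        zeros = mono-vanish (replicate M 0) (mono-replicate M)

      divisible : Divisible ℓ H
      divisible = ∣-trans (n∣m*n k) (subst (k * ℓ ∣_) (sym (trans (∣edges∣ f uniform) (sumS-cong {V} ind-f)))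
                    (sum-∣ {t = t} vanishing M Q bounded zeros))
                , λ v → ∣-trans (m∣m*n ℓ) (subst (k * ℓ ∣_) (sym (trans (degree-sum f uniform v)
                    (sumS-cong {V} (λ e → cong (_* ind (lookup e v)) (ind-f e)))))
                    (degree-∣ {t = t} vanishing M Q bounded mono-vanish v))

  -- Weights along a single cycle

  sumN-point : ∀ n g i → i < n → g i ≤ sumN n g
  sumN-point (suc n) g zero    _         = m≤m+n (g 0) _
  sumN-point (suc n) g (suc i) (s≤s i<n) = ≤-trans (sumN-point n (g ∘ suc) i i<n) (m≤n+m _ (g 0))

  module CycleWeights (k L : ℕ) (x : ℕ → ℕ) (x≤1 : ∀ i → x i ≤ 1) (per : ∀ i → x (i + suc L) ≡ x i) where

    open Windows k L x x≤1 per

    private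
      vanish : ∀ {α : ℕ → ℕ} → (∀ i → i < ℓ → c i ≡ c 0) → α (c 0) ≡ 0 → sumN ℓ (α ∘ c) ≡ 0
      vanish {α} const-c z = trans (sumN-cong< ℓ (λ i lt → trans (cong α (const-c i lt)) z)) (sumN-zero ℓ)

      budget : ∀ s p (α : ℕ → ℕ) → (∀ z → α z + s * ind (odd z xor p) ≤ s) → sumN ℓ (α ∘ c) + s * sumN ℓ (bad p) ≤ s * ℓ
      budget s p α le = begin
        sumN ℓ (α ∘ c) + s * sumN ℓ (bad p) ≡⟨ cong (sumN ℓ (α ∘ c) +_) (sumN-* ℓ s (bad p)) ⟨
        sumN ℓ (α ∘ c) + sumN ℓ (λ i → s * bad p i) ≡⟨ sumN-+ ℓ (α ∘ c) (λ i → s * bad p i) ⟨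
        sumN ℓ (λ i → α (c i) + s * bad p i) ≤⟨ sumN-mono ℓ (λ i _ → le (c i)) ⟩
        sumN ℓ (λ _ → s) ≡⟨ trans (sumN-const ℓ s) (*-comm ℓ s) ⟩
        s * ℓ ∎
        where open ≤-Reasoning

    -- With no bad window the type is constant and `none` makes the left side zero. Otherwise at
    -- most `L` windows carry weight, and even one bad window pays `L`.
    simple : ∀ p (α : ℕ → ℕ) → (∀ z → α z + 1 * ind (odd z xor p) ≤ 1) →
      (odd (c 0) ≡ p → k ∣ ℓ * c 0 → α (c 0) ≡ 0) →
      sumN ℓ (α ∘ c) ≤ sumN ℓ (λ i → L * ind (odd (c i) xor p))
    simple p α le none with sumN ℓ (bad p) in eq
    ... | zero  = let (const-c , par , div) = all-same p eq
                  in ≤-trans (≤-reflexive (vanish {α} const-c (none par div))) z≤n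
    ... | suc u = begin
      sumN ℓ (α ∘ c)           ≤⟨ m+n≤o⇒m≤o _ (s≤s⁻¹ bound) ⟩
      L                        ≡⟨ *-identityʳ L ⟨
      L * 1                    ≤⟨ *-monoʳ-≤ L (s≤s (z≤n {u})) ⟩
      L * suc u                ≡⟨ cong (L *_) eq ⟨
      L * sumN ℓ (bad p)       ≡⟨ sumN-* ℓ L (bad p) ⟨
      sumN ℓ (λ i → L * ind (odd (c i) xor p)) ∎
      where
      open ≤-Reasoning
      bound : suc (sumN ℓ (α ∘ c) + u) ≤ suc L
      bound = begin
        suc (sumN ℓ (α ∘ c) + u)             ≡⟨ +-suc _ u ⟨
        sumN ℓ (α ∘ c) + suc u               ≡⟨ cong (sumN ℓ (α ∘ c) +_) (trans (sym eq) (sym (*-identityˡ _))) ⟩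
        sumN ℓ (α ∘ c) + 1 * sumN ℓ (bad p)  ≤⟨ budget 1 p α le ⟩
        1 * ℓ                                ≡⟨ *-identityˡ ℓ ⟩
        suc L                                ∎

    -- Good windows now weigh at most 2. If there are two or more bad ones, the rest weighs at most
    -- `2 * (ℓ - 2) = 2 * L′`, so `L′` from each suffices. A single bad window has to pay `2 * L`;
    -- by `excl` and the equation of `one-bad` it is not of type `e`, so type `e` may always be
    -- charged only `L′`.
    refined : ∀ p L′ → L ≡ suc L′ → ∀ (α : ℕ → ℕ) e → (∀ z → α z + 2 * ind (odd z xor p) ≤ 2) →
      (odd (c 0) ≡ p → c 0 ≤ k → k ∣ ℓ * c 0 → α (c 0) ≡ 0) →
      (∀ b X → b ≤ k → odd b ≡ p → e ≡ suc b ⊎ b ≡ suc e → e + L * b ≢ k * X) →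
      sumN ℓ (α ∘ c) ≤ sumN ℓ (λ i → ind (odd (c i) xor p) * (if c i ≡ᵇ e then L′ else 2 * L))
    refined p L′ refl α e le none excl with sumN ℓ (bad p) in eq
    ... | zero = let (const-c , par , div) = all-same p eq
                 in ≤-trans (≤-reflexive (vanish {α} const-c (none par (c≤k 0) div))) z≤n
    ... | suc zero with one-bad p (s≤s z≤n) eq
    ...   | i , b , i<ℓ , b≤k , par , ne , adj , total-eq = begin
      sumN ℓ (α ∘ c) ≤⟨ +-cancelʳ-≤ 2 _ _ (≤-trans (subst (λ z → sumN ℓ (α ∘ c) + 2 * z ≤ 2 * ℓ) eq (budget 2 p α le)) (≤-reflexive (lem L))) ⟩
      2 * L          ≡⟨ *-identityˡ (2 * L) ⟨
      1 * (2 * L)    ≡⟨ cong₂ (λ z z′ → z * (if z′ then L′ else 2 * L)) (sym bad-i) (sym (≡ᵇ-false ci≢e)) ⟩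
      ind (odd (c i) xor p) * (if c i ≡ᵇ e then L′ else 2 * L)
                     ≤⟨ sumN-point ℓ (λ i → ind (odd (c i) xor p) * (if c i ≡ᵇ e then L′ else 2 * L)) i i<ℓ ⟩
      _ ∎
      where
      open ≤-Reasoning
      lem : ∀ L → 2 * suc L ≡ 2 * L + 2
      lem = solve-∀
      bad-i : ind (odd (c i) xor p) ≡ 1
      bad-i with odd (c i) xor p in eq′
      ... | true  = refl
      ... | false = contradiction (xor-zero (odd (c i)) p (cong ind eq′)) ne
      ci≢e : c i ≢ e
      ci≢e eq′ = excl b X b≤k par (subst (λ z → z ≡ suc b ⊎ b ≡ suc z) eq′ adj)
                   (trans (cong (_+ L * b) (sym eq′)) total-eq)
    refined p L′ refl α e le none excl | suc (suc u) = begin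
      sumN ℓ (α ∘ c) ≤⟨ +-cancelʳ-≤ (2 * suc (suc u)) _ _ bound ⟩
      L′ * suc (suc u) ≡⟨ cong (L′ *_) eq ⟨
      L′ * sumN ℓ (bad p) ≡⟨ sumN-* ℓ L′ (bad p) ⟨
      sumN ℓ (λ i → L′ * bad p i) ≤⟨ sumN-mono ℓ (λ i _ → weight (c i)) ⟩
      _ ∎
      where
      open ≤-Reasoning
      weight : ∀ z → L′ * ind (odd z xor p) ≤ ind (odd z xor p) * (if z ≡ᵇ e then L′ else 2 * L)
      weight z with z ≡ᵇ e
      ... | true  = ≤-reflexive (*-comm L′ _)
      ... | false = ≤-trans (≤-reflexive (*-comm L′ _)) (*-monoʳ-≤ (ind (odd z xor p)) (≤-trans (n≤1+n L′) (m≤m+n L _)))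
      lem : ∀ L′ u → 2 * suc (suc L′) + L′ * u ≤ L′ * suc (suc u) + 2 * suc (suc u)
      lem L′ u = ≤-trans (m≤m+n _ (2 * u)) (≤-reflexive (eq′ L′ u))
        where
        eq′ : ∀ L′ u → 2 * suc (suc L′) + L′ * u + 2 * u ≡ L′ * suc (suc u) + 2 * suc (suc u)
        eq′ = solve-∀
      bound : sumN ℓ (α ∘ c) + 2 * suc (suc u) ≤ L′ * suc (suc u) + 2 * suc (suc u)
      bound = begin
        sumN ℓ (α ∘ c) + 2 * suc (suc u) ≤⟨ subst (λ z → sumN ℓ (α ∘ c) + 2 * z ≤ 2 * ℓ) eq (budget 2 p α le) ⟩
        2 * ℓ                            ≤⟨ m≤m+n _ (L′ * u) ⟩
        2 * suc (suc L′) + L′ * u        ≤⟨ lem L′ u ⟩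
        _ ∎

  -- Edge numbers by type

  module Counting (κ m t r : ℕ) (p : Bool) .{{_ : NonZero m}} (1≤κ : 1 ≤ κ) (r≤m : r ≤ m) (κ≤t : κ ≤ t) where

    open Construction κ m t r p 1≤κ r≤m public

    -- `K` counts all `κ`-sets and `P` those inside `A`; `O` counts the edges of the dense parity
    -- and `X` the extra edges.
    K P O X : ℕ
    K = W (const 1)
    P = W (λ c → ind (c ≡ᵇ κ))
    O = E same
    X = E (λ c → odd c xor p)

    diff : ℕ → Bool
    diff c = odd c xor p

    A≤ : ∀ S → A S ≤ ∣ S ∣
    A≤ S = ≤-trans (sumIn-mono S a≤1) (≤-reflexive (sumIn-one S))

    K-pos : 0 < K
    K-pos with subset-of-size V κ κ≤V
      where
      κ≤V : κ ≤ V
      κ≤V = ≤-trans κ≤t (≤-trans (≤-reflexive (sym (*-identityˡ t))) (*-monoˡ-≤ t (≤-trans (>-nonZero⁻¹ m) (m≤m+n m m))))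
    ... | S , eq = ≤-trans (≤-reflexive (sym (trans (*-identityʳ _) (cong ind (≡ᵇ-true eq)))))
                     (sumS-point {V} (λ S → ind (∣ S ∣ ≡ᵇ κ) * 1) S)

    N-same : ∀ c → N same c ≡ m
    N-same c = split (odd c) p
      where
      split : ∀ o p → (if not (not o xor p) then m else r) * ind (not (not o xor p))
                    + (if not (o xor p) then m else r) * ind (not (o xor p)) ≡ m
      split true  true  = trans (cong₂ _+_ (*-zeroʳ r) (*-identityʳ m)) refl
      split true  false = trans (cong₂ _+_ (*-identityʳ m) (*-zeroʳ r)) (+-identityʳ m)
      split false true  = trans (cong₂ _+_ (*-identityʳ m) (*-zeroʳ r)) (+-identityʳ m)
      split false false = trans (cong₂ _+_ (*-zeroʳ r) (*-identityʳ m)) refl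

    N-diff : ∀ c → N diff c ≡ r
    N-diff c = split (odd c) p
      where
      split : ∀ o p → (if not (not o xor p) then m else r) * ind (not o xor p)
                    + (if not (o xor p) then m else r) * ind (o xor p) ≡ r
      split true  true  = trans (cong₂ _+_ (*-identityʳ r) (*-zeroʳ m)) (+-identityʳ r)
      split true  false = trans (cong₂ _+_ (*-zeroʳ m) (*-identityʳ r)) refl
      split false true  = trans (cong₂ _+_ (*-zeroʳ m) (*-identityʳ r)) refl
      split false false = trans (cong₂ _+_ (*-identityʳ r) (*-zeroʳ m)) (+-identityʳ r)

    -- Together with `X-≤` this makes `O` to `X` at least about `m` to `r`, so a bound `O ≤ L * X`
    -- fails once `m` exceeds `L * r` by a constant.
    O-≥ : t * m * K ≤ k * O + (κ + t) * K
    O-≥ = ≤-trans (≤-reflexive (sym (W-* (t * m) (const 1))))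
      (≤-trans (W-mono (λ c → t * m * 1) (λ c → 1 * (t * N same c)) (λ S _ → ≤-reflexive (trans (*-identityʳ (t * m)) (trans (cong (t *_) (sym (N-same (A S)))) (sym (*-identityˡ _))))))
      (E-≥ same (const true)))

    X-≤ : k * X ≤ t * r * K
    X-≤ = ≤-trans (E-≤ diff) (≤-trans
      (W-mono (λ c → t * N diff c) (λ c → t * r * 1) (λ S _ → ≤-reflexive (trans (trans (cong (t *_) (N-diff (A S))) refl) (sym (*-identityʳ (t * r))))))
      (≤-reflexive (W-* (t * r) (const 1))))

    Eφ : (ℕ → ℕ) → ℕ
    Eφ φ = sumS V (λ e → ind (f e) * φ (A e))

    Eφ-mono : ∀ {φ ψ} → (∀ c → φ c ≤ ψ c) → Eφ φ ≤ Eφ ψ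
    Eφ-mono le = sumS-mono {V} (λ e → *-monoʳ-≤ (ind (f e)) (le (A e)))

    Eφ-+ : ∀ φ ψ → Eφ (λ c → φ c + ψ c) ≡ Eφ φ + Eφ ψ
    Eφ-+ φ ψ = trans (sumS-cong {V} (λ e → *-distribˡ-+ (ind (f e)) _ _)) (sumS-+ {V} _ _)

    Eφ-* : ∀ x φ → Eφ (λ c → x * φ c) ≡ x * Eφ φ
    Eφ-* x φ = trans (sumS-cong {V} (λ e → lem (ind (f e)) x (φ (A e)))) (sumS-* {V} x _)
      where
      lem : ∀ i x z → i * (x * z) ≡ x * (i * z)
      lem = solve-∀

    decomposition-Eφ : ∀ L → k < suc L → HasDecomposition (suc L) H → ∀ α β →
      (∀ x (x≤1 : ∀ i → x i ≤ 1) (per : ∀ i → x (i + suc L) ≡ x i) →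
         sumN (suc L) (λ i → α (sumN k (λ j → x (i + j)))) ≤ sumN (suc L) (λ i → β (sumN k (λ j → x (i + j))))) →
      Eφ α ≤ Eφ β
    decomposition-Eφ L k<ℓ dec α β le = subst₂ _≤_ (sumL-edges f uniform (α ∘ A)) (sumL-edges f uniform (β ∘ A))
      (decomposition-≤ H dec (α ∘ A) (β ∘ A) λ C →
        subst₂ _≤_ (sym (sumL-cycleEdges C k k<ℓ aᵥ α)) (sym (sumL-cycleEdges C k k<ℓ aᵥ β))
          (le (aᵥ ∘ at C) (λ i → a≤1 (at C i)) (λ i → cong aᵥ (at-periodic C i))))

  -- From hypergraphs to Dedekind cuts

  ∋⇒< : ∀ (x : ℝ) {p q} → x ∋ p → ¬ (x ∋ q) → p ℚ.< q
  ∋⇒< x {p} {q} p∈ q∉ with ℚ.<-cmp p q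
  ... | tri< p<q _ _  = p<q
  ... | tri≈ _ refl _ = contradiction p∈ q∉
  ... | tri> _ _ q<p  = contradiction (ℝ.down x q<p p∈) q∉

  ·-upper : ∀ n (x : ℝ) d → (∀ {z} → x ∋ z → z ℚ.< d) → ∀ {z} → (n · x) ∋ z → z ℚ.< fromℚᵘ (mkℚᵘ (ℤ.+ n) 0) ℚ.* d
  ·-upper zero    x d ub z< = subst (_ ℚ.<_) (sym (ℚ.*-zeroˡ d)) z<
  ·-upper (suc n) x d ub {z} (a , b , a∈ , b∈ , refl) = subst (z ℚ.<_) eq (ℚ.+-mono-< (ub a∈) (·-upper n x d ub b∈))
    where
    eq : d ℚ.+ fromℚᵘ (mkℚᵘ (ℤ.+ n) 0) ℚ.* d ≡ fromℚᵘ (mkℚᵘ (ℤ.+ suc n) 0) ℚ.* d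
    eq = trans (cong (ℚ._+ fromℚᵘ (mkℚᵘ (ℤ.+ n) 0) ℚ.* d) (sym (ℚ.*-identityˡ d)))
      (trans (sym (ℚ.*-distribʳ-+ d 1ℚ (fromℚᵘ (mkℚᵘ (ℤ.+ n) 0)))) (cong (ℚ._* d) (ℚ.toℚᵘ-injective (begin
        toℚᵘ (1ℚ ℚ.+ fromℚᵘ (mkℚᵘ (ℤ.+ n) 0))        ≈⟨ ℚ.toℚᵘ-homo-+ 1ℚ (fromℚᵘ (mkℚᵘ (ℤ.+ n) 0)) ⟩
        toℚᵘ 1ℚ ℚᵘ.+ toℚᵘ (fromℚᵘ (mkℚᵘ (ℤ.+ n) 0)) ≈⟨ ℚᵘ.+-congʳ (toℚᵘ 1ℚ) (ℚ.toℚᵘ-fromℚᵘ (mkℚᵘ (ℤ.+ n) 0)) ⟩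
        toℚᵘ 1ℚ ℚᵘ.+ mkℚᵘ (ℤ.+ n) 0                  ≈⟨ ℚᵘ.*≡* (cong (λ z → (ℤ.+ 1 ℤ.+ z) ℤ.* ℤ.+ 1) (ℤ.*-identityʳ (ℤ.+ n))) ⟩
        mkℚᵘ (ℤ.+ suc n) 0                            ≈⟨ ℚ.toℚᵘ-fromℚᵘ (mkℚᵘ (ℤ.+ suc n) 0) ⟨
        toℚᵘ (fromℚᵘ (mkℚᵘ (ℤ.+ suc n) 0)) ∎))))
      where open ℚᵘ.≃-Reasoning

  -- Two distinct fractions with denominators `s` and `suc b` differ by at least `1 / (s * suc b)`.
  -- This gap between `d` and `a / suc b` absorbs the error term `n` of the hypothesis.
  scale-≤ : ∀ n a b mc (d : ℚ) → let s = suc (ℚ.denominator-1 d) in d ℚ.< fromℚᵘ (mkℚᵘ (ℤ.+ a) b) →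
    n ℕ.* (a ℕ.* s) ℕ.≤ mc ℕ.* (suc b ℕ.* s) ℕ.+ n →
    fromℚᵘ (mkℚᵘ (ℤ.+ n) 0) ℚ.* d ℚ.≤ fromℚᵘ (mkℚᵘ (ℤ.+ mc) 0)
  scale-≤ n a b mc d@(mkℚ i den _) d< le = ℚ.toℚᵘ-cancel-≤ (begin
      toℚᵘ (fromℚᵘ (mkℚᵘ (ℤ.+ n) 0) ℚ.* d)          ≃⟨ ℚ.toℚᵘ-homo-* (fromℚᵘ (mkℚᵘ (ℤ.+ n) 0)) d ⟩
      toℚᵘ (fromℚᵘ (mkℚᵘ (ℤ.+ n) 0)) ℚᵘ.* toℚᵘ d    ≃⟨ ℚᵘ.*-congʳ (ℚ.toℚᵘ-fromℚᵘ (mkℚᵘ (ℤ.+ n) 0)) ⟩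
      mkℚᵘ (ℤ.+ n) 0 ℚᵘ.* toℚᵘ d                    ≤⟨ core ⟩
      mkℚᵘ (ℤ.+ mc) 0                               ≃⟨ ℚ.toℚᵘ-fromℚᵘ (mkℚᵘ (ℤ.+ mc) 0) ⟨
      toℚᵘ (fromℚᵘ (mkℚᵘ (ℤ.+ mc) 0))               ∎)
    where
    open ℚᵘ.≤-Reasoning
    s B : ℤ
    s = ↧ d
    B = ℤ.+ suc b

    num : i ℤ.* B ℤ.< ℤ.+ a ℤ.* s
    num with ℚᵘ.<-respʳ-≃ (ℚ.toℚᵘ-fromℚᵘ (mkℚᵘ (ℤ.+ a) b)) (ℚ.toℚᵘ-mono-< d<)
    ... | *<* lt = lt
    leℤ : ℤ.+ n ℤ.* (ℤ.+ a ℤ.* s) ℤ.≤ ℤ.+ mc ℤ.* (B ℤ.* s) ℤ.+ ℤ.+ n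
    leℤ = subst₂ ℤ._≤_ (trans (ℤ.pos-* n _) (cong (ℤ.+ n ℤ.*_) (ℤ.pos-* a _)))
       (trans (ℤ.pos-+ (mc ℕ.* _) n) (cong (ℤ._+ ℤ.+ n) (trans (ℤ.pos-* mc _) (cong (ℤ.+ mc ℤ.*_) (ℤ.pos-* (suc b) _)))))
       (ℤ.+≤+ le)
    step : ℤ.+ n ℤ.* i ℤ.* B ℤ.+ ℤ.+ n ℤ.≤ ℤ.+ mc ℤ.* s ℤ.* B ℤ.+ ℤ.+ n
    step = ℤ.≤-trans (ℤ.≤-reflexive (lem₁ (ℤ.+ n) i B))
      (ℤ.≤-trans (ℤ.*-monoˡ-≤-nonNeg (ℤ.+ n) (ℤ.i<j⇒suc[i]≤j num))
      (ℤ.≤-trans leℤ (ℤ.≤-reflexive (lem₂ (ℤ.+ mc) B s (ℤ.+ n)))))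
      where
      lem₁ : ∀ n i B → n ℤ.* i ℤ.* B ℤ.+ n ≡ n ℤ.* (ℤ.1ℤ ℤ.+ i ℤ.* B)
      lem₁ = ℤSolver.solve-∀
      lem₂ : ∀ m B s n → m ℤ.* (B ℤ.* s) ℤ.+ n ≡ m ℤ.* s ℤ.* B ℤ.+ n
      lem₂ = ℤSolver.solve-∀
    ni≤ : ℤ.+ n ℤ.* i ℤ.≤ ℤ.+ mc ℤ.* s
    ni≤ = ℤ.*-cancelʳ-≤-pos (ℤ.+ n ℤ.* i) (ℤ.+ mc ℤ.* s) B (subst₂ ℤ._≤_ (lem (ℤ.+ n ℤ.* i ℤ.* B) (ℤ.+ n)) (lem (ℤ.+ mc ℤ.* s ℤ.* B) (ℤ.+ n)) (ℤ.+-monoˡ-≤ (ℤ.- ℤ.+ n) step))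
      where
      lem : ∀ x n → x ℤ.+ n ℤ.+ ℤ.- n ≡ x
      lem = ℤSolver.solve-∀
    core : mkℚᵘ (ℤ.+ n) 0 ℚᵘ.* toℚᵘ d ℚᵘ.≤ mkℚᵘ (ℤ.+ mc) 0
    core = *≤* (subst₂ ℤ._≤_ (sym (ℤ.*-identityʳ (ℤ.+ n ℤ.* i))) (cong (ℤ.+ mc ℤ.*_) (sym (ℤ.*-identityˡ s))) ni≤)

  -- The last condition says, free of denominators, that the minimum codegree is at least
  -- `a / suc b - 1 / (suc b * suc N)` times `n`; `N` sets the precision.
  Obstruction : (k ℓ a b : ℕ) → Set
  Obstruction k ℓ a b = ∀ N n₀ → ∃[ n ] n₀ ℕ.≤ n × Σ (KGraph k n) λ H →
    Divisible ℓ H × ¬ HasDecomposition ℓ H ×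
    n ℕ.* (a ℕ.* suc N) ℕ.≤ minCodegree H ℕ.* (suc b ℕ.* suc N) ℕ.+ n

  -- If `δ` were smaller, some rational `q` below the bound would lie outside the cut of `δ`. Take
  -- `d` strictly between `q` and `a / suc b` and `ε = d - q`; then `δ + ε` is at most `d`, and the
  -- hypergraph whose precision is the denominator of `d` contradicts `forces`.
  obstruction⇒≤ : ∀ {k ℓ a b} → Obstruction k ℓ a b → ∀ {β} → β ℚ.≤ fromℚᵘ (mkℚᵘ (ℤ.+ a) b) →
    ∀ δ → Forces k ℓ δ → fromℚ β ≤ᴿ δ
  obstruction⇒≤ {k} {ℓ} {a} {b} obstruction {β} β≤ δ forces (q , q<β , q∉δ) =
    let (d , q<d , d<) = ℚ.<-dense (ℚ.<-≤-trans q<β β≤)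
        ε = d ℚ.- q
        q+ε≡d : q ℚ.+ ε ≡ d
        q+ε≡d = trans (ℚ.+-comm q ε) (trans (ℚ.+-assoc d (ℚ.- q) q)
                  (trans (cong (d ℚ.+_) (ℚ.+-inverseˡ q)) (ℚ.+-identityʳ d)))
        0<ε = subst (ℚ._< ε) (ℚ.+-inverseʳ q) (ℚ.+-monoˡ-< (ℚ.- q) q<d)
        (n₀ , decomposable) = forces (fromℚ ε) (0ℚ , 0<ε , ℚ.<-irrefl refl)
        (n , n₀≤n , H , div , indecomposable , dense) = obstruction (ℚ.denominator-1 d) n₀
        upper : ∀ {z} → (δ +ᴿ fromℚ ε) ∋ z → z ℚ.< d
        upper = λ { {z} (u , v , u∈ , v< , eq) → subst₂ ℚ._<_ (sym eq) q+ε≡d (ℚ.+-mono-< (∋⇒< δ u∈ q∉δ) v<) }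
    in indecomposable (decomposable n n₀≤n H div λ (z , z∈ , z≮) →
         z≮ (ℚ.<-≤-trans (·-upper n (δ +ᴿ fromℚ ε) d upper z∈) (scale-≤ n a b (minCodegree H) d d< dense)))

  -- Indecomposability of the parity construction

  module Obstruct (κ m t r : ℕ) (p : Bool) .{{_ : NonZero m}} (1≤κ : 1 ≤ κ) (r≤m : r ≤ m) (κ≤t : κ ≤ t) where

    open Counting κ m t r p 1≤κ r≤m κ≤t public

    -- All `k`-sets are counted, not only edges, so that the value does not depend on `p` and the
    -- two choices of `p` can be compared.
    U : (ℕ → Bool) → ℕ
    U q = sumS V (λ e → ind (∣ e ∣ ≡ᵇ k) * ind (q (A e)))

    E≤U : ∀ q → E q ≤ U q
    E≤U q = sumS-mono {V} λ e → *-monoˡ-≤ (ind (q (A e)))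
      (≤-trans (≤-reflexive (ind-∧ (∣ e ∣ ≡ᵇ k) _)) (≤-trans (*-monoʳ-≤ (ind (∣ e ∣ ≡ᵇ k)) (ind≤1 _)) (≤-reflexive (*-identityʳ (ind (∣ e ∣ ≡ᵇ k))))))

    -- Of two consecutive types at most one satisfies `q`, so a `κ`-set is completed only from `A`
    -- or only from outside `A`, that is, by at most `t * m` vertices.
    U-≤ : ∀ q → (∀ c → ind (q (suc c)) + ind (q c) ≤ 1) → k * U q ≤ t * m * K
    U-≤ q once = ≤-trans (≤-reflexive (extension-sum _ supp))
      (≤-trans (sumS-mono {V} (λ S → *-monoʳ-≤ (ind (∣ S ∣ ≡ᵇ κ)) (≤-trans (step S) (≤-reflexive (sym (*-identityʳ (t * m)))))))
               (≤-reflexive (W-* (t * m) (const 1))))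
      where
      supp : ∀ e → ∣ e ∣ ≢ k → ind (∣ e ∣ ≡ᵇ k) * ind (q (A e)) ≡ 0
      supp e ne rewrite ≡ᵇ-false ne = refl
      count : ∀ c → sumF V (λ v → ind (q (aᵥ v + c))) ≤ t * m
      count c = begin
        sumF V (λ v → ind (q (aᵥ v + c))) ≡⟨ sumF-color M t (λ γ → ind (q (a γ + c))) ⟩
        t * sumF M (λ γ → ind (q (a γ + c))) ≡⟨ cong (t *_) (sumF-label (λ α _ → ind (q (α + c)))) ⟩
        t * (sumN m (λ _ → ind (q (suc c))) + sumN m (λ _ → ind (q c)))
          ≡⟨ cong (t *_) (trans (cong₂ _+_ (sumN-const m _) (sumN-const m _)) (sym (*-distribˡ-+ m _ _))) ⟩
        t * (m * (ind (q (suc c)) + ind (q c))) ≤⟨ *-monoʳ-≤ t (*-monoʳ-≤ m (once c)) ⟩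
        t * (m * 1) ≡⟨ cong (t *_) (*-identityʳ m) ⟩
        t * m ∎
        where open ≤-Reasoning
      step : ∀ S → sumOut S (λ v → ind (∣ S [ v ]≔ inside ∣ ≡ᵇ k) * ind (q (A (S [ v ]≔ inside)))) ≤ t * m
      step S = ≤-trans (sumOut-mono S λ v v∉ → ≤-trans (*-monoˡ-≤ _ (ind≤1 (∣ S [ v ]≔ inside ∣ ≡ᵇ k)))
                   (≤-reflexive (trans (*-identityˡ _) (cong (ind ∘ q) (sumIn-insert S aᵥ v v∉)))))
               (≤-trans (sumOut≤sumF S _) (count (A S)))

    module _ (L : ℕ) (k<ℓ : k < suc L) (D : ℕ → Bool) (multiples : ∀ c → k ∣ suc L * c → T (D c)) where

      -- `D` contains every type that a cycle without extra edges can have. Dense edges of these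
      -- types are exempt; the others are paid for by the extra edges at `L` each.
      simple-bound : HasDecomposition (suc L) H → O ≤ L * X + E (λ c → same c ∧ D c)
      simple-bound dec = begin
        O ≤⟨ Eφ-mono {ind ∘ same} {λ c → α c + ind (same c ∧ D c)} (λ c → split (same c) (D c)) ⟩
        Eφ (λ c → α c + ind (same c ∧ D c)) ≡⟨ Eφ-+ α (λ c → ind (same c ∧ D c)) ⟩
        Eφ α + E (λ c → same c ∧ D c) ≤⟨ +-monoˡ-≤ _ (decomposition-Eφ L k<ℓ dec α (λ c → L * ind (diff c))
             (λ x x≤1 per → CycleWeights.simple k L x x≤1 per p α le (λ par div → vanish _ (multiples _ div)))) ⟩
        Eφ (λ c → L * ind (diff c)) + E (λ c → same c ∧ D c) ≡⟨ cong (_+ E (λ c → same c ∧ D c)) (Eφ-* L (ind ∘ diff)) ⟩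
        L * X + E (λ c → same c ∧ D c) ∎
        where
        open ≤-Reasoning
        α : ℕ → ℕ
        α c = ind (same c ∧ not (D c))
        split : ∀ s d → ind s ≤ ind (s ∧ not d) + ind (s ∧ d)
        split true  true  = ≤-refl
        split true  false = ≤-refl
        split false d     = z≤n
        le : ∀ z → α z + 1 * ind (odd z xor p) ≤ 1
        le z with odd z xor p
        ... | true  = ≤-refl
        ... | false = ≤-trans (≤-reflexive (+-identityʳ _)) (ind≤1 (not (D z)))
        vanish : ∀ c → T (D c) → α c ≡ 0
        vanish c d with D c | same c
        ... | true | true  = refl
        ... | true | false = refl

    kO-≥ : t * m * K ≤ k * O + 2 * t * K
    kO-≥ = ≤-trans O-≥ (+-monoʳ-≤ (k * O) (*-monoˡ-≤ K (≤-trans (+-monoˡ-≤ t κ≤t) (≤-reflexive (lem t)))))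
      where
      lem : ∀ t → t + t ≡ 2 * t
      lem = solve-∀

    -- The number of `s`-sets of type `c`, which for `c ≤ s` is `binom h c * binom h (s - c)` with
    -- `h = t * m` the size of both `A` and its complement. Only its recursions are established.
    K2 : ℕ → ℕ → ℕ
    K2 s c = sumS V (λ S → ind (∣ S ∣ ≡ᵇ s) * ind (A S ≡ᵇ c))

    private
      h : ℕ
      h = t * m

      a-total : sumF V aᵥ ≡ h
      a-total = trans (sumF-color M t a) (cong (t *_) (trans (sumF-label (λ α _ → α))
        (trans (cong₂ _+_ (sumN-const m 1) (sumN-zero m)) (trans (+-identityʳ (m * 1)) (*-identityʳ m)))))

      a+b : ∀ v → aᵥ v + bᵥ v ≡ 1
      a+b v with splitAt m (color M t v)
      ... | inj₁ _ = refl
      ... | inj₂ _ = refl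

      b-total : sumF V bᵥ ≡ h
      b-total = +-cancelˡ-≡ (sumF V aᵥ) _ _ (begin
        sumF V aᵥ + sumF V bᵥ       ≡⟨ sumF-+ aᵥ bᵥ ⟨
        sumF V (λ v → aᵥ v + bᵥ v)  ≡⟨ sumF-cong a+b ⟩
        sumF V (λ _ → 1)            ≡⟨ trans (sumF-const V 1) (*-identityʳ V) ⟩
        (m + m) * t                 ≡⟨ lem m t ⟩
        h + h                       ≡⟨ cong (_+ h) a-total ⟨
        sumF V aᵥ + h               ∎)
        where
        open ≡-Reasoning
        lem : ∀ m t → (m + m) * t ≡ t * m + t * m
        lem = solve-∀

      A+B : ∀ e → A e + sumIn e bᵥ ≡ ∣ e ∣
      A+B e = trans (sym (sumIn-+ e aᵥ bᵥ)) (trans (sumIn-cong e a+b) (sumIn-one e))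
        where
        sumIn-+ : ∀ {n} (e : Subset n) g g′ → sumIn e (λ v → g v + g′ v) ≡ sumIn e g + sumIn e g′
        sumIn-+ []          g g′ = refl
        sumIn-+ (true ∷ e)  g g′ = trans (cong (g zero + g′ zero +_) (sumIn-+ e (g ∘ suc) (g′ ∘ suc)))
                                         (+-interchange (g zero) (g′ zero) _ _)
        sumIn-+ (false ∷ e) g g′ = sumIn-+ e (g ∘ suc) (g′ ∘ suc)

      weigh : ∀ s c (w : Subset V → ℕ) x → (∀ e → ∣ e ∣ ≡ s → A e ≡ c → w e ≡ x) → ∀ e →
              ind (∣ e ∣ ≡ᵇ s) * ind (A e ≡ᵇ c) * w e ≡ x * (ind (∣ e ∣ ≡ᵇ s) * ind (A e ≡ᵇ c))
      weigh s c w x hyp e with ∣ e ∣ ≡ᵇ s in eq₁ | A e ≡ᵇ c in eq₂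
      ... | true  | true  = trans (+-identityʳ (w e)) (trans (hyp e (≡ᵇ⇒≡ _ s (Equivalence.from T-≡ eq₁)) (≡ᵇ⇒≡ _ c (Equivalence.from T-≡ eq₂))) (sym (*-identityʳ x)))
      ... | true  | false = sym (*-zeroʳ x)
      ... | false | _     = sym (*-zeroʳ x)

    -- The recursion `(c + 1) * binom h (c + 1) = (h - c) * binom h c` without subtraction, obtained
    -- by adding a vertex of `A`; `extend-B` adds one outside `A`.
    extend-A : ∀ s c → suc c * K2 (suc s) (suc c) + c * K2 s c ≡ h * K2 s c
    extend-A s c = trans (count-extensions aᵥ _ _ (suc c) c
        (weigh (suc s) (suc c) A (suc c) (λ _ _ eq → eq)) (weigh s c A c (λ _ _ eq → eq)) ext)
      (cong (_* K2 s c) a-total)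
      where
      ext : ∀ S v → lookup S v ≡ outside →
        ind (∣ S [ v ]≔ inside ∣ ≡ᵇ suc s) * ind (A (S [ v ]≔ inside) ≡ᵇ suc c) * aᵥ v ≡
        ind (∣ S ∣ ≡ᵇ s) * ind (A S ≡ᵇ c) * aᵥ v
      ext S v v∉ rewrite ∣insert∣ S v v∉ | sumIn-insert S aᵥ v v∉ with aᵥ v | a≤1 v
      ... | zero  | _       = trans (*-zeroʳ (ind (∣ S ∣ ≡ᵇ s) * ind (A S ≡ᵇ suc c))) (sym (*-zeroʳ (ind (∣ S ∣ ≡ᵇ s) * ind (A S ≡ᵇ c))))
      ... | suc zero | _    = refl
      ... | suc (suc _) | s≤s ()

    extend-B : ∀ c d → suc d * K2 (suc (c + d)) c + d * K2 (c + d) c ≡ h * K2 (c + d) c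
    extend-B c d = trans (count-extensions bᵥ _ _ (suc d) d
        (weigh (suc (c + d)) c B (suc d) (λ e eq₁ eq₂ → outside-A e (suc d) eq₂ (trans eq₁ (sym (+-suc c d)))))
        (weigh (c + d) c B d (λ e eq₁ eq₂ → outside-A e d eq₂ eq₁)) ext)
      (cong (_* K2 (c + d) c) b-total)
      where
      B : Subset V → ℕ
      B e = sumIn e bᵥ
      outside-A : ∀ e x → A e ≡ c → ∣ e ∣ ≡ c + x → B e ≡ x
      outside-A e x eq₂ eq₁ = +-cancelˡ-≡ c _ _ (trans (cong (_+ B e) (sym eq₂)) (trans (A+B e) eq₁))
      ext : ∀ S v → lookup S v ≡ outside →
        ind (∣ S [ v ]≔ inside ∣ ≡ᵇ suc (c + d)) * ind (A (S [ v ]≔ inside) ≡ᵇ c) * bᵥ v ≡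
        ind (∣ S ∣ ≡ᵇ c + d) * ind (A S ≡ᵇ c) * bᵥ v
      ext S v v∉ rewrite ∣insert∣ S v v∉ | sumIn-insert S aᵥ v v∉ with aᵥ v | bᵥ v | a+b v
      ... | zero        | .1 | refl = refl
      ... | suc zero    | .0 | refl = trans (*-zeroʳ (ind (∣ S ∣ ≡ᵇ c + d) * ind (suc (A S) ≡ᵇ c))) (sym (*-zeroʳ (ind (∣ S ∣ ≡ᵇ c + d) * ind (A S ≡ᵇ c))))
      ... | suc (suc _) | _  | ()

    module _ (q : ℕ) (κ≡ : κ ≡ suc (suc q)) (2≤q : 2 ≤ q) where

      private
        instance
          h≢0 : NonZero h
          h≢0 = m*n≢0 t m {{>-nonZero (≤-trans 1≤κ κ≤t)}}

        p₀ p₁ p₂ : ℕ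
        p₀ = K2 (suc (suc q)) (suc (suc q))
        p₁ = K2 (suc q) (suc q)
        p₂ = K2 q q

        P≡ : P ≡ p₀
        P≡ = cong (λ z → K2 z z) κ≡

        shrink : ∀ c x y z → suc (suc c) * x + suc c * y ≡ z * y → suc (suc c) * x + y ≤ z * y
        shrink c x y z eq = ≤-trans (+-monoʳ-≤ (suc (suc c) * x) (m≤m+n y (c * y))) (≤-reflexive eq)

      -- This is `(q + 2) * binom h (q + 2) ≤ h * binom h (q +
      -- 1)`; the right side counts the `κ`-sets with exactly one vertex outside `A`.
      2P≤K₁ : 2 * P ≤ K2 κ (suc q)
      2P≤K₁ = begin
        2 * P                      ≡⟨ cong (2 *_) P≡ ⟩
        2 * p₀                     ≤⟨ *-monoˡ-≤ p₀ (s≤s (s≤s (z≤n {q}))) ⟩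
        suc (suc q) * p₀           ≤⟨ m+n≤o⇒m≤o _ (shrink q p₀ p₁ h (extend-A (suc q) (suc q))) ⟩
        h * p₁                     ≡⟨ one-outside (suc q) ⟨
        K2 (suc (suc q)) (suc q)   ≡⟨ cong (λ z → K2 z (suc q)) κ≡ ⟨
        K2 κ (suc q)               ∎
        where
        open ≤-Reasoning
        one-outside : ∀ c → K2 (suc c) c ≡ h * K2 c c
        one-outside c = trans (cong (λ z → K2 (suc z) c) (sym (+-identityʳ c)))
          (trans (lem (K2 (suc (c + 0)) c)) (trans (extend-B c 0) (cong (λ z → h * K2 z c) (+-identityʳ c))))
          where
          lem : ∀ x → x ≡ 1 * x + 0
          lem = solve-∀

      -- This is `(q + 1) * (q + 2) * binom h (q + 2) ≤ h * (h - 1) * binom h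
      -- q`; the right side is twice the number of `κ`-sets with exactly two vertices outside `A`,
      -- and the factor on the left is at least 4.
      2P≤K₂ : 2 * P ≤ K2 κ q
      2P≤K₂ = *-cancelˡ-≤ 2 (begin
        2 * (2 * P)                ≡⟨ trans (cong (λ z → 2 * (2 * z)) P≡) (sym (*-assoc 2 2 p₀)) ⟩
        4 * p₀                     ≤⟨ *-monoˡ-≤ p₀ 4≤ ⟩
        suc q * suc (suc q) * p₀   ≤⟨ +-cancelʳ-≤ d _ _ final ⟩
        2 * x₂                     ≡⟨ cong (λ z → 2 * K2 z q) κ≡ ⟨
        2 * K2 κ q                 ∎)
        where
        open ≤-Reasoning
        x₁ x₂ z d : ℕ
        x₁ = K2 (suc q) q
        x₂ = K2 (suc (suc q)) q
        z = suc q * p₁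
        4≤ : 4 ≤ suc q * suc (suc q)
        4≤ = *-mono-≤ {2} {suc q} {2} (s≤s (≤-trans (s≤s z≤n) 2≤q)) (s≤s (s≤s z≤n))
        z≤x₁ : z ≤ x₁
        z≤x₁ = begin
          suc q * p₁ ≤⟨ m≤m+n _ (q * p₂) ⟩
          suc q * p₁ + q * p₂ ≡⟨ extend-A q q ⟩
          h * p₂ ≡⟨ trans (lem x₁) (subst (λ y → 1 * K2 (suc y) q + 0 * K2 y q ≡ h * K2 y q) (+-identityʳ q) (extend-B q 0)) ⟨
          x₁ ∎
          where
          lem : ∀ x → x ≡ 1 * x + 0
          lem = solve-∀
        -- Naming the slack splits `h * x₁` as `h * z + h * d`, so the estimate `first` for `z`
        -- carries over to `x₁` without subtraction.
        d = x₁ ∸ z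
        z+d : z + d ≡ x₁
        z+d = m+[n∸m]≡n z≤x₁
        two-outside : 2 * x₂ + x₁ ≡ h * x₁
        two-outside = trans (cong (2 * x₂ +_) (sym (*-identityˡ x₁)))
          (subst (λ y → 2 * K2 (suc y) q + 1 * K2 y q ≡ h * K2 y q) (+-comm q 1) (extend-B q 1))
        first : suc q * suc (suc q) * p₀ + z ≤ h * z
        first = begin
          suc q * suc (suc q) * p₀ + suc q * p₁ ≡⟨ lem (suc q) (suc (suc q)) p₀ p₁ ⟩
          suc q * (suc (suc q) * p₀ + p₁)       ≤⟨ *-monoʳ-≤ (suc q) (shrink q p₀ p₁ h (extend-A (suc q) (suc q))) ⟩
          suc q * (h * p₁)                      ≡⟨ lem′ (suc q) h p₁ ⟩
          h * z                                 ∎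
          where
          lem : ∀ a b x y → a * b * x + a * y ≡ a * (b * x + y)
          lem = solve-∀
          lem′ : ∀ a b x → a * (b * x) ≡ b * (a * x)
          lem′ = solve-∀
        final : suc q * suc (suc q) * p₀ + d ≤ 2 * x₂ + d
        final = +-cancelʳ-≤ z _ _ (begin
          suc q * suc (suc q) * p₀ + d + z ≡⟨ lem (suc q * suc (suc q) * p₀) d z ⟩
          suc q * suc (suc q) * p₀ + z + d ≤⟨ +-mono-≤ first (m≤n*m d h) ⟩
          h * z + h * d                    ≡⟨ trans (sym (*-distribˡ-+ h z d)) (cong (h *_) z+d) ⟩
          h * x₁                           ≡⟨ two-outside ⟨
          2 * x₂ + x₁                      ≡⟨ cong (2 * x₂ +_) z+d ⟨
          2 * x₂ + (z + d)                 ≡⟨ lem′ (2 * x₂) z d ⟩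
          2 * x₂ + d + z                   ∎)
          where
          lem : ∀ a b c → a + b + c ≡ a + c + b
          lem = solve-∀
          lem′ : ∀ a b c → a + (b + c) ≡ a + c + b
          lem′ = solve-∀

    module _ (L : ℕ) (k<ℓ : k < suc L) where

      private
        tK>0 : 0 < t * K
        tK>0 = *-mono-≤ (≤-trans 1≤κ κ≤t) K-pos

        excess : ∀ x y z → 0 < z → x ≡ y + z → ¬ x ≤ y
        excess x y z pos eq le = <⇒≱ pos (+-cancelˡ-≤ y z 0 (≤-trans (≤-reflexive (sym eq)) (≤-trans le (≤-reflexive (sym (+-identityʳ y))))))

      -- No dense edge is exempt, so `O ≤ L * X`. After multiplying by `k` and dividing by `t * K`
      -- this reads `m ≤ L * r + 2`.
      no-decomposition-strong : ∀ D → (∀ c → k ∣ suc L * c → T (D c)) → (∀ c → same c ∧ D c ≡ false) →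
        m ≡ L * r + 3 → ¬ HasDecomposition (suc L) H
      no-decomposition-strong D multiples never m≡ dec =
        excess (t * m * K) (L * (t * r * K) + 2 * t * K) (t * K) tK>0
          (trans (cong (λ z → t * z * K) m≡) (lem L r t K)) (begin
          t * m * K                   ≤⟨ kO-≥ ⟩
          k * O + 2 * t * K           ≤⟨ +-monoˡ-≤ (2 * t * K) (*-monoʳ-≤ k (simple-bound L k<ℓ D multiples dec)) ⟩
          k * (L * X + E (λ c → same c ∧ D c)) + 2 * t * K
            ≡⟨ cong (λ z → k * (L * X + z) + 2 * t * K) none ⟩
          k * (L * X + 0) + 2 * t * K ≡⟨ lem′ k L X (2 * t * K) ⟩
          L * (k * X) + 2 * t * K     ≤⟨ +-monoˡ-≤ (2 * t * K) (*-monoʳ-≤ L X-≤) ⟩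
          L * (t * r * K) + 2 * t * K ∎)
        where
        open ≤-Reasoning
        none : E (λ c → same c ∧ D c) ≡ 0
        none = trans (sumS-cong {V} (λ e → trans (cong (λ z → ind (f e) * ind z) (never (A e))) (*-zeroʳ (ind (f e))))) (sumS-zero V)
        lem : ∀ L r t K → t * (L * r + 3) * K ≡ L * (t * r * K) + 2 * t * K + t * K
        lem = solve-∀
        lem′ : ∀ k L X y → k * (L * X + 0) + y ≡ L * (k * X) + y
        lem′ = solve-∀

      -- With up to half of the dense edges exempt, the comparison becomes
      -- `2 * m ≤ 2 * L * r + m + 4`, that is, `m ≤ 2 * L * r + 4`.
      no-decomposition-weak : ∀ D → (∀ c → k ∣ suc L * c → T (D c)) →
        2 * (k * E (λ c → same c ∧ D c)) ≤ t * m * K →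
        m ≡ 2 * L * r + 5 → ¬ HasDecomposition (suc L) H
      no-decomposition-weak D multiples half m≡ dec =
        excess (t * m * K) (2 * L * (t * r * K) + 4 * t * K) (t * K) tK>0
          (trans (cong (λ z → t * z * K) m≡) (lem L r t K)) (+-cancelʳ-≤ (t * m * K) _ _ (begin
          t * m * K + t * m * K        ≡⟨ cong (t * m * K +_) (+-identityʳ (t * m * K)) ⟨
          2 * (t * m * K)              ≤⟨ *-monoʳ-≤ 2 (≤-trans kO-≥ (+-monoˡ-≤ (2 * t * K) (*-monoʳ-≤ k (simple-bound L k<ℓ D multiples dec)))) ⟩
          2 * (k * (L * X + Z) + 2 * t * K) ≡⟨ lem′ k L X Z t K ⟩
          2 * L * (k * X) + 4 * t * K + 2 * (k * Z)
            ≤⟨ +-mono-≤ (+-monoˡ-≤ (4 * t * K) (*-monoʳ-≤ (2 * L) X-≤)) half ⟩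
          2 * L * (t * r * K) + 4 * t * K + t * m * K ∎))
        where
        open ≤-Reasoning
        Z : ℕ
        Z = E (λ c → same c ∧ D c)
        lem : ∀ L r t K → t * (2 * L * r + 5) * K ≡ 2 * L * (t * r * K) + 4 * t * K + t * K
        lem = solve-∀
        lem′ : ∀ k L X Z t K → 2 * (k * (L * X + Z) + 2 * t * K) ≡ 2 * L * (k * X) + 4 * t * K + 2 * (k * Z)
        lem′ = solve-∀

      -- A cycle lies inside A, or has at least two windows of the wrong parity, or has exactly one, which
      -- then is not of type e.  Type e is therefore worth only half of the other extra edges, and this loss
      -- outweighs the edges inside A.
      no-decomposition-refined : ∀ L′ → L ≡ suc L′ → ∀ r′ w → r ≡ 2 + r′ → r′ ≡ 2 * L + 3 + w → m ≡ L * r + 3 →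
        (∀ c → odd c ≡ p → c ≤ k → k ∣ suc L * c → c ≡ k) →
        ∀ e j → odd e ≢ p → j ≡ e ⊎ suc j ≡ e → 2 * P ≤ K2 κ j →
        (∀ b X → b ≤ k → odd b ≡ p → e ≡ suc b ⊎ b ≡ suc e → e + L * b ≢ k * X) →
        ¬ HasDecomposition (suc L) H
      no-decomposition-refined L′ L≡ r′ w r≡ r′≡ m≡ full e j e-diff j-e 2P≤ excl dec =
        excess (2 * (t * (L * r + 1) * K) + suc L * (t * r′ * (2 * P))) (2 * L * (t * r * K) + 2 * (t * m * P))
          (2 * (t * K) + 2 * (t * w * P)) (≤-trans tK>0 (≤-trans (m≤m+n _ _) (m≤m+n _ _)))
          numbers (begin
          2 * (t * (L * r + 1) * K) + suc L * (t * r′ * (2 * P))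
            ≤⟨ +-mono-≤ (*-monoʳ-≤ 2 kO≥) (*-monoʳ-≤ (suc L) (≤-trans (*-monoʳ-≤ (t * r′) 2P≤) kY≥)) ⟩
          2 * (k * O) + suc L * (k * Yₑ)      ≡⟨ lem k O (suc L) Yₑ ⟩
          k * (2 * O + suc L * Yₑ)            ≤⟨ *-monoʳ-≤ k balance ⟩
          k * (2 * L * X + 2 * Z)             ≡⟨ lem′ k L X Z ⟩
          2 * L * (k * X) + 2 * (k * Z)       ≤⟨ +-mono-≤ (*-monoʳ-≤ (2 * L) X-≤) (*-monoʳ-≤ 2 kZ≤) ⟩
          2 * L * (t * r * K) + 2 * (t * m * P) ∎)
        where
        open ≤-Reasoning
        Z Yₑ Kⱼ : ℕ
        Z = E (_≡ᵇ k)
        Yₑ = E (_≡ᵇ e)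
        Kⱼ = K2 κ j
        -- Type `e` gains `suc L * r′` per `2 * t * P`, and the edges inside `A` cost
        -- `m = L * r′ + 2 * L + 3`. The gain covers the cost once `r′ ≥ 2 * L + 3`, which explains
        -- this constant; `w` is the surplus.
        numbers : 2 * (t * (L * r + 1) * K) + suc L * (t * r′ * (2 * P)) ≡
                  2 * L * (t * r * K) + 2 * (t * m * P) + (2 * (t * K) + 2 * (t * w * P))
        numbers = trans (cong₂ (λ a b → 2 * (t * (L * a + 1) * K) + suc L * (t * b * (2 * P))) (trans r≡ (cong (2 +_) r′≡)) r′≡)
          (trans (eq t L w K P)
          (cong₂ (λ a b → 2 * L * (t * a * K) + 2 * (t * b * P) + (2 * (t * K) + 2 * (t * w * P)))
            (sym (trans r≡ (cong (2 +_) r′≡))) (sym (trans m≡ (cong (λ z → L * z + 3) (trans r≡ (cong (2 +_) r′≡)))))))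
          where
          eq : ∀ t L w K P → 2 * (t * (L * (2 + (2 * L + 3 + w)) + 1) * K) + suc L * (t * (2 * L + 3 + w) * (2 * P)) ≡
            2 * L * (t * (2 + (2 * L + 3 + w)) * K) + 2 * (t * (L * (2 + (2 * L + 3 + w)) + 3) * P) + (2 * (t * K) + 2 * (t * w * P))
          eq = solve-∀
        lem : ∀ k O l Y → 2 * (k * O) + l * (k * Y) ≡ k * (2 * O + l * Y)
        lem = solve-∀
        lem′ : ∀ k L X Z → k * (2 * L * X + 2 * Z) ≡ 2 * L * (k * X) + 2 * (k * Z)
        lem′ = solve-∀
        kO≥ : t * (L * r + 1) * K ≤ k * O
        kO≥ = +-cancelʳ-≤ (2 * t * K) _ _ (≤-trans (≤-reflexive (trans (eq t (L * r) K) (cong (λ z → t * z * K) (sym m≡)))) kO-≥)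
          where
          eq : ∀ t x K → t * (x + 1) * K + 2 * t * K ≡ t * (x + 3) * K
          eq = solve-∀
        e≢ : same e ≡ false
        e≢ with odd e xor p in eq
        ... | true  = refl
        ... | false = contradiction (xor-eq (odd e) p eq) e-diff
          where
          xor-eq : ∀ a b → a xor b ≡ false → a ≡ b
          xor-eq true  true  _ = refl
          xor-eq false false _ = refl
        width-e : width e ≡ r
        width-e rewrite e≢ = refl
        N-e : r ≤ N (_≡ᵇ e) j
        N-e = [ (λ eq → ≤-trans (subst (λ z → r ≤ width z * ind (z ≡ᵇ e)) (sym eq) at-e) (m≤n+m _ _))
              , (λ eq → ≤-trans (subst (λ z → r ≤ width z * ind (z ≡ᵇ e)) (sym eq) at-e) (m≤m+n _ _)) ]′ j-e
          where
          at-e : r ≤ width e * ind (e ≡ᵇ e)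
          at-e = ≤-reflexive (sym (trans (cong (width e *_) (cong ind (≡ᵇ-refl e))) (trans (*-identityʳ _) width-e)))
        kY≥ : t * r′ * Kⱼ ≤ k * Yₑ
        kY≥ = +-cancelʳ-≤ (2 * t * Kⱼ) _ _ (begin
          t * r′ * Kⱼ + 2 * t * Kⱼ ≡⟨ trans (eq t r′ Kⱼ) (cong (λ z → t * z * Kⱼ) (sym r≡)) ⟩
          t * r * Kⱼ               ≡⟨ W-* (t * r) (λ c → ind (c ≡ᵇ j)) ⟨
          W (λ c → t * r * ind (c ≡ᵇ j)) ≤⟨ W-mono (λ c → t * r * ind (c ≡ᵇ j)) (λ c → ind (c ≡ᵇ j) * (t * N (_≡ᵇ e) c)) (λ S _ → at-j (A S)) ⟩
          W (λ c → ind (c ≡ᵇ j) * (t * N (_≡ᵇ e) c)) ≤⟨ E-≥ (_≡ᵇ e) (_≡ᵇ j) ⟩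
          k * Yₑ + (κ + t) * Kⱼ    ≤⟨ +-monoʳ-≤ (k * Yₑ) (*-monoˡ-≤ Kⱼ (≤-trans (+-monoˡ-≤ t κ≤t) (≤-reflexive (double t)))) ⟩
          k * Yₑ + 2 * t * Kⱼ      ∎)
          where
          eq : ∀ t r K → t * r * K + 2 * t * K ≡ t * (2 + r) * K
          eq = solve-∀
          double : ∀ t → t + t ≡ 2 * t
          double = solve-∀
          at-j : ∀ c → t * r * ind (c ≡ᵇ j) ≤ ind (c ≡ᵇ j) * (t * N (_≡ᵇ e) c)
          at-j c with c ≡ᵇ j in eq
          ... | false = ≤-reflexive (*-zeroʳ (t * r))
          ... | true rewrite ≡ᵇ⇒≡ c j (Equivalence.from T-≡ eq) = begin
            t * r * 1 ≡⟨ *-identityʳ (t * r) ⟩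
            t * r     ≤⟨ *-monoʳ-≤ t N-e ⟩
            t * N (_≡ᵇ e) j ≡⟨ +-identityʳ _ ⟨
            1 * (t * N (_≡ᵇ e) j) ∎
        kZ≤ : k * Z ≤ t * m * P
        kZ≤ = ≤-trans (E-≤ (_≡ᵇ k)) (≤-trans (W-mono (λ c → t * N (_≡ᵇ k) c) (λ c → t * m * ind (c ≡ᵇ κ)) bound)
                (≤-reflexive (W-* (t * m) (λ c → ind (c ≡ᵇ κ)))))
          where
          width≤m : ∀ c → width c ≤ m
          width≤m c with same c
          ... | true  = ≤-refl
          ... | false = r≤m
          bound : ∀ S → ∣ S ∣ ≡ κ → t * N (_≡ᵇ k) (A S) ≤ t * m * ind (A S ≡ᵇ κ)
          bound S ∣S∣ = ≤-trans (*-monoʳ-≤ t (≤-trans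
              (≤-reflexive (trans (cong (λ z → width (suc (A S)) * ind (A S ≡ᵇ κ) + width (A S) * ind z) (≡ᵇ-false (<⇒≢ (s≤s (subst (A S ≤_) ∣S∣ (A≤ S))))))
                 (trans (cong (width (suc (A S)) * ind (A S ≡ᵇ κ) +_) (*-zeroʳ (width (A S)))) (+-identityʳ _))))
              (*-monoˡ-≤ (ind (A S ≡ᵇ κ)) (width≤m (suc (A S)))))) (≤-reflexive (sym (*-assoc t m _)))
        α β : ℕ → ℕ
        α c = 2 * ind (same c ∧ not (c ≡ᵇ k))
        β c = ind (diff c) * (if c ≡ᵇ e then L′ else 2 * L)
        Eα≤Eβ : Eφ α ≤ Eφ β
        Eα≤Eβ = decomposition-Eφ L k<ℓ dec α β (λ x x≤1 per →
          CycleWeights.refined k L x x≤1 per p L′ L≡ α e budget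
            (λ par le div → subst (λ z → α z ≡ 0) (sym (full _ par le div)) α-k) excl)
          where
          α-k : α k ≡ 0
          α-k rewrite ≡ᵇ-refl k with same k
          ... | true  = refl
          ... | false = refl
          budget : ∀ z → α z + 2 * ind (odd z xor p) ≤ 2
          budget z with odd z xor p
          ... | true  = ≤-refl
          ... | false = ≤-trans (≤-reflexive (+-identityʳ _)) (*-monoʳ-≤ 2 (ind≤1 (not (z ≡ᵇ k))))
        2O≤ : 2 * O ≤ Eφ α + 2 * Z
        2O≤ = begin
          2 * O ≡⟨ Eφ-* 2 (ind ∘ same) ⟨
          Eφ (λ c → 2 * ind (same c)) ≤⟨ Eφ-mono (λ c → split (same c) (c ≡ᵇ k)) ⟩
          Eφ (λ c → α c + 2 * ind (c ≡ᵇ k)) ≡⟨ Eφ-+ α (λ c → 2 * ind (c ≡ᵇ k)) ⟩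
          Eφ α + Eφ (λ c → 2 * ind (c ≡ᵇ k)) ≡⟨ cong (Eφ α +_) (Eφ-* 2 (λ c → ind (c ≡ᵇ k))) ⟩
          Eφ α + 2 * Z ∎
          where
          split : ∀ s d → 2 * ind s ≤ 2 * ind (s ∧ not d) + 2 * ind d
          split true  true  = ≤-refl
          split true  false = ≤-refl
          split false d     = z≤n
        -- Type `e` is charged `L′` instead of `2 * L`, which saves `suc L` per edge.
        Eβ+ : Eφ β + suc L * Yₑ ≤ 2 * L * X
        Eβ+ = begin
          Eφ β + suc L * Yₑ ≡⟨ cong (Eφ β +_) (Eφ-* (suc L) (λ c → ind (c ≡ᵇ e))) ⟨
          Eφ β + Eφ (λ c → suc L * ind (c ≡ᵇ e)) ≡⟨ Eφ-+ β (λ c → suc L * ind (c ≡ᵇ e)) ⟨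
          Eφ (λ c → β c + suc L * ind (c ≡ᵇ e)) ≤⟨ Eφ-mono weights ⟩
          Eφ (λ c → 2 * L * ind (diff c)) ≡⟨ Eφ-* (2 * L) (ind ∘ diff) ⟩
          2 * L * X ∎
          where
          weights : ∀ c → β c + suc L * ind (c ≡ᵇ e) ≤ 2 * L * ind (diff c)
          weights c with c ≡ᵇ e in eq
          ... | false = ≤-reflexive (trans (cong (ind (diff c) * (2 * L) +_) (*-zeroʳ L)) (trans (+-identityʳ _) (*-comm (ind (diff c)) _)))
          ... | true rewrite ≡ᵇ⇒≡ c e (Equivalence.from T-≡ eq) with odd e xor p | e≢
          ...   | true | _ = ≤-reflexive (trans (cong (λ z → 1 * L′ + suc z * 1) L≡) (trans (arith L′) (cong (λ z → 2 * z * 1) (sym L≡))))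
            where
            arith : ∀ x → 1 * x + suc (suc x) * 1 ≡ 2 * suc x * 1
            arith = solve-∀
        balance : 2 * O + suc L * Yₑ ≤ 2 * L * X + 2 * Z
        balance = begin
          2 * O + suc L * Yₑ              ≤⟨ +-monoˡ-≤ (suc L * Yₑ) 2O≤ ⟩
          Eφ α + 2 * Z + suc L * Yₑ       ≤⟨ +-monoˡ-≤ (suc L * Yₑ) (+-monoˡ-≤ (2 * Z) Eα≤Eβ) ⟩
          Eφ β + 2 * Z + suc L * Yₑ       ≡⟨ swap (Eφ β) (2 * Z) (suc L * Yₑ) ⟩
          Eφ β + suc L * Yₑ + 2 * Z       ≤⟨ +-monoˡ-≤ (2 * Z) Eβ+ ⟩
          2 * L * X + 2 * Z               ∎
          where
          swap : ∀ a b c → a + b + c ≡ a + c + b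
          swap = solve-∀

  -- Choice of the parameters

  module _ (κ L : ℕ) (2≤κ : 2 ≤ κ) (k<ℓ : suc κ < suc L) where

    private
      k ℓ : ℕ
      k = suc κ
      ℓ = suc L

      1≤κ : 1 ≤ κ
      1≤κ = ≤-trans (s≤s z≤n) 2≤κ

      1≤L : 1 ≤ L
      1≤L = ≤-trans (s≤s z≤n) (s≤s⁻¹ k<ℓ)

    -- The 2 in `r = 2 + r′` absorbs the codegree loss `κ + t ≤ 2 * t`. The parity `p` may depend on
    -- `t`, since one of the applications selects it by comparing two counts.
    construction-obstruction : ∀ m r′ .{{_ : NonZero m}} (r≤m : 2 + r′ ≤ m) a b N →
      (∀ t → (m + m) * t * (a * suc N) ≤ t * (m + r′) * (suc b * suc N) + (m + m) * t) →
      (∀ t (κ≤t : κ ≤ t) → ∃[ p ] ¬ HasDecomposition ℓ (Construction.H κ m t (2 + r′) p 1≤κ r≤m)) →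
      ∀ n₀ → ∃[ n ] n₀ ≤ n × Σ (KGraph k n) λ H → Divisible ℓ H × ¬ HasDecomposition ℓ H ×
        n * (a * suc N) ≤ minCodegree H * (suc b * suc N) + n
    construction-obstruction m r′ r≤m a b N numeric indecomposable n₀ = from (indecomposable t κ≤t)
      where
      t : ℕ
      -- The factor `k ! * (k * ℓ)` makes the binomials vanish modulo `k * ℓ`, and `suc n₀` makes
      -- the vertex set large enough.
      t = k ! * (k * ℓ) * suc n₀
      κ≤t : κ ≤ t
      κ≤t = ≤-trans (n≤1+n κ) (≤-trans (≤-trans (m≤m*n k ℓ) (m≤n*m (k * ℓ) (k !) {{>-nonZero (1≤n! k)}})) (m≤m*n _ (suc n₀)))
      lem : ∀ t m r → t * (m + r) + (t + t) ≡ t * (m + (2 + r))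
      lem = solve-∀
      from : (∃[ p ] ¬ HasDecomposition ℓ (Construction.H κ m t (2 + r′) p 1≤κ r≤m)) →
        ∃[ n ] n₀ ≤ n × Σ (KGraph k n) λ H → Divisible ℓ H × ¬ HasDecomposition ℓ H ×
          n * (a * suc N) ≤ minCodegree H * (suc b * suc N) + n
      from (p , ¬dec) = V , n₀≤V , H , divisible (factorial-vanishing (k * ℓ) k (suc n₀)) , ¬dec
        , ≤-trans (numeric t) (+-monoˡ-≤ V (*-monoˡ-≤ (suc b * suc N) (minCodegree-H (t * (m + r′))
            (≤-trans (+-monoʳ-≤ (t * (m + r′)) (+-monoˡ-≤ t κ≤t)) (≤-reflexive (lem t m r′))))))
        where
        open Construction κ m t (2 + r′) p 1≤κ r≤m using (V; H; divisible; minCodegree-H)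
        n₀≤V : n₀ ≤ V
        n₀≤V = ≤-trans (n≤1+n n₀) (≤-trans (m≤n*m (suc n₀) (k ! * (k * ℓ)) {{m*n≢0 (k !) (k * ℓ) {{>-nonZero (1≤n! k)}}}})
                 (m≤n*m t (m + m) {{>-nonZero (≤-trans (>-nonZero⁻¹ m) (m≤m+n m m))}}))

    private
      -- The claim reduces to `(2 * L + 3) * suc N ≤ m`. Since `2 * L + 3 ≤ 5 * L`, the summand
      -- `5 * suc N` of `r′` suffices; the remaining part `2 * L + 3` is what the refined count asks
      -- for.
      strong-numeric : ∀ L′ → L ≡ suc L′ → ∀ N t → let r′ = 2 * L + 3 + 5 * suc N ; m = 3 + L * (2 + r′) in
        (m + m) * t * (suc L * suc N) ≤ t * (m + r′) * (2 * suc L′ * suc N) + (m + m) * t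
      strong-numeric L′ refl N t = ≤-trans (m≤m+n _ (2 * t * (5 * suc L′ + 2 * suc L′ * suc L′ + 3 + 3 * L′ * suc N)))
        (≤-reflexive (eq L′ N t))
        where
        eq : ∀ L′ N t → let L = suc L′ ; r′ = 2 * L + 3 + 5 * suc N ; m = 3 + L * (2 + r′) in
          (m + m) * t * (suc L * suc N) + 2 * t * (5 * suc L′ + 2 * suc L′ * suc L′ + 3 + 3 * L′ * suc N) ≡
          t * (m + r′) * (2 * suc L′ * suc N) + (m + m) * t
        eq = solve-∀

      weak-numeric : ∀ L′ → L ≡ suc L′ → ∀ N t → let r′ = 2 * L + 3 + 5 * suc N ; m = 5 + 2 * L * (2 + r′) in
        (m + m) * t * (suc (2 * L) * suc N) ≤ t * (m + r′) * (4 * suc L′ * suc N) + (m + m) * t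
      weak-numeric L′ refl N t = ≤-trans (m≤m+n _ (2 * t * (10 * suc L′ + 4 * suc L′ * suc L′ + 5 + suc L′ * suc N + 5 * L′ * suc N)))
        (≤-reflexive (eq L′ N t))
        where
        eq : ∀ L′ N t → let L = suc L′ ; r′ = 2 * L + 3 + 5 * suc N ; m = 5 + 2 * L * (2 + r′) in
          (m + m) * t * (suc (2 * L) * suc N) + 2 * t * (10 * suc L′ + 4 * suc L′ * suc L′ + 5 + suc L′ * suc N + 5 * L′ * suc N) ≡
          t * (m + r′) * (4 * suc L′ * suc N) + (m + m) * t
        eq = solve-∀

      r≤3+Lr : ∀ r → r ≤ 3 + L * r
      r≤3+Lr r = ≤-trans (m≤n*m r L {{>-nonZero 1≤L}}) (m≤n+m _ 3)

      r≤5+2Lr : ∀ r → r ≤ 5 + 2 * L * r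
      r≤5+2Lr r = ≤-trans (m≤n*m r (2 * L) {{m*n≢0 2 L {{_}} {{>-nonZero 1≤L}}}}) (m≤n+m _ 5)

      k′ : ℕ
      k′ = quotient (gcd[m,n]∣n ℓ k)

      k′∣ : ∀ c → k ∣ ℓ * c → k′ ∣ c
      k′∣ c = ∣-gcd-cancel ℓ k c

      multiple : ℕ → Bool
      multiple c = does (k′ ∣? c)

      multiple-T : ∀ c → k ∣ ℓ * c → T (multiple c)
      multiple-T c div = Equivalence.from T-≡ (dec-true (k′ ∣? c) (k′∣ c div))

      multiple⇒∣ : ∀ c → multiple c ≡ true → k′ ∣ c
      multiple⇒∣ c eq with k′ ∣? c
      ... | yes d = d

    -- Multiples of the even number `k′` are even, while `p = true` makes the odd types dense, so no
    -- dense edge is exempt. The last index is written so that its successor computes to `2 * L`.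
    even-obstruction : ∀ L′ → L ≡ suc L′ → 2 ∣ k′ → Obstruction k ℓ (suc L) (L′ + 1 * suc L′)
    even-obstruction L′ L≡ 2∣k′ N =
      construction-obstruction (3 + L * (2 + r′)) r′ (r≤3+Lr (2 + r′)) (suc L) (L′ + 1 * suc L′) N (strong-numeric L′ L≡ N)
        λ t κ≤t → true , Obstruct.no-decomposition-strong κ (3 + L * (2 + r′)) t (2 + r′) true 1≤κ (r≤3+Lr (2 + r′)) κ≤t
                           L k<ℓ multiple multiple-T never (+-comm 3 (L * (2 + r′)))
      where
      r′ = 2 * L + 3 + 5 * suc N
      never : ∀ c → not (odd c xor true) ∧ multiple c ≡ false
      never c with odd c in eq₁ | multiple c in eq₂
      ... | true  | true  = case trans (sym eq₁) (2∣⇒even c (∣-trans 2∣k′ (multiple⇒∣ c eq₂))) of λ ()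
      ... | true  | false = refl
      ... | false | _     = refl

    -- As `k′ ≠ 1`, no two consecutive types are multiples of `k′`, which bounds the `k`-sets of
    -- such types by about half of all. The parity class containing fewer of them is made dense, so
    -- at most about half of its edges are exempt.
    general-obstruction : ∀ L′ → L ≡ suc L′ → ¬ (k ∣ ℓ) → Obstruction k ℓ (suc (2 * L)) (L′ + 3 * suc L′)
    general-obstruction L′ L≡ k∤ℓ N =
      construction-obstruction m r′ (r≤5+2Lr (2 + r′)) (suc (2 * L)) (L′ + 3 * suc L′) N (weak-numeric L′ L≡ N) choose
      where
      r′ = 2 * L + 3 + 5 * suc N
      m = 5 + 2 * L * (2 + r′)
      m≡ : m ≡ 2 * L * (2 + r′) + 5
      m≡ = +-comm 5 (2 * L * (2 + r′))
      k′≢1 : k′ ≢ 1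
      k′≢1 eq = k∤ℓ (subst (_∣ ℓ) (sym (trans (_∣_.equality (gcd[m,n]∣n ℓ k)) (trans (cong (_* gcd ℓ k) eq) (*-identityˡ _)))) (gcd[m,n]∣m ℓ k))
      once : ∀ c → ind (multiple (suc c)) + ind (multiple c) ≤ 1
      once c with multiple (suc c) in eq₁ | multiple c in eq₂
      ... | true  | true  = contradiction (∣1⇒≡1 (∣m+n∣m⇒∣n (subst (k′ ∣_) (+-comm 1 c) (multiple⇒∣ (suc c) eq₁)) (multiple⇒∣ c eq₂))) k′≢1
      ... | true  | false = ≤-refl
      ... | false | true  = ≤-refl
      ... | false | false = z≤n
      choose : ∀ t (κ≤t : κ ≤ t) → ∃[ p ] ¬ HasDecomposition ℓ (Construction.H κ m t (2 + r′) p 1≤κ (r≤5+2Lr (2 + r′)))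
      choose t κ≤t = [ (λ le → true , T-mod.no-decomposition-weak L k<ℓ multiple multiple-T (smaller le (T-mod.E≤U (λ c → not (odd c xor true) ∧ multiple c))) m≡)
                     , (λ ge → false , F-mod.no-decomposition-weak L k<ℓ multiple multiple-T
                           (smaller′ ge (F-mod.E≤U (λ c → not (odd c xor false) ∧ multiple c))) m≡) ]′ (≤-total u₁ u₂)
        where
        module T-mod = Obstruct κ m t (2 + r′) true 1≤κ (r≤5+2Lr (2 + r′)) κ≤t
        module F-mod = Obstruct κ m t (2 + r′) false 1≤κ (r≤5+2Lr (2 + r′)) κ≤t
        u₁ = T-mod.U (λ c → not (odd c xor true) ∧ multiple c)
        u₂ = T-mod.U (λ c → not (odd c xor false) ∧ multiple c)
        u₁+u₂ : u₁ + u₂ ≡ T-mod.U multiple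
        u₁+u₂ = trans (sym (sumS-+ {T-mod.V} _ _)) (sumS-cong {T-mod.V} λ e → trans (sym (*-distribˡ-+ (ind (∣ e ∣ ≡ᵇ k)) _ _))
                  (cong (ind (∣ e ∣ ≡ᵇ k) *_) (split (odd (T-mod.A e)) (multiple (T-mod.A e)))))
          where
          split : ∀ o d → ind (not (o xor true) ∧ d) + ind (not (o xor false) ∧ d) ≡ ind d
          split true  d = +-identityʳ (ind d)
          split false d = refl
        total-≤ : k * (u₁ + u₂) ≤ t * m * T-mod.K
        total-≤ = ≤-trans (≤-reflexive (cong (k *_) u₁+u₂)) (T-mod.U-≤ multiple once)
        smaller : u₁ ≤ u₂ → ∀ {x} → x ≤ u₁ → 2 * (k * x) ≤ t * m * T-mod.K
        smaller le {x} x≤ = ≤-trans (≤-reflexive (lem k x)) (≤-trans (*-monoʳ-≤ k (+-mono-≤ x≤ (≤-trans x≤ le))) total-≤)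
          where
          lem : ∀ k x → 2 * (k * x) ≡ k * (x + x)
          lem = solve-∀
        smaller′ : u₂ ≤ u₁ → ∀ {x} → x ≤ u₂ → 2 * (k * x) ≤ t * m * T-mod.K
        smaller′ le {x} x≤ = ≤-trans (≤-reflexive (lem k x)) (≤-trans (*-monoʳ-≤ k (+-mono-≤ (≤-trans x≤ le) x≤)) total-≤)
          where
          lem : ∀ k x → 2 * (k * x) ≡ k * (x + x)
          lem = solve-∀

    -- A single window of type κ together with a single window of type κ ∸ 2 cannot both be completed to
    -- cycles: the former needs k ∣ ℓ (q + 1) + 1, the latter excludes it.
    coprime-obstruction : ∀ L′ → L ≡ suc L′ → ∀ q → κ ≡ suc (suc q) → 2 ≤ q → gcd ℓ k ≡ 1 → odd k ≡ true →
      Obstruction k ℓ (suc L) (L′ + 1 * suc L′)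
    coprime-obstruction L′ L≡ q refl 2≤q gcd≡1 odd-k N =
      construction-obstruction m r′ (r≤3+Lr (2 + r′)) (suc L) (L′ + 1 * suc L′) N (strong-numeric L′ L≡ N) λ t κ≤t → true , go t κ≤t
      where
      r′ = 2 * L + 3 + 5 * suc N
      m = 3 + L * (2 + r′)
      k∣c : ∀ c → k ∣ ℓ * c → k ∣ c
      k∣c c div = subst (_∣ c) (sym (trans (_∣_.equality (gcd[m,n]∣n ℓ k)) (trans (cong (k′ *_) gcd≡1) (*-identityʳ k′)))) (k′∣ c div)
      full : ∀ c → odd c ≡ true → c ≤ k → k ∣ ℓ * c → c ≡ k
      full (suc c) _ c≤k div = ≤-antisym c≤k (∣⇒≤ (k∣c (suc c) div))
      even-q : odd q ≡ false
      even-q = not-true (odd q) odd-k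
        where
        not-true : ∀ b → not (not (not b)) ≡ true → b ≡ false
        not-true false _ = refl
      odd-e : odd q ≢ true
      odd-e eq = case trans (sym even-q) eq of λ ()
      odd-e′ : odd (suc (suc q)) ≢ true
      odd-e′ eq = odd-e (trans (sym (not-involutive (odd q))) eq)
      k≢ : ∀ {d} → d < k → 0 < d → ¬ k ∣ d
      k≢ {suc d} d<k _ k∣d = <⇒≱ d<k (∣⇒≤ k∣d)
      go : ∀ t (κ≤t : κ ≤ t) → ¬ HasDecomposition ℓ (Construction.H κ m t (2 + r′) true 1≤κ (r≤3+Lr (2 + r′)))
      go t κ≤t with k ∣? suc (ℓ * suc q)
      ... | no ∤ = O.no-decomposition-refined L k<ℓ L′ L≡ r′ (5 * suc N) refl refl (+-comm 3 (L * (2 + r′))) full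
                     (suc (suc q)) (suc q) odd-e′ (inj₂ refl) (O.2P≤K₁ q refl 2≤q) excl
        where
        module O = Obstruct κ m t (2 + r′) true 1≤κ (r≤3+Lr (2 + r′)) κ≤t
        excl : ∀ b X → b ≤ k → odd b ≡ true → suc (suc q) ≡ suc b ⊎ b ≡ suc (suc (suc q)) → suc (suc q) + L * b ≢ k * X
        excl b X _ _ (inj₁ refl) eq = ∤ (divides X (trans (trans (lem q L) eq) (*-comm k X)))
          where
          lem : ∀ q L → suc (suc L * suc q) ≡ suc (suc q) + L * suc q
          lem = solve-∀
        -- Here `b = k`, so `k` would divide `e = κ`.
        excl b X _ _ (inj₂ refl) eq = k≢ ≤-refl (s≤s z≤n) (∣m+n∣n⇒∣m (divides X (trans eq (*-comm k X))) (n∣m*n L))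
          where
          ∣m+n∣n⇒∣m : ∀ {d m n} → d ∣ m + n → d ∣ n → d ∣ m
          ∣m+n∣n⇒∣m {d} {m} {n} p q = ∣m+n∣m⇒∣n (subst (d ∣_) (+-comm m n) p) q
      ... | yes div = O.no-decomposition-refined L k<ℓ L′ L≡ r′ (5 * suc N) refl refl (+-comm 3 (L * (2 + r′))) full
                     q q odd-e (inj₁ refl) (O.2P≤K₂ q refl 2≤q) excl
        where
        module O = Obstruct κ m t (2 + r′) true 1≤κ (r≤3+Lr (2 + r′)) κ≤t
        excl : ∀ b X → b ≤ k → odd b ≡ true → q ≡ suc b ⊎ b ≡ suc q → q + L * b ≢ k * X
        -- `2 * (ℓ * (q + 1) + 1)` is the sum of `ℓ * (q - 1) + 1`, `ℓ * k` and 1, so `k` would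
        -- divide 1.
        excl b X _ _ (inj₁ refl) eq = k≢ (s≤s (s≤s z≤n)) (s≤s z≤n)
          (∣m+n∣m⇒∣n {n = 1} (∣m+n∣m⇒∣n (subst (k ∣_) (lem b L) (∣n⇒∣m*n 2 div)) (divides X (trans eq (*-comm k X)))) (n∣m*n ℓ))
          where
          lem : ∀ b L → 2 * suc (suc L * suc (suc b)) ≡ (suc b + L * b) + (suc L * suc (suc (suc (suc b))) + 1)
          lem = solve-∀
        -- Now the total is `ℓ * (q + 1) - 1`, so `k` would divide 2.
        excl b X _ _ (inj₂ refl) eq = k≢ (s≤s (s≤s (s≤s z≤n))) (s≤s z≤n)
          (∣m+n∣m⇒∣n {n = 2} (subst (k ∣_) (lem q L) div) (divides X (trans eq (*-comm k X))))
          where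
          lem : ∀ q L → suc (suc L * suc q) ≡ (q + L * suc q) + 2
          lem = solve-∀

  -- Subsets of a masked set

  within : (Fin n → Bool) → Subset n → Bool
  within W []          = true
  within W (true ∷ a)  = W zero ∧ within (W ∘ suc) a
  within W (false ∷ a) = within (W ∘ suc) a

  masked : (Fin n → Bool) → ℕ → Subset n → Bool
  masked W c a = within W a ∧ (∣ a ∣ ≡ᵇ c)

  module _ {n : ℕ} (W : Fin n → Bool) where

    masked-count : ℕ → ℕ
    masked-count c = sumS n (ind ∘ masked W c)

    masked-degree : ℕ → Fin n → ℕ
    masked-degree c i = sumS n (λ a → ind (masked W c a) * ind (lookup a i))

  private
    ind-∧-assoc : ∀ a b c → ind ((a ∧ b) ∧ c) ≡ ind a * ind (b ∧ c)
    ind-∧-assoc true  b c = sym (+-identityʳ _)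
    ind-∧-assoc false b c = refl

    ind-∧-false : ∀ a → ind (a ∧ false) ≡ 0
    ind-∧-false true  = refl
    ind-∧-false false = refl

  masked-count-suc : ∀ {n} (W : Fin (suc n) → Bool) c →
    masked-count W (suc c) ≡ ind (W zero) * masked-count (W ∘ suc) c + masked-count (W ∘ suc) (suc c)
  masked-count-suc {n} W c = cong (_+ masked-count (W ∘ suc) (suc c))
    (trans (sumS-cong {n} (λ a → ind-∧-assoc (W zero) (within (W ∘ suc) a) _)) (sumS-* {n} (ind (W zero)) _))

  masked-count-0 : ∀ {n} (W : Fin n → Bool) → masked-count W 0 ≡ 1
  masked-count-0 {zero}  W = refl
  masked-count-0 {suc n} W = trans (cong (_+ masked-count (W ∘ suc) 0)
    (trans (sumS-cong {n} (λ a → ind-∧-false (within W (true ∷ a)))) (sumS-zero n))) (masked-count-0 (W ∘ suc))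

  masked-count-1 : ∀ {n} (W : Fin n → Bool) → masked-count W 1 ≡ sumF n (ind ∘ W)
  masked-count-1 {zero}  W = refl
  masked-count-1 {suc n} W = trans (masked-count-suc W 0) (cong₂ _+_
    (trans (cong (ind (W zero) *_) (masked-count-0 (W ∘ suc))) (*-identityʳ _)) (masked-count-1 (W ∘ suc)))

  ind-square : ∀ b → ind b * ind b ≡ ind b
  ind-square true  = refl
  ind-square false = refl

  masked-count-2 : ∀ {n} (W : Fin n → Bool) → let u = sumF n (ind ∘ W) in 2 * masked-count W 2 + u ≡ u * u
  masked-count-2 {zero}  W = refl
  masked-count-2 {suc n} W = begin
    2 * masked-count W 2 + (w + u)
      ≡⟨ cong (λ z → 2 * z + (w + u)) (trans (masked-count-suc W 1) (cong (λ z → w * z + B) (masked-count-1 (W ∘ suc)))) ⟩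
    2 * (w * u + B) + (w + u)        ≡⟨ lem w u B ⟩
    w + 2 * (w * u) + (2 * B + u)    ≡⟨ cong₂ (λ a b → a + 2 * (w * u) + b) (sym (ind-square (W zero))) (masked-count-2 (W ∘ suc)) ⟩
    w * w + 2 * (w * u) + u * u      ≡⟨ lem′ w u ⟩
    (w + u) * (w + u)                ∎
    where
    open ≡-Reasoning
    w = ind (W zero)
    u = sumF n (ind ∘ W ∘ suc)
    B = masked-count (W ∘ suc) 2
    lem : ∀ w u B → 2 * (w * u + B) + (w + u) ≡ w + 2 * (w * u) + (2 * B + u)
    lem = solve-∀
    lem′ : ∀ w u → w * w + 2 * (w * u) + u * u ≡ (w + u) * (w + u)
    lem′ = solve-∀

  masked-degree-zero : ∀ {n} (W : Fin (suc n) → Bool) c → masked-degree W (suc c) zero ≡ ind (W zero) * masked-count (W ∘ suc) c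
  masked-degree-zero {n} W c = trans (cong₂ _+_
      (trans (sumS-cong {n} (λ a → trans (*-identityʳ _) (ind-∧-assoc (W zero) (within (W ∘ suc) a) _))) (sumS-* {n} (ind (W zero)) _))
      (trans (sumS-cong {n} (λ a → *-zeroʳ (ind (masked W (suc c) (false ∷ a))))) (sumS-zero n)))
    (+-identityʳ _)

  masked-degree-suc : ∀ {n} (W : Fin (suc n) → Bool) c i →
    masked-degree W (suc c) (suc i) ≡ ind (W zero) * masked-degree (W ∘ suc) c i + masked-degree (W ∘ suc) (suc c) i
  masked-degree-suc {n} W c i = cong (_+ masked-degree (W ∘ suc) (suc c) i)
    (trans (sumS-cong {n} (λ a → trans (cong (_* ind (lookup a i)) (ind-∧-assoc (W zero) (within (W ∘ suc) a) _))
      (*-assoc (ind (W zero)) _ _))) (sumS-* {n} (ind (W zero)) _))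

  masked-degree-0 : ∀ {n} (W : Fin n → Bool) i → masked-degree W 0 i ≡ 0
  masked-degree-0 {n} W i = trans (sumS-cong {n} zero-term) (sumS-zero n)
    where
    zero-term : ∀ a → ind (masked W 0 a) * ind (lookup a i) ≡ 0
    zero-term a with lookup a i in eq
    ... | false = *-zeroʳ (ind (masked W 0 a))
    ... | true  = trans (cong (λ z → ind (within W a ∧ z) * 1) (≡ᵇ-false (>⇒≢ (lookup⇒∣∣>0 a i eq))))
                        (cong (_* 1) (ind-∧-false (within W a)))

  masked-degree-1 : ∀ {n} (W : Fin n → Bool) i → masked-degree W 1 i ≡ ind (W i)
  masked-degree-1 W zero    = trans (masked-degree-zero W 0) (trans (cong (ind (W zero) *_) (masked-count-0 (W ∘ suc))) (*-identityʳ _))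
  masked-degree-1 W (suc i) = trans (masked-degree-suc W 0 i) (trans
    (cong (λ z → ind (W zero) * z + masked-degree (W ∘ suc) 1 i) (masked-degree-0 (W ∘ suc) i))
    (trans (cong (_+ masked-degree (W ∘ suc) 1 i) (*-zeroʳ (ind (W zero)))) (masked-degree-1 (W ∘ suc) i)))

  masked-degree-2 : ∀ {n} (W : Fin n → Bool) i → masked-degree W 2 i + ind (W i) ≡ ind (W i) * sumF n (ind ∘ W)
  masked-degree-2 {suc n} W zero = begin
    masked-degree W 2 zero + w ≡⟨ cong (_+ w) (trans (masked-degree-zero W 1) (cong (w *_) (masked-count-1 (W ∘ suc)))) ⟩
    w * u + w                ≡⟨ cong (w * u +_) (ind-square (W zero)) ⟨
    w * u + w * w            ≡⟨ lem w u ⟩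
    w * (w + u)              ∎
    where
    open ≡-Reasoning
    w = ind (W zero)
    u = sumF n (ind ∘ W ∘ suc)
    lem : ∀ w u → w * u + w * w ≡ w * (w + u)
    lem = solve-∀
  masked-degree-2 {suc n} W (suc i) = begin
    masked-degree W 2 (suc i) + x
      ≡⟨ cong (_+ x) (trans (masked-degree-suc W 1 i) (cong (λ z → w * z + masked-degree (W ∘ suc) 2 i) (masked-degree-1 (W ∘ suc) i))) ⟩
    w * x + masked-degree (W ∘ suc) 2 i + x   ≡⟨ +-assoc (w * x) _ x ⟩
    w * x + (masked-degree (W ∘ suc) 2 i + x) ≡⟨ cong (w * x +_) (masked-degree-2 (W ∘ suc) i) ⟩
    w * x + x * u                           ≡⟨ lem w x u ⟩
    x * (w + u)                             ∎
    where
    open ≡-Reasoning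
    w = ind (W zero)
    x = ind (W (suc i))
    u = sumF n (ind ∘ W ∘ suc)
    lem : ∀ w x u → w * x + x * u ≡ x * (w + u)
    lem = solve-∀

  module _ (s n : ℕ) (φ : Subset s → ℕ) (χ : Subset n → ℕ) where

    private
      inner : ∀ x (g : Subset n → ℕ) → sumS n (λ b → x * g b) ≡ x * sumS n g
      inner x g = sumS-* {n} x g

      factor : ∀ (g : Subset s → ℕ) y → sumS s (λ a → g a * y) ≡ sumS s g * y
      factor g y = trans (sumS-cong {s} (λ a → *-comm (g a) y)) (trans (sumS-* {s} y g) (*-comm y _))

    sum-product : sumS (s + n) (λ e → φ (take s e) * χ (drop s e)) ≡ sumS s φ * sumS n χ
    sum-product = trans (sumS-++ s n _) (trans (sumS-cong {s} (λ a → trans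
        (sumS-cong {n} (λ b → cong₂ (λ x y → φ x * χ y) (take-++ a b) (drop-++ a b))) (inner (φ a) χ)))
      (factor φ (sumS n χ)))

    sum-product-left : ∀ i → sumS (s + n) (λ e → φ (take s e) * χ (drop s e) * ind (lookup e (i ↑ˡ n))) ≡
                             sumS s (λ a → φ a * ind (lookup a i)) * sumS n χ
    sum-product-left i = trans (sumS-++ s n _) (trans (sumS-cong {s} (λ a → trans
        (sumS-cong {n} (λ b → trans (cong₂ _*_ (cong₂ (λ x y → φ x * χ y) (take-++ a b) (drop-++ a b)) (cong ind (lookup-++ˡ a b i)))
                                    (lem (φ a) (χ b) (ind (lookup a i)))))
        (inner (φ a * ind (lookup a i)) χ)))
      (factor _ (sumS n χ)))
      where
      lem : ∀ x y z → x * y * z ≡ x * z * y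
      lem = solve-∀

    sum-product-right : ∀ j → sumS (s + n) (λ e → φ (take s e) * χ (drop s e) * ind (lookup e (s ↑ʳ j))) ≡
                              sumS s φ * sumS n (λ b → χ b * ind (lookup b j))
    sum-product-right j = trans (sumS-++ s n _) (trans (sumS-cong {s} (λ a → trans
        (sumS-cong {n} (λ b → trans (cong₂ _*_ (cong₂ (λ x y → φ x * χ y) (take-++ a b) (drop-++ a b)) (cong ind (lookup-++ʳ a b j)))
                                    (*-assoc (φ a) (χ b) (ind (lookup b j)))))
        (inner (φ a) (λ b → χ b * ind (lookup b j)))))
      (factor φ _))

  -- The three-class construction for triples

  -- Counts of the three colours are packed in base 4.
  code : Fin 3 → ℕ
  code zero             = 1
  code (suc zero)       = 4
  code (suc (suc zero)) = 16

  -- The code sums of the triples meeting exactly two classes: 6 and 9 for the classes 0 and 1, 18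
  -- and 33 for 0 and 2, 24 and 36 for 1 and 2.
  two-coloured : ℕ → Bool
  two-coloured z = (z ≡ᵇ 6) ∨ ((z ≡ᵇ 9) ∨ ((z ≡ᵇ 18) ∨ ((z ≡ᵇ 33) ∨ ((z ≡ᵇ 24) ∨ (z ≡ᵇ 36)))))

  -- The invariant of a two-coloured triple: 1 on {0,0,1}, 2 on {0,1,1}, and 0 otherwise.
  charge : ℕ → ℕ
  charge 6 = 1
  charge 9 = 2
  charge _ = 0

  -- Chosen so that the charge of consecutive colours `x`, `y`, `z` is
  -- `potential y z - potential x y` modulo 3; below, 2 stands for `-1`.
  potential : Fin 3 → Fin 3 → ℕ
  potential zero       (suc zero) = 1
  potential (suc zero) zero       = 2
  potential _          _          = 0

  charge-potential : ∀ x y z → T (two-coloured (code x + (code y + (code z + 0)))) →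
    3 ∣ charge (code x + (code y + (code z + 0))) + potential x y + 2 * potential y z
  charge-potential = from-yes (all? λ x → all? λ y → all? λ z →
    T? (two-coloured (code x + (code y + (code z + 0)))) →-dec
    (3 ∣? charge (code x + (code y + (code z + 0))) + potential x y + 2 * potential y z))

  -- Along a cycle the charges telescope modulo 3.
  cyclic-charge : ∀ ℓ (z : ℕ → Fin 3) → (∀ i → z (i + ℓ) ≡ z i) →
    (∀ i → i < ℓ → T (two-coloured (sumN 3 (λ j → code (z (i + j)))))) →
    3 ∣ sumN ℓ (λ i → charge (sumN 3 (λ j → code (z (i + j)))))
  cyclic-charge ℓ z per two = ∣m+n∣m⇒∣n (subst (3 ∣_) total-eq (go ℓ ≤-refl)) (m∣m*n (sumN ℓ g))
    where
    Ψ g : ℕ → ℕ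
    Ψ i = charge (sumN 3 (λ j → code (z (i + j))))
    g i = potential (z (i + 0)) (z (i + 1))
    term : ∀ i → i < ℓ → 3 ∣ Ψ i + g i + 2 * g (1 + i)
    term i lt = subst (λ w → 3 ∣ Ψ i + g i + 2 * w)
      (cong₂ (λ a b → potential (z a) (z b)) (trans (+-suc i 0) refl) (+-suc i 1))
      (charge-potential (z (i + 0)) (z (i + 1)) (z (i + 2)) (two i lt))
    go : ∀ m → m ≤ ℓ → 3 ∣ sumN m (λ i → Ψ i + g i + 2 * g (1 + i))
    go zero    _ = 3 ∣0
    go (suc m) le = subst (3 ∣_) (sym (sumN-last m _)) (∣m∣n⇒∣m+n (go m (<⇒≤ le)) (term m le))
    g-per : ∀ i → g (i + ℓ) ≡ g i
    g-per i = cong₂ potential (trans (cong z (lem i ℓ 0)) (per (i + 0))) (trans (cong z (lem i ℓ 1)) (per (i + 1)))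
      where
      lem : ∀ i l j → i + l + j ≡ i + j + l
      lem = solve-∀
    total-eq : sumN ℓ (λ i → Ψ i + g i + 2 * g (1 + i)) ≡ 3 * sumN ℓ g + sumN ℓ Ψ
    total-eq = begin
      sumN ℓ (λ i → Ψ i + g i + 2 * g (1 + i)) ≡⟨ sumN-+ ℓ (λ i → Ψ i + g i) (λ i → 2 * g (1 + i)) ⟩
      sumN ℓ (λ i → Ψ i + g i) + sumN ℓ (λ i → 2 * g (1 + i))
        ≡⟨ cong₂ _+_ (sumN-+ ℓ Ψ g) (trans (sumN-* ℓ 2 (λ i → g (1 + i))) (cong (2 *_) (sumN-shift ℓ g g-per 1))) ⟩
      sumN ℓ Ψ + sumN ℓ g + 2 * sumN ℓ g ≡⟨ lem (sumN ℓ Ψ) (sumN ℓ g) ⟩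
      3 * sumN ℓ g + sumN ℓ Ψ ∎
      where
      open ≡-Reasoning
      lem : ∀ a b → a + b + 2 * b ≡ 3 * b + a
      lem = solve-∀

  -- Three classes of size s, each with a marked set of u vertices.
  module ThreeClasses (s u : ℕ) (u≤s : u ≤ s) where

    V : ℕ
    V = 3 * s

    W : Fin s → Bool
    W i = toℕ i <ᵇ u

    ∣W∣ : sumF s (ind ∘ W) ≡ u
    ∣W∣ = trans (sumF-toℕ s (λ i → ind (i <ᵇ u))) (sumN-<ᵇ s u u≤s)

    Z : Subset V → ℕ
    Z e = sumIn e (code ∘ color 3 s)

    -- The trailing `true` stands for the empty remainder in `3 * s = s + (s + (s + 0))`, so that
    -- counts factor class by class.
    tri : ℕ → ℕ → ℕ → Subset V → Bool
    tri x y z e = masked W x (take s e) ∧ (masked W y (take s (drop s e)) ∧ (masked W z (take s (drop s (drop s e))) ∧ true))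

    -- The gadget consists of marked triples of types {0,0,1}, {1,1,2} and {2,2,0}. By this cyclic
    -- choice a marked vertex lies in `(u - 1) * u = 2 * β₂` triples as one of a pair and in `β₂` as
    -- the single vertex, `3 * β₂` in all, while only the first type has a charge.
    gadget full f : Subset V → Bool
    gadget e = tri 2 1 0 e ∨ (tri 0 2 1 e ∨ tri 1 0 2 e)
    full e = (∣ e ∣ ≡ᵇ 3) ∧ two-coloured (Z e)
    f e = full e ∧ not (gadget e)

    masked-size : ∀ c (a : Subset s) → T (masked W c a) → ∣ a ∣ ≡ c
    masked-size c a m = ≡ᵇ⇒≡ _ c (proj₂ (Equivalence.to (T-∧ {within W a}) m))

    tri⇒cnt : ∀ x y z e → T (tri x y z e) → cnt 3 s e ≡ x ∷ y ∷ z ∷ []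
    tri⇒cnt x y z e t₀ =
      let (m₀ , t₁) = Equivalence.to (T-∧ {masked W x (take s e)}) t₀
          (m₁ , t₂) = Equivalence.to (T-∧ {masked W y (take s (drop s e))}) t₁
          (m₂ , _)  = Equivalence.to (T-∧ {masked W z (take s (drop s (drop s e)))}) t₂
      in cong₂ _∷_ (masked-size x (take s e) m₀) (cong₂ _∷_ (masked-size y (take s (drop s e)) m₁)
           (cong (_∷ []) (masked-size z (take s (drop s (drop s e))) m₂)))

    tri⇒Z : ∀ x y z e → T (tri x y z e) → Z e ≡ dot code (x ∷ y ∷ z ∷ [])
    tri⇒Z x y z e t = trans (sumIn-color 3 s code e) (cong (dot code) (tri⇒cnt x y z e t))

    tri⇒size : ∀ x y z e → T (tri x y z e) → ∣ e ∣ ≡ total (x ∷ y ∷ z ∷ [])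
    tri⇒size x y z e t = trans (sym (total-cnt 3 s e)) (cong total (tri⇒cnt x y z e t))

    private
      true⇒T : ∀ {b} → b ≡ true → T b
      true⇒T eq = Equivalence.from T-≡ eq

    gadget⇒full : ∀ e → T (gadget e) → T (full e)
    gadget⇒full e g with tri 2 1 0 e in eq₁ | tri 0 2 1 e in eq₂ | tri 1 0 2 e in eq₃
    ... | true  | _     | _    rewrite tri⇒Z 2 1 0 e (true⇒T eq₁) | tri⇒size 2 1 0 e (true⇒T eq₁) = g
    ... | false | true  | _    rewrite tri⇒Z 0 2 1 e (true⇒T eq₂) | tri⇒size 0 2 1 e (true⇒T eq₂) = g
    ... | false | false | true rewrite tri⇒Z 1 0 2 e (true⇒T eq₃) | tri⇒size 1 0 2 e (true⇒T eq₃) = g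

    ind-gadget : ∀ e → ind (gadget e) ≡ ind (tri 2 1 0 e) + (ind (tri 0 2 1 e) + ind (tri 1 0 2 e))
    ind-gadget e with tri 2 1 0 e in eq₁ | tri 0 2 1 e in eq₂ | tri 1 0 2 e in eq₃
    ... | true  | true  | _     = case trans (sym (tri⇒Z 2 1 0 e (true⇒T eq₁))) (tri⇒Z 0 2 1 e (true⇒T eq₂)) of λ ()
    ... | true  | false | true  = case trans (sym (tri⇒Z 2 1 0 e (true⇒T eq₁))) (tri⇒Z 1 0 2 e (true⇒T eq₃)) of λ ()
    ... | false | true  | true  = case trans (sym (tri⇒Z 0 2 1 e (true⇒T eq₂))) (tri⇒Z 1 0 2 e (true⇒T eq₃)) of λ ()
    ... | true  | false | false = refl
    ... | false | true  | false = refl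
    ... | false | false | true  = refl
    ... | false | false | false = refl

    gadget-charge : ∀ e → ind (gadget e) * charge (Z e) ≡ ind (tri 2 1 0 e)
    gadget-charge e with tri 2 1 0 e in eq₁ | tri 0 2 1 e in eq₂ | tri 1 0 2 e in eq₃
    ... | true  | _     | _     rewrite tri⇒Z 2 1 0 e (true⇒T eq₁) = refl
    ... | false | true  | _     rewrite tri⇒Z 0 2 1 e (true⇒T eq₂) = refl
    ... | false | false | true  rewrite tri⇒Z 1 0 2 e (true⇒T eq₃) = refl
    ... | false | false | false = refl

    split-full : ∀ e → ind (full e) ≡ ind (gadget e) + ind (f e)
    split-full e with full e in eq₁ | gadget e in eq₂
    ... | true  | true  = refl
    ... | true  | false = refl
    ... | false | false = refl
    ... | false | true  = contradiction (subst T eq₁ (gadget⇒full e (true⇒T eq₂))) id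

    uniform : ∀ e → T (f e) → ∣ e ∣ ≡ 3
    uniform e fe = ≡ᵇ⇒≡ _ 3 (proj₁ (Equivalence.to T-∧ (proj₁ (Equivalence.to (T-∧ {full e}) fe))))

    H : KGraph 3 V
    H = hypergraph f uniform

    split-sum : ∀ (w : Subset V → ℕ) → sumS V (λ e → ind (full e) * w e) ≡
                sumS V (λ e → ind (gadget e) * w e) + sumS V (λ e → ind (f e) * w e)
    split-sum w = trans (sumS-cong {V} (λ e → trans (cong (_* w e) (split-full e)) (*-distribʳ-+ (w e) (ind (gadget e)) _)))
                        (sumS-+ {V} _ _)

    β₂ : ℕ
    β₂ = masked-count W 2

    private
      β : ℕ → ℕ
      β = masked-count W

      γ : ℕ → Fin s → ℕ
      γ = masked-degree W

      μ : ℕ → Subset s → ℕ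
      μ c = ind ∘ masked W c

      ind-tri : ∀ x y z e → ind (tri x y z e) ≡ μ x (take s e) * (μ y (take s (drop s e)) * (μ z (take s (drop s (drop s e))) * 1))
      ind-tri x y z e = trans (ind-∧ (masked W x (take s e)) _) (cong (μ x (take s e) *_)
        (trans (ind-∧ (masked W y (take s (drop s e))) _) (cong (μ y (take s (drop s e)) *_) (ind-∧ (masked W z (take s (drop s (drop s e)))) true))))

      χ₁ : ℕ → Subset (1 * s) → ℕ
      χ₁ z b = μ z (take s b) * 1

      χ₂ : ℕ → ℕ → Subset (2 * s) → ℕ
      χ₂ y z b = μ y (take s b) * χ₁ z (drop s b)

      sum-χ₁ : ∀ z → sumS (1 * s) (χ₁ z) ≡ β z * 1
      sum-χ₁ z = sum-product s 0 (μ z) (const 1)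

      sum-χ₂ : ∀ y z → sumS (2 * s) (χ₂ y z) ≡ β y * (β z * 1)
      sum-χ₂ y z = trans (sum-product s (1 * s) (μ y) (χ₁ z)) (cong (β y *_) (sum-χ₁ z))

    sum-tri : ∀ x y z → sumS V (ind ∘ tri x y z) ≡ masked-count W x * (masked-count W y * (masked-count W z * 1))
    sum-tri x y z = trans (sumS-cong {V} (ind-tri x y z))
      (trans (sum-product s (2 * s) (μ x) (χ₂ y z)) (cong (β x *_) (sum-χ₂ y z)))

    private
      deg-tri : ∀ x y z v {r} → sumS V (λ e → μ x (take s e) * χ₂ y z (drop s e) * ind (lookup e v)) ≡ r →
                sumS V (λ e → ind (tri x y z e) * ind (lookup e v)) ≡ r
      deg-tri x y z v eq = trans (sumS-cong {V} (λ e → cong (_* ind (lookup e v)) (ind-tri x y z e))) eq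

      deg₀ : ∀ x y z i → sumS V (λ e → ind (tri x y z e) * ind (lookup e (i ↑ˡ (2 * s)))) ≡ γ x i * (β y * (β z * 1))
      deg₀ x y z i = deg-tri x y z _ (trans (sum-product-left s (2 * s) (μ x) (χ₂ y z) i) (cong (γ x i *_) (sum-χ₂ y z)))

      deg₁ : ∀ x y z i → sumS V (λ e → ind (tri x y z e) * ind (lookup e (s ↑ʳ (i ↑ˡ (1 * s))))) ≡ β x * (γ y i * (β z * 1))
      deg₁ x y z i = deg-tri x y z _ (trans (sum-product-right s (2 * s) (μ x) (χ₂ y z) _)
        (cong (β x *_) (trans (sum-product-left s (1 * s) (μ y) (χ₁ z) i) (cong (γ y i *_) (sum-χ₁ z)))))

      deg₂ : ∀ x y z i → sumS V (λ e → ind (tri x y z e) * ind (lookup e (s ↑ʳ (s ↑ʳ (i ↑ˡ 0))))) ≡ β x * (β y * (γ z i * 1))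
      deg₂ x y z i = deg-tri x y z _ (trans (sum-product-right s (2 * s) (μ x) (χ₂ y z) _)
        (cong (β x *_) (trans (sum-product-right s (1 * s) (μ y) (χ₁ z) _)
          (cong (β y *_) (sum-product-left s 0 (μ z) (const 1) i)))))

    2β₂ : 2 * β₂ + u ≡ u * u
    2β₂ = subst (λ z → 2 * β₂ + z ≡ z * z) ∣W∣ (masked-count-2 W)

    private
      β₁ : β 1 ≡ u
      β₁ = trans (masked-count-1 W) ∣W∣

      three-∣ : ∀ i → 3 ∣ γ 2 i * u + γ 1 i * β₂
      three-∣ i rewrite masked-degree-1 W i with ind (W i) | ind≤1 (W i) | subst (λ z → γ 2 i + ind (W i) ≡ ind (W i) * z) ∣W∣ (masked-degree-2 W i)
      ... | zero     | _ | eq = subst (3 ∣_) (sym (trans (cong (λ z → z * u + 0) (m+n≡0⇒m≡0 (γ 2 i) eq)) refl)) (3 ∣0)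
      ... | suc zero | _ | eq = subst (3 ∣_) (sym (trans (cong (_+ 1 * β₂) γu) (lem β₂))) (m∣m*n β₂)
        where
        lem : ∀ b → 2 * b + 1 * b ≡ 3 * b
        lem = solve-∀
        lem′ : ∀ g u → g * u + u ≡ (g + 1) * u
        lem′ = solve-∀
        γu : γ 2 i * u ≡ 2 * β₂
        γu = +-cancelʳ-≡ u _ _ (trans (lem′ (γ 2 i) u) (trans (cong (_* u) (trans eq (*-identityˡ u))) (sym 2β₂)))
      ... | suc (suc _) | s≤s () | _

      combine : ∀ v {x y z} → sumS V (λ e → ind (tri 2 1 0 e) * ind (lookup e v)) ≡ x →
        sumS V (λ e → ind (tri 0 2 1 e) * ind (lookup e v)) ≡ y →
        sumS V (λ e → ind (tri 1 0 2 e) * ind (lookup e v)) ≡ z →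
        sumS V (λ e → ind (gadget e) * ind (lookup e v)) ≡ x + (y + z)
      combine v refl refl refl = trans (sumS-cong {V} (λ e → trans (cong (_* ind (lookup e v)) (ind-gadget e))
          (lem (ind (tri 2 1 0 e)) (ind (tri 0 2 1 e)) (ind (tri 1 0 2 e)) (ind (lookup e v)))))
        (trans (sumS-+ {V} _ _) (cong (sumS V (λ e → ind (tri 2 1 0 e) * ind (lookup e v)) +_) (sumS-+ {V} _ _)))
        where
        lem : ∀ a b c d → (a + (b + c)) * d ≡ a * d + (b * d + c * d)
        lem = solve-∀

      β₀ : β 0 ≡ 1
      β₀ = masked-count-0 W

    gadget-degree : ∀ v → 3 ∣ sumS V (λ e → ind (gadget e) * ind (lookup e v))
    gadget-degree v with side s (2 * s) v
    ... | left i = subst (3 ∣_) (sym (trans (combine _ (deg₀ 2 1 0 i) (deg₀ 0 2 1 i) (deg₀ 1 0 2 i)) eq)) (three-∣ i)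
      where
      lem : ∀ a b u w → a * (u * (1 * 1)) + (0 * (b * (u * 1)) + w * (1 * (b * 1))) ≡ a * u + w * b
      lem = solve-∀
      eq : γ 2 i * (β 1 * (β 0 * 1)) + (γ 0 i * (β 2 * (β 1 * 1)) + γ 1 i * (β 0 * (β 2 * 1))) ≡ γ 2 i * u + γ 1 i * β₂
      eq rewrite β₁ | β₀ | masked-degree-0 W i = lem (γ 2 i) β₂ u (γ 1 i)
    ... | right v′ with side s (1 * s) v′
    ...   | left i = subst (3 ∣_) (sym (trans (combine _ (deg₁ 2 1 0 i) (deg₁ 0 2 1 i) (deg₁ 1 0 2 i)) eq)) (three-∣ i)
      where
      lem : ∀ a b u w → b * (w * (1 * 1)) + (1 * (a * (u * 1)) + u * (0 * (b * 1))) ≡ a * u + w * b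
      lem = solve-∀
      eq : β 2 * (γ 1 i * (β 0 * 1)) + (β 0 * (γ 2 i * (β 1 * 1)) + β 1 * (γ 0 i * (β 2 * 1))) ≡ γ 2 i * u + γ 1 i * β₂
      eq rewrite β₁ | β₀ | masked-degree-0 W i = lem (γ 2 i) β₂ u (γ 1 i)
    ...   | right v″ with side s 0 v″
    ...     | left i = subst (3 ∣_) (sym (trans (combine _ (deg₂ 2 1 0 i) (deg₂ 0 2 1 i) (deg₂ 1 0 2 i)) eq)) (three-∣ i)
      where
      lem : ∀ a b u w → b * (u * (0 * 1)) + (1 * (b * (w * 1)) + u * (1 * (a * 1))) ≡ a * u + w * b
      lem = solve-∀
      eq : β 2 * (β 1 * (γ 0 i * 1)) + (β 0 * (β 2 * (γ 1 i * 1)) + β 1 * (β 0 * (γ 2 i * 1))) ≡ γ 2 i * u + γ 1 i * β₂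
      eq rewrite β₁ | β₀ | masked-degree-0 W i = lem (γ 2 i) β₂ u (γ 1 i)

    gadget-size : sumS V (ind ∘ gadget) ≡ 3 * (β₂ * u)
    gadget-size = trans (sumS-cong {V} ind-gadget) (trans (sumS-+ {V} _ _) (trans (cong (sumS V (ind ∘ tri 2 1 0) +_) (sumS-+ {V} _ _))
      (trans (cong₂ _+_ (sum-tri 2 1 0) (cong₂ _+_ (sum-tri 0 2 1) (sum-tri 1 0 2))) eq)))
      where
      lem : ∀ b u → b * (u * (1 * 1)) + (1 * (b * (u * 1)) + u * (1 * (b * 1))) ≡ 3 * (b * u)
      lem = solve-∀
      eq : β 2 * (β 1 * (β 0 * 1)) + (β 0 * (β 2 * (β 1 * 1)) + β 1 * (β 0 * (β 2 * 1))) ≡ 3 * (β₂ * u)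
      eq rewrite β₁ | β₀ = lem β₂ u

    gadget-total-charge : sumS V (λ e → ind (gadget e) * charge (Z e)) ≡ β₂ * u
    gadget-total-charge = trans (sumS-cong {V} gadget-charge) (trans (sum-tri 2 1 0) eq)
      where
      lem : ∀ b u → b * (u * (1 * 1)) ≡ b * u
      lem = solve-∀
      eq : β 2 * (β 1 * (β 0 * 1)) ≡ β₂ * u
      eq rewrite β₁ | β₀ = lem β₂ u

    module _ {ℓ : ℕ} (vanishing : Vanishing (3 * ℓ) 3 s) (ℓ∣u : ℓ ∣ u) where

      private
        Q : Vec ℕ 3 → ℕ
        Q c = ind ((total c ≡ᵇ 3) ∧ two-coloured (dot code c))

        ind-full : ∀ e → ind (full e) ≡ Q (cnt 3 s e)
        ind-full e rewrite sym (total-cnt 3 s e) | sumIn-color 3 s code e = refl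

        bounded : Bounded {t = s} vanishing Q
        bounded c lt rewrite ≡ᵇ-false (>⇒≢ lt) = refl

        mono-vanish : ∀ c → T (mono c) → Q c ≡ 0
        mono-vanish (0 ∷ 0 ∷ 0 ∷ []) _ = refl
        mono-vanish (0 ∷ 0 ∷ 1 ∷ []) _ = refl
        mono-vanish (0 ∷ 0 ∷ 2 ∷ []) _ = refl
        mono-vanish (0 ∷ 0 ∷ 3 ∷ []) _ = refl
        mono-vanish (0 ∷ 0 ∷ suc (suc (suc (suc x))) ∷ []) _ = refl
        mono-vanish (0 ∷ 1 ∷ 0 ∷ []) _ = refl
        mono-vanish (0 ∷ 2 ∷ 0 ∷ []) _ = refl
        mono-vanish (0 ∷ 3 ∷ 0 ∷ []) _ = refl
        mono-vanish (0 ∷ suc (suc (suc (suc x))) ∷ 0 ∷ []) _ = refl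
        mono-vanish (1 ∷ 0 ∷ 0 ∷ []) _ = refl
        mono-vanish (2 ∷ 0 ∷ 0 ∷ []) _ = refl
        mono-vanish (3 ∷ 0 ∷ 0 ∷ []) _ = refl
        mono-vanish (suc (suc (suc (suc x))) ∷ 0 ∷ 0 ∷ []) _ = refl

      divisible : Divisible ℓ H
      divisible = subst (ℓ ∣_) (sym (∣edges∣ f uniform)) (∣m+n∣m⇒∣n
                    (subst (ℓ ∣_) (trans (sumS-cong {V} split-full) (sumS-+ {V} _ _))
                      (∣-trans (n∣m*n 3) (subst (3 * ℓ ∣_) (sym (sumS-cong {V} ind-full)) (sum-∣ {t = s} vanishing 3 Q bounded refl))))
                    (subst (ℓ ∣_) (sym gadget-size) (∣n⇒∣m*n 3 (∣n⇒∣m*n β₂ ℓ∣u))))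
                , λ v → subst (3 ∣_) (sym (degree-sum f uniform v)) (∣m+n∣m⇒∣n
                    (subst (3 ∣_) (split-sum (λ e → ind (lookup e v)))
                      (∣-trans (m∣m*n ℓ) (subst (3 * ℓ ∣_) (sym (sumS-cong {V} (λ e → cong (_* ind (lookup e v)) (ind-full e))))
                        (degree-∣ {t = s} vanishing 3 Q bounded mono-vanish v))))
                    (gadget-degree v))

      full-charge : 3 ∣ sumS V (λ e → ind (full e) * charge (Z e))
      full-charge = ∣-trans (m∣m*n ℓ) (subst (3 * ℓ ∣_)
        (sym (sumS-cong {V} (λ e → cong₂ _*_ (ind-full e) (cong charge (sumIn-color 3 s code e)))))
        (sum-∣ {t = s} vanishing 3 (λ c → Q c * charge (dot code c)) (λ c lt → cong (_* charge (dot code c)) (bounded c lt)) refl))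

      -- The charge of H is that of the full two-coloured hypergraph minus that of the gadget.
      no-decomposition : ∀ L → ℓ ≡ suc L → 3 < ℓ → ¬ 3 ∣ β₂ * u → ¬ HasDecomposition ℓ H
      no-decomposition L refl 3<ℓ 3∤ dec = 3∤ (subst (3 ∣_) gadget-total-charge
          (∣m+n∣m⇒∣n (subst (3 ∣_) (trans (split-sum (charge ∘ Z)) (+-comm (sumS V (λ e → ind (gadget e) * charge (Z e))) _)) full-charge) charge-H))
        where
        two-all : All (λ e → T (two-coloured (Z e))) (edges H)
        two-all = All.map (λ {e} fe → proj₂ (Equivalence.to (T-∧ {∣ e ∣ ≡ᵇ 3}) (proj₁ (Equivalence.to (T-∧ {full e}) fe))))
                    (All.all-filter (λ e → T? (f e)) (subsets V))
        on-cycle : ∀ C → All (λ e → T (two-coloured (Z e))) (cycleEdges 3 C) → 3 ∣ sumL (charge ∘ Z) (cycleEdges 3 C)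
        on-cycle C all = subst (3 ∣_) (sym (sumL-cycleEdges C 3 3<ℓ (code ∘ color 3 s) charge))
          (cyclic-charge (suc L) (color 3 s ∘ at C) (λ i → cong (color 3 s) (at-periodic C i)) λ i i<ℓ →
            subst (T ∘ two-coloured) (trans (sumIn-cycleEdge C 3 3<ℓ (code ∘ color 3 s) (fromℕ< i<ℓ))
                (cong (λ m → sumN 3 (λ j → code (color 3 s (at C (m + j))))) (toℕ-fromℕ< i<ℓ)))
              (All.lookup (All.map⁻ all) (∈-allFin (fromℕ< i<ℓ))))
        charge-H : 3 ∣ sumS V (λ e → ind (f e) * charge (Z e))
        charge-H = subst (3 ∣_) (sumL-edges f uniform (charge ∘ Z)) (decomposition-∣ H dec 3 (charge ∘ Z) two-all on-cycle)

  -- A pair inside one class is completed from either other class, a pair across two classes from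
  -- either of these two.
  two-completions : ∀ (c : Vec ℕ 3) → total c ≡ 2 → 2 ≤ sumF 3 (λ γ → ind (two-coloured (code γ + dot code c)))
  two-completions (0 ∷ 0 ∷ 2 ∷ []) _ = ≤-refl
  two-completions (0 ∷ 1 ∷ 1 ∷ []) _ = ≤-refl
  two-completions (0 ∷ 2 ∷ 0 ∷ []) _ = ≤-refl
  two-completions (1 ∷ 0 ∷ 1 ∷ []) _ = ≤-refl
  two-completions (1 ∷ 1 ∷ 0 ∷ []) _ = ≤-refl
  two-completions (2 ∷ 0 ∷ 0 ∷ []) _ = ≤-refl
  two-completions (0 ∷ 0 ∷ 0 ∷ []) ()
  two-completions (0 ∷ 0 ∷ 1 ∷ []) ()
  two-completions (0 ∷ 0 ∷ suc (suc (suc _)) ∷ []) ()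
  two-completions (0 ∷ 1 ∷ 0 ∷ []) ()
  two-completions (0 ∷ 1 ∷ suc (suc _) ∷ []) ()
  two-completions (0 ∷ 2 ∷ suc _ ∷ []) ()
  two-completions (0 ∷ suc (suc (suc _)) ∷ _ ∷ []) ()
  two-completions (1 ∷ 0 ∷ 0 ∷ []) ()
  two-completions (1 ∷ 0 ∷ suc (suc _) ∷ []) ()
  two-completions (1 ∷ 1 ∷ suc _ ∷ []) ()
  two-completions (1 ∷ suc (suc _) ∷ _ ∷ []) ()
  two-completions (2 ∷ 0 ∷ suc _ ∷ []) ()
  two-completions (2 ∷ suc _ ∷ _ ∷ []) ()
  two-completions (suc (suc (suc _)) ∷ _ ∷ _ ∷ []) ()

  module _ (s u : ℕ) (u≤s : u ≤ s) where

    open ThreeClasses s u u≤s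

    -- Of the `2 * s` completions at most 2 are vertices of `S`, and at most the whole gadget is
    -- deleted; the size of the gadget depends only on `u`.
    three-minCodegree : ∀ x → x + (2 + 3 * (β₂ * u)) ≡ 2 * s → x ≤ minCodegree H
    three-minCodegree x x≡ = minCodegree-≥ H x x≤V λ S ∣S∣ →
      ≤-trans (+-cancelʳ-≤ (2 + 3 * (β₂ * u)) _ _ (≤-trans (≤-reflexive x≡) (bound S ∣S∣))) (codegree-≥ f uniform S)
      where
      x≤V : x ≤ V
      x≤V = ≤-trans (m≤m+n x _) (≤-trans (≤-reflexive x≡) (*-monoˡ-≤ s {2} {3} (s≤s (s≤s z≤n))))
      bound : ∀ S → ∣ S ∣ ≡ 2 → 2 * s ≤ sumOut S (λ v → ind (f (S [ v ]≔ inside))) + (2 + 3 * (β₂ * u))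
      bound S ∣S∣ = begin
        2 * s ≡⟨ *-comm 2 s ⟩
        s * 2 ≤⟨ *-monoʳ-≤ s (two-completions (cnt 3 s S) (trans (total-cnt 3 s S) ∣S∣)) ⟩
        s * sumF 3 (λ γ → ind (two-coloured (code γ + dot code (cnt 3 s S))))
          ≡⟨ cong (λ z → s * sumF 3 (λ γ → ind (two-coloured (code γ + z)))) (sumIn-color 3 s code S) ⟨
        s * sumF 3 (λ γ → ind (two-coloured (code γ + Z S)))
          ≡⟨ sumF-color 3 s (λ γ → ind (two-coloured (code γ + Z S))) ⟨
        sumF V h ≡⟨ sumIn+sumOut S h ⟨
        sumIn S h + sumOut S h
          ≤⟨ +-mono-≤ (≤-trans (sumIn-mono S (λ v → ind≤1 (two-coloured (code (color 3 s v) + Z S)))) (≤-reflexive (trans (sumIn-one S) ∣S∣)))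
               (≤-reflexive (trans (sumOut-cong S completes) (sumOut-+ S _ _))) ⟩
        2 + (sumOut S (λ v → ind (gadget (S [ v ]≔ inside))) + sumOut S (λ v → ind (f (S [ v ]≔ inside))))
          ≤⟨ +-monoʳ-≤ 2 (+-monoˡ-≤ _ (≤-trans (sumOut≤sumS S (ind ∘ gadget)) (≤-reflexive gadget-size))) ⟩
        2 + (3 * (β₂ * u) + sumOut S (λ v → ind (f (S [ v ]≔ inside))))
          ≡⟨ trans (sym (+-assoc 2 (3 * (β₂ * u)) _)) (+-comm (2 + 3 * (β₂ * u)) _) ⟩
        sumOut S (λ v → ind (f (S [ v ]≔ inside))) + (2 + 3 * (β₂ * u)) ∎
        where
        open ≤-Reasoning
        h : Fin V → ℕ
        h v = ind (two-coloured (code (color 3 s v) + Z S))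
        completes : ∀ v → lookup S v ≡ outside → h v ≡ ind (gadget (S [ v ]≔ inside)) + ind (f (S [ v ]≔ inside))
        completes v v∉ = trans (sym full-insert) (split-full (S [ v ]≔ inside))
          where
          full-insert : ind (full (S [ v ]≔ inside)) ≡ h v
          full-insert rewrite ∣insert∣ S v v∉ | ∣S∣ | sumIn-insert S (code ∘ color 3 s) v v∉ = refl

  -- `2 * (b * u)` equals `u * u * u - u * u`, which for `u` congruent to 2 is congruent to
  -- `8 - 4 = 4` modulo 3.
  charge-nonzero : ∀ b u z → u ≡ 3 * z + 2 → 2 * b + u ≡ u * u → ¬ 3 ∣ b * u
  charge-nonzero b u z u≡ 2b div = 3∤4 (∣m+n∣m⇒∣n {n = 4}
      (subst (3 ∣_) (+-cancelʳ-≡ 4 _ _ eq) (∣m∣n⇒∣m+n (∣n⇒∣m*n 2 div) (m∣m*n (3 * z * z + 4 * z))))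
      (m∣m*n (9 * z * z * z + 18 * z * z + 12 * z)))
    where
    open ≡-Reasoning
    3∤4 : ¬ 3 ∣ 4
    3∤4 = from-no (3 ∣? 4)
    expand : ∀ b u → 2 * (b * u) + u * u ≡ (2 * b + u) * u
    expand = solve-∀
    square : ∀ z → (3 * z + 2) * (3 * z + 2) ≡ 3 * (3 * z * z + 4 * z) + 4
    square = solve-∀
    cube : ∀ z → (3 * z + 2) * (3 * z + 2) * (3 * z + 2) ≡ 3 * (9 * z * z * z + 18 * z * z + 12 * z) + 4 + 4
    cube = solve-∀
    eq : 2 * (b * u) + 3 * (3 * z * z + 4 * z) + 4 ≡ 3 * (9 * z * z * z + 18 * z * z + 12 * z) + 4 + 4
    eq = begin
      2 * (b * u) + 3 * (3 * z * z + 4 * z) + 4   ≡⟨ +-assoc (2 * (b * u)) _ 4 ⟩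
      2 * (b * u) + (3 * (3 * z * z + 4 * z) + 4) ≡⟨ cong (2 * (b * u) +_) (trans (sym (square z)) (cong (λ w → w * w) (sym u≡))) ⟩
      2 * (b * u) + u * u                         ≡⟨ trans (expand b u) (cong (_* u) 2b) ⟩
      u * u * u                                   ≡⟨ trans (cong (λ w → w * w * w) u≡) (cube z) ⟩
      _ ∎

  -- For k = 3 and ℓ ≡ 2 mod 3 the space barrier is too weak; this divisibility barrier gives 2/3.
  triple-obstruction : ∀ L → 3 < suc L → ¬ 3 ∣ suc L → Obstruction 3 (suc L) 2 2
  triple-obstruction L 3<ℓ 3∤ℓ N n₀ = V , n₀≤V , H , divisible vanishing ℓ∣u
      , no-decomposition vanishing ℓ∣u L refl 3<ℓ 3∤β₂u
      , ≤-trans dense (+-monoˡ-≤ V (*-monoˡ-≤ (3 * suc N) (three-minCodegree s u u≤s x x≡)))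
    where
    ℓ u y s : ℕ
    ℓ = suc L
    -- A multiple of `ℓ`, and congruent to 2 modulo 3 because the square of `ℓ` is congruent to 1.
    u = 2 * (ℓ * ℓ)
    -- Large enough for `s` to exceed `u`, `n₀` and `suc N` times the codegree loss, by means of
    -- `β₂ ≤ u * u`.
    y = suc (suc N * (2 + 3 * (u * u * u)) + u + n₀)
    s = 3 ! * (3 * ℓ) * y
    y≤s : y ≤ s
    y≤s = m≤n*m y (3 ! * (3 * ℓ))
    u≤s : u ≤ s
    u≤s = ≤-trans (≤-trans (m≤n+m u (suc N * (2 + 3 * (u * u * u)))) (≤-trans (m≤m+n _ n₀) (n≤1+n _))) y≤s
    open ThreeClasses s u u≤s
    vanishing : Vanishing (3 * ℓ) 3 s
    vanishing = factorial-vanishing (3 * ℓ) 3 y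
    ℓ∣u : ℓ ∣ u
    ℓ∣u = ∣n⇒∣m*n 2 (m∣m*n ℓ)
    n₀≤V : n₀ ≤ V
    n₀≤V = ≤-trans (≤-trans (≤-trans (m≤n+m n₀ _) (n≤1+n _)) y≤s) (m≤n*m s 3)
    Γ : ℕ
    Γ = 2 + 3 * (β₂ * u)
    Γ≤ : suc N * Γ ≤ s
    Γ≤ = ≤-trans (*-monoʳ-≤ (suc N) (+-monoʳ-≤ 2 (*-monoʳ-≤ 3 (*-monoˡ-≤ u β₂≤))))
          (≤-trans (≤-trans (m≤m+n _ (u + n₀)) (≤-trans (≤-reflexive (sym (+-assoc (suc N * (2 + 3 * (u * u * u))) u n₀))) (n≤1+n _))) y≤s)
      where
      β₂≤ : β₂ ≤ u * u
      β₂≤ = ≤-trans (m≤m+n β₂ (β₂ + 0)) (≤-trans (m≤m+n _ u) (≤-reflexive 2β₂))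
    x : ℕ
    x = 2 * s ∸ Γ
    x≡ : x + Γ ≡ 2 * s
    x≡ = m∸n+n≡m (≤-trans (m≤n*m Γ (suc N)) (≤-trans Γ≤ (m≤n*m s 2)))
    dense : V * (2 * suc N) ≤ x * (3 * suc N) + V
    dense = begin
      3 * s * (2 * suc N)               ≡⟨ lem s (suc N) ⟩
      2 * s * (3 * suc N)               ≡⟨ cong (_* (3 * suc N)) x≡ ⟨
      (x + Γ) * (3 * suc N)             ≡⟨ lem′ x Γ (suc N) ⟩
      x * (3 * suc N) + 3 * (suc N * Γ) ≤⟨ +-monoʳ-≤ (x * (3 * suc N)) (*-monoʳ-≤ 3 Γ≤) ⟩
      x * (3 * suc N) + V               ∎
      where
      open ≤-Reasoning
      lem : ∀ s N → 3 * s * (2 * N) ≡ 2 * s * (3 * N)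
      lem = solve-∀
      lem′ : ∀ x Γ N → (x + Γ) * (3 * N) ≡ x * (3 * N) + 3 * (N * Γ)
      lem′ = solve-∀
    u-mod-3 : ∃[ z ] u ≡ 3 * z + 2
    u-mod-3 with ℓ % 3 in eq | m≡m%n+[m/n]*n ℓ 3 | m%n<n ℓ 3
    ... | 0 | _  | _ = contradiction (m%n≡0⇒n∣m ℓ 3 eq) 3∤ℓ
    ... | 1 | ℓ≡ | _ = 4 * (ℓ / 3) + 6 * (ℓ / 3) * (ℓ / 3) , trans (cong (λ z → 2 * (z * z)) ℓ≡) (lem (ℓ / 3))
      where
      lem : ∀ q → 2 * ((1 + q * 3) * (1 + q * 3)) ≡ 3 * (4 * q + 6 * q * q) + 2
      lem = solve-∀
    ... | 2 | ℓ≡ | _ = 2 + 8 * (ℓ / 3) + 6 * (ℓ / 3) * (ℓ / 3) , trans (cong (λ z → 2 * (z * z)) ℓ≡) (lem (ℓ / 3))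
      where
      lem : ∀ q → 2 * ((2 + q * 3) * (2 + q * 3)) ≡ 3 * (2 + 8 * q + 6 * q * q) + 2
      lem = solve-∀
    ... | suc (suc (suc _)) | _ | s≤s (s≤s (s≤s ()))
    3∤β₂u : ¬ 3 ∣ β₂ * u
    3∤β₂u = let (z , u≡) = u-mod-3 in charge-nonzero β₂ u z u≡ 2β₂

  -- The bounds as rational numbers

  half-plus : ∀ a b → 2 * a ≡ 2 + suc b → ½ ℚ.+ 1ℚ ⟋ suc b ≡ fromℚᵘ (mkℚᵘ (ℤ.+ a) b)
  half-plus a b eq = trans (cong (½ ℚ.+_) (ℚ.*-identityˡ (fromℚᵘ (mkℚᵘ (ℤ.+ 1) b)))) (ℚ.toℚᵘ-injective (begin
    toℚᵘ (½ ℚ.+ fromℚᵘ (mkℚᵘ (ℤ.+ 1) b))         ≈⟨ ℚ.toℚᵘ-homo-+ ½ (fromℚᵘ (mkℚᵘ (ℤ.+ 1) b)) ⟩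
    toℚᵘ ½ ℚᵘ.+ toℚᵘ (fromℚᵘ (mkℚᵘ (ℤ.+ 1) b))   ≈⟨ ℚᵘ.+-congʳ (toℚᵘ ½) (ℚ.toℚᵘ-fromℚᵘ (mkℚᵘ (ℤ.+ 1) b)) ⟩
    mkℚᵘ (ℤ.+ 1) 1 ℚᵘ.+ mkℚᵘ (ℤ.+ 1) b             ≈⟨ *≡* (trans (cong ℤ.+_ (trans (lem b) (trans (cong (_* suc b) (sym eq)) (lem′ a b)))) (ℤ.pos-* a (2 * suc b))) ⟩
    mkℚᵘ (ℤ.+ a) b                               ≈⟨ ℚ.toℚᵘ-fromℚᵘ (mkℚᵘ (ℤ.+ a) b) ⟨
    toℚᵘ (fromℚᵘ (mkℚᵘ (ℤ.+ a) b)) ∎))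
    where
    open ℚᵘ.≃-Reasoning
    lem : ∀ b → (1 * suc b + 1 * 2) * suc b ≡ (2 + suc b) * suc b
    lem = solve-∀
    lem′ : ∀ a b → 2 * a * suc b ≡ a * (2 * suc b)
    lem′ = solve-∀

  ⟋-nonNeg : ∀ d → 0ℚ ℚ.≤ 1ℚ ⟋ d
  ⟋-nonNeg zero    = ℚ.≤-refl
  ⟋-nonNeg (suc d) = subst (0ℚ ℚ.≤_) (sym (ℚ.*-identityˡ (ℤ.+ 1 ℚ./ suc d))) (ℚ.nonNegative⁻¹ (ℤ.+ 1 ℚ./ suc d) {{ℚ.normalize-nonNeg 1 (suc d)}})

  damped-≤ : ∀ d b → ½ ℚ.+ (1ℚ ℚ.- 1ℚ ⟋ d) ⟋ suc b ℚ.≤ ½ ℚ.+ 1ℚ ⟋ suc b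
  damped-≤ d b = ℚ.+-monoʳ-≤ ½ (ℚ.*-monoʳ-≤-nonNeg (ℤ.+ 1 ℚ./ suc b) {{ℚ.normalize-nonNeg 1 (suc b)}}
    (subst (1ℚ ℚ.- 1ℚ ⟋ d ℚ.≤_) (ℚ.+-identityʳ 1ℚ) (ℚ.+-monoʳ-≤ 1ℚ (ℚ.neg-antimono-≤ (⟋-nonNeg d)))))

  fraction-≤ : ∀ a b c d → a * suc d ≤ c * suc b → fromℚᵘ (mkℚᵘ (ℤ.+ a) b) ℚ.≤ fromℚᵘ (mkℚᵘ (ℤ.+ c) d)
  fraction-≤ a b c d le = ℚ.toℚᵘ-cancel-≤ (begin
    toℚᵘ (fromℚᵘ (mkℚᵘ (ℤ.+ a) b)) ≃⟨ ℚ.toℚᵘ-fromℚᵘ (mkℚᵘ (ℤ.+ a) b) ⟩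
    mkℚᵘ (ℤ.+ a) b                 ≤⟨ *≤* (subst₂ ℤ._≤_ (ℤ.pos-* a (suc d)) (ℤ.pos-* c (suc b)) (ℤ.+≤+ le)) ⟩
    mkℚᵘ (ℤ.+ c) d                 ≃⟨ ℚ.toℚᵘ-fromℚᵘ (mkℚᵘ (ℤ.+ c) d) ⟨
    toℚᵘ (fromℚᵘ (mkℚᵘ (ℤ.+ c) d)) ∎)
    where open ℚᵘ.≤-Reasoning

  lower-bounds : ∀ (k ℓ : ℕ) → 3 ≤ k → k < ℓ → ¬ (k ∣ ℓ) →
      ∀ (δ : ℝ) → IsThreshold k ℓ δ →
      (fromℚ (½ ℚ.+ 1ℚ ⟋ (4 * (ℓ ∸ 1))) ≤ᴿ δ)
      × (2 ∣ quotient (gcd[m,n]∣n ℓ k) →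
      fromℚ (½ ℚ.+ 1ℚ ⟋ (2 * (ℓ ∸ 1))) ≤ᴿ δ)
      × (gcd ℓ k ≡ 1 → ¬ (2 ∣ k) →
      fromℚ (½ ℚ.+ (1ℚ ℚ.- 1ℚ ⟋ (2 ^ k)) ⟋ (2 * (ℓ ∸ 1))) ≤ᴿ δ)
  lower-bounds (suc κ) (suc (suc L′)) (s≤s 2≤κ) k<ℓ k∤ℓ δ threshold =
      obstruction⇒≤ {a = suc (2 * suc L′)} {b = L′ + 3 * suc L′} (general-obstruction κ (suc L′) 2≤κ k<ℓ L′ refl k∤ℓ)
        (ℚ.≤-reflexive (half-plus (suc (2 * suc L′)) (L′ + 3 * suc L′) (quarter L′))) δ forces
    , (λ 2∣ → obstruction⇒≤ {a = suc (suc L′)} {b = L′ + 1 * suc L′} (even-obstruction κ (suc L′) 2≤κ k<ℓ L′ refl 2∣) (ℚ.≤-reflexive half) δ forces)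
    , odd-case κ 2≤κ k<ℓ k∤ℓ forces
    where
    open IsThreshold threshold using (forces)
    quarter : ∀ L → 2 * suc (2 * suc L) ≡ 2 + suc (L + 3 * suc L)
    quarter = solve-∀
    half : ½ ℚ.+ 1ℚ ⟋ (2 * suc L′) ≡ fromℚᵘ (mkℚᵘ (ℤ.+ suc (suc L′)) (L′ + 1 * suc L′))
    half = half-plus (suc (suc L′)) (L′ + 1 * suc L′) (lem L′)
      where
      lem : ∀ L → 2 * suc (suc L) ≡ 2 + suc (L + 1 * suc L)
      lem = solve-∀
    damped : ∀ d → ½ ℚ.+ (1ℚ ℚ.- 1ℚ ⟋ d) ⟋ (2 * suc L′) ℚ.≤ fromℚᵘ (mkℚᵘ (ℤ.+ suc (suc L′)) (L′ + 1 * suc L′))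
    damped d = ℚ.≤-trans (damped-≤ d (L′ + 1 * suc L′)) (ℚ.≤-reflexive half)
    odd-case : ∀ κ → 2 ≤ κ → suc κ < suc (suc L′) → ¬ (suc κ ∣ suc (suc L′)) → Forces (suc κ) (suc (suc L′)) δ →
      gcd (suc (suc L′)) (suc κ) ≡ 1 → ¬ (2 ∣ suc κ) →
      fromℚ (½ ℚ.+ (1ℚ ℚ.- 1ℚ ⟋ (2 ^ suc κ)) ⟋ (2 * suc L′)) ≤ᴿ δ
    -- For `k = 3`, the value `2 / 3` is at least `1 / 2 + 1 / (2 * (ℓ - 1))` as soon as `ℓ ≥ 4`.
    odd-case 2 _ k<ℓ k∤ℓ forces _ _ = obstruction⇒≤ {a = 2} {b = 2} (triple-obstruction (suc L′) k<ℓ k∤ℓ)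
      (ℚ.≤-trans (damped (2 ^ 3)) (fraction-≤ (suc (suc L′)) (L′ + 1 * suc L′) 2 2 (two-thirds L′ (s≤s⁻¹ (s≤s⁻¹ k<ℓ))))) δ forces
      where
      two-thirds : ∀ L → 2 ≤ L → suc (suc L) * 3 ≤ 2 * suc (L + 1 * suc L)
      two-thirds 1 (s≤s ())
      two-thirds (suc (suc L)) _ = ≤-trans (m≤m+n _ L) (≤-reflexive (lem L))
        where
        lem : ∀ L → suc (suc (suc (suc L))) * 3 + L ≡ 2 * suc (suc (suc L) + 1 * suc (suc (suc L)))
        lem = solve-∀
    odd-case 3 _ _ _ _ _ odd-k = contradiction (divides 2 refl) odd-k
    -- Here `κ = 4 + q`, and the obstruction is applied with `suc (suc q)`, which is at least 2.
    odd-case (suc (suc (suc (suc q)))) 2≤κ k<ℓ k∤ℓ forces gcd≡1 odd-k = obstruction⇒≤ {a = suc (suc L′)} {b = L′ + 1 * suc L′}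
      (coprime-obstruction (suc (suc (suc (suc q)))) (suc L′) 2≤κ k<ℓ L′ refl (suc (suc q)) refl (s≤s (s≤s z≤n)) gcd≡1 (¬2∣⇒odd (5 + q) odd-k)) (damped (2 ^ (5 + q))) δ forces
    odd-case 1 (s≤s ()) _ _ _ _ _
  lower-bounds (suc κ) 1 _ (s≤s ()) _ _ _

open import Data.Rational.Base using (½; 1ℚ; _+_; _-_)

corollary2p4 : ∀ (k ℓ : ℕ) → 3 ≤ k → k < ℓ → ¬ (k ∣ ℓ) →
    ∀ (δ : ℝ) → IsThreshold k ℓ δ →
    (fromℚ (½ + 1ℚ ⟋ (4 * (ℓ ∸ 1))) ≤ᴿ δ)
    × (2 ∣ quotient (gcd[m,n]∣n ℓ k) →
    fromℚ (½ + 1ℚ ⟋ (2 * (ℓ ∸ 1))) ≤ᴿ δ)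
    × (gcd ℓ k ≡ 1 → ¬ (2 ∣ k) →
    fromℚ (½ + (1ℚ - 1ℚ ⟋ (2 ^ k)) ⟋ (2 * (ℓ ∸ 1))) ≤ᴿ δ)
corollary2p4 = Barriers.lower-bounds
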